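{- For every integer $N\geq 2$, $$\varepsilon_0(N,3)=2\sum_{i=0}^{N-2}\Bigl(\varepsilon_0(i)\,\varepsilon_0(N-i-1,3)+\varepsilon_0(i,2)\,\varepsilon_0(N-i-1,2)\Bigr)+\sum_{i=1}^{2N-3}(i+1)(i+2)\,\tilde{\varepsilon}_0(2N-2,i,2).$$
   Context: Let $N\ge 1$, $K\ge 1$. A gluing datum with $N$ edges and $K$ faces consists of a composition $(m_1,\dots,m_K)$ of $2N$ into positive integers and a fixed-point-free involution $\iota$ of $\{1,\dots,2N\}$. With $s_0=0$, $s_i=m_1+\dots+m_i$, let $\tau$ be the permutation with cycles $(s_{i-1}+1,\dots,s_i)$, $i=1,\dots,K$. The datum is connected if $\langle\iota,\tau\rangle$ acts transitively, and has genus $g$ if $\tau\iota$ has exactly $N-K+2-2g$ cycles. (Geometrically: gluing $K$ numbered polygons with distinguished edges, having $2N$ edges in total, into a connected closed orientable surface of genus $g$ by gluing paired edges with opposite orientations.) $\varepsilon_g(N,K)$ is the number of connected genus-$g$ data; $\varepsilon_0(0,1)=1$, $\varepsilon_g(0,K)=0$ if $g+K>1$; $\varepsilon_g(N):=\varepsilon_g(N,1)$. For integers $n,M,K$, $\tilde{\varepsilon}_0(n,M,K)$ is the number of connected genus-$0$ gluing data with $n/2$ edges (i.e. compositions of $n$) and $K$ faces such that $m_1=M$; it is $0$ if $n$ is odd or if the required composition does not exist. -}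

module Defs where

open import Data.Nat using (ℕ; zero; suc; _+_; _*_; _∸_; _≡ᵇ_; _<ᵇ_; _≤ᵇ_)
open import Data.Bool using (Bool; true; false; _∧_; _∨_; not; if_then_else_)
open import Data.List using (List; []; _∷_; map; concatMap; upTo; filterᵇ; length)
open import Data.Bool.ListAction using (all; any)
open import Data.Nat.ListAction using (sum)

-- Conventions: the 2N positions are 0-indexed, i.e. {0,…,2N-1} instead of {1,…,2N}.
-- Maps on positions are represented as lookup tables (lists of naturals).

-- lookup with default (out-of-range indices map to 0; never used in range)
idx : List ℕ → ℕ → ℕ
idx []       _       = 0
idx (x ∷ xs) zero    = x
idx (x ∷ xs) (suc j) = idx xs j

allTables : ℕ → ℕ → List (List ℕ)
allTables zero    m = [] ∷ []
allTables (suc n) m = concatMap (λ t → map (λ a → a ∷ t) (upTo m)) (allTables n m)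

compositions : ℕ → ℕ → List (List ℕ)
compositions zero    zero    = [] ∷ []
compositions (suc n) zero    = []
compositions n       (suc K) =
  concatMap (λ a → map (λ c → suc a ∷ c) (compositions (n ∸ suc a) K)) (upTo n)

isFPFInvolution : ℕ → List ℕ → Bool
isFPFInvolution n ι =
  all (λ j → not (idx ι j ≡ᵇ j) ∧ (idx ι (idx ι j) ≡ᵇ j)) (upTo n)

-- τ for a composition: cycles (s_{i-1}, …, s_i - 1) on 0-indexed positions;
-- the second argument is the current offset s_{i-1}.
tauAux : List ℕ → ℕ → ℕ → ℕ
tauAux []       off j = j
tauAux (m ∷ ms) off j =
  if j <ᵇ off + m
  then (if suc j <ᵇ off + m then suc j else off)
  else tauAux ms (off + m) j

tau : List ℕ → ℕ → ℕ
tau comp = tauAux comp 0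

iter : (ℕ → ℕ) → ℕ → ℕ → ℕ
iter σ zero    j = j
iter σ (suc k) j = σ (iter σ k j)

-- number of cycles of a permutation σ of {0,…,n-1}:
-- number of j that are the minimum of their σ-cycle
numCycles : ℕ → (ℕ → ℕ) → ℕ
numCycles n σ =
  length (filterᵇ (λ j → all (λ k → j ≤ᵇ iter σ (suc k) j) (upTo n)) (upTo n))

-- points reachable from 0 in at most k steps, each step applying ι or τ.
-- Since ι, τ are permutations of a finite set, the forward closure is the
-- ⟨ι,τ⟩-orbit, and n steps suffice.
reach : ℕ → (ℕ → ℕ) → (ℕ → ℕ) → ℕ → ℕ → Bool
reach n ι τ zero    x = x ≡ᵇ 0
reach n ι τ (suc k) x =
  reach n ι τ k x ∨
  any (λ y → reach n ι τ k y ∧ ((ι y ≡ᵇ x) ∨ (τ y ≡ᵇ x))) (upTo n)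

connected : ℕ → (ℕ → ℕ) → (ℕ → ℕ) → Bool
connected n ι τ = all (reach n ι τ n) (upTo n)

-- the gluing datum (comp, ι) on n = 2N positions is connected of genus 0:
-- #cycles(τι) = N - K + 2, written as 2(#cycles + K) = n + 4.
isGenus0Datum : ℕ → ℕ → List ℕ → List ℕ → Bool
isGenus0Datum n K comp ι =
  isFPFInvolution n ι ∧
  connected n (idx ι) (tau comp) ∧
  (2 * (numCycles n (λ j → tau comp (idx ι j)) + K) ≡ᵇ n + 4)

countData : ℕ → ℕ → (List ℕ → Bool) → ℕ
countData n K P =
  length (concatMap
    (λ comp → if P comp
              then filterᵇ (isGenus0Datum n K comp) (allTables n n)
              else [])
    (compositions n K))

firstIs : ℕ → List ℕ → Bool
firstIs M []      = false
firstIs M (m ∷ _) = m ≡ᵇ M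

ε₀ : ℕ → ℕ → ℕ
ε₀ zero    (suc zero) = 1
ε₀ zero    _          = 0
ε₀ (suc N) K          = countData (2 * suc N) K (λ _ → true)

-- ε̃₀(n,M,K): connected genus-0 data on n positions (n/2 edges), K faces, m₁ = M
-- (0 for odd n: no fixed-point-free involution exists, and the genus equation fails)
ε̃₀ : ℕ → ℕ → ℕ → ℕ
ε̃₀ n M K = countData n K (firstIs M)

Σ[_to_] : ℕ → ℕ → (ℕ → ℕ) → ℕ
Σ[ a to b ] f = sum (map (λ k → f (a + k)) (upTo (suc b ∸ a)))

{-# OPTIONS --safe #-}
-- Remove the edge carrying the distinguished dart x of the first polygon.  If x is
-- glued to a dart of the same polygon, that polygon x u x' v splits into u and v;
-- otherwise x w and v x' v' fuse into w v' v.  If an empty polygon is counted as a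
-- sphere with one vertex, the number of vertices never changes, so Euler's
-- inequality V + K ≤ E + 2 for connected systems follows by induction, and equality
-- forces every splitting edge to separate the surface.  Hence connected genus-0
-- gluings correspond to trees of choices whose number depends on the polygon
-- lengths only and satisfies Tutte's recursion.  Summing that recursion over the
-- lengths of three polygons gives the theorem.

module Submission where

open import Defs
open import Data.Nat using (ℕ; zero; suc; _+_; _*_; _∸_; _≤_; _<_; z≤n; s≤s; _≡ᵇ_; _<ᵇ_; _≤ᵇ_; _≟_; _<?_)
open import Data.Nat.Properties
open import Data.Nat.Solver using (module +-*-Solver)
open import Data.Nat.ListAction using (sum)
open import Data.Nat.ListAction.Properties using (sum-++)
open import Data.Bool using (Bool; true; false; not; if_then_else_; T)
open import Data.Bool.Properties using (T-≡; T-not-≡; T-∧; T-∨) renaming (_≟_ to _≟ᵇ_)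
open import Data.Bool.ListAction using (all; any)
open import Data.Fin using (Fin; toℕ; fromℕ<)
open import Data.Fin.Properties using (pigeonhole; toℕ<n; toℕ-fromℕ<)
open import Data.List using (List; []; _∷_; _++_; map; concat; concatMap; upTo; applyUpTo; filterᵇ; length; cartesianProductWith)
open import Data.List.Properties using (++-assoc; ++-identityʳ; map-++; length-++; length-map; map-∘; length-applyUpTo; map-upTo; ∷-injective; ∷-injectiveˡ; ∷-injectiveʳ)
open import Data.List.Membership.Propositional using (_∈_; _∉_; find; lose)
open import Data.List.Membership.Propositional.Properties
open import Data.List.Membership.DecPropositional _≟_ using (_∈?_)
open import Data.List.Relation.Unary.Any as Any using (Any; here; there)
open import Data.List.Relation.Unary.All as All using (All; []; _∷_)
open import Data.List.Relation.Unary.AllPairs using ([]; _∷_)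
open import Data.List.Relation.Unary.Unique.Propositional using (Unique)
import Data.List.Relation.Unary.Unique.Propositional.Properties as Uniqueₚ
import Data.List.Relation.Binary.Permutation.Propositional as Perm
open import Data.List.Relation.Binary.Permutation.Propositional using (_↭_; ↭-refl; ↭-sym; ↭-trans; ↭-reflexive; module PermutationReasoning)
open import Data.List.Relation.Binary.Permutation.Propositional.Properties using (∈-resp-↭; All-resp-↭; ↭-length; ++⁺ˡ; ++⁺ʳ; ++⁺; shift; shifts; ++-comm)
open import Data.Product using (∃-syntax; _×_; _,_; proj₁; proj₂)
open import Data.Sum using (_⊎_; inj₁; inj₂)
open import Data.Empty using (⊥-elim)
open import Data.Unit using (tt)
open import Function using (_∘_; id; case_of_)
open import Function.Bundles using (Equivalence)
open import Relation.Nullary using (¬_; yes; no; does)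
open import Relation.Nullary.Decidable using (_×-dec_; ¬?; T?)
import Relation.Binary.Construct.Closure.Equivalence as EqC
open EqC using (EqClosure)
open import Relation.Binary.PropositionalEquality using (_≡_; _≢_; refl; sym; trans; cong; cong₂; subst; module ≡-Reasoning)

-- Removing an edge leaves words over scattered positions and a changed face permutation, so the
-- induction cannot stay with `tau`: it speaks of arbitrary words, a fixed `ι` and any `τ` that is
-- cyclic on them. Two kinds of derivation are kept apart. `Vertices` removes edges blindly and only
-- counts vertices; `Planar` also demands that each splitting edge distribute the remaining faces
-- over two independent sides. The number counted by `Vertices` is tied to the cycles of `τ ∘ ι`
-- because each removal bypasses two points of that permutation, and every cycle lost in this way is
-- replaced by an empty word. Connectedness is used in dual form, as constancy of all admissible
-- two-colourings: this passes to subsystems without any handling of paths, and it makes the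
-- distribution of faces at a separating edge unique. The final count does not rest on a pair of
-- inverse functions: for a fixed composition, `Planar` is a relation between involution tables and
-- trees, total and injective in both directions, which gives two inequalities of lengths.

private
  variable
    A B : Set

-- Duplicate-free lists, counting through relations, boolean tests

unique-++⁻ : (xs : List A) {ys : List A} → Unique (xs ++ ys) →
  Unique xs × Unique ys × (∀ {a} → a ∈ xs → a ∉ ys)
unique-++⁻ [] u = [] , u , λ ()
unique-++⁻ (x ∷ xs) {ys} (x≢ ∷ u) with unique-++⁻ xs u
... | ux , uy , dis =
  (All.tabulate (λ a∈ → All.lookup x≢ (∈-++⁺ˡ a∈)) ∷ ux) , uy ,
  λ { (here refl) a∈ys → All.lookup x≢ (∈-++⁺ʳ xs a∈ys) refl
    ; (there a∈xs) a∈ys → dis a∈xs a∈ys }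

unique-++⁺ : {xs ys : List A} → Unique xs → Unique ys →
  (∀ {a} → a ∈ xs → a ∉ ys) → Unique (xs ++ ys)
unique-++⁺ ux uy dis = Uniqueₚ.++⁺ ux uy (λ (p , q) → dis p q)

unique-resp-↭ : {xs ys : List A} → xs ↭ ys → Unique xs → Unique ys
unique-resp-↭ Perm.refl u = u
unique-resp-↭ (Perm.prep x p) (x≢ ∷ u) = All-resp-↭ p x≢ ∷ unique-resp-↭ p u
unique-resp-↭ (Perm.swap x y p) ((x≢y ∷ x≢) ∷ y≢ ∷ u) =
  ((x≢y ∘ sym) ∷ All-resp-↭ p y≢) ∷ All-resp-↭ p x≢ ∷ unique-resp-↭ p u
unique-resp-↭ (Perm.trans p q) u = unique-resp-↭ q (unique-resp-↭ p u)

-- Induction deletes the partner of the head from `ys`; by injectivity no later element relies on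
-- it. A relation in place of a function allows the same correspondence to be used in both
-- directions.
length≤-by-relation : (R : A → B → Set) (xs : List A) (ys : List B) → Unique xs →
  (∀ {x} → x ∈ xs → ∃[ y ] y ∈ ys × R x y) →
  (∀ {x x' y} → x ∈ xs → x' ∈ xs → y ∈ ys → R x y → R x' y → x ≡ x') →
  length xs ≤ length ys
length≤-by-relation R [] ys u tot inj = z≤n
length≤-by-relation {A = A} {B = B} R (x ∷ xs) ys (x≢ ∷ u) tot inj with tot (here refl)
... | y , y∈ , r with ∈-∃++ y∈
... | ys₁ , ys₂ , refl = subst (suc (length xs) ≤_) (sym (↭-length (shift y ys₁ ys₂)))
        (s≤s (length≤-by-relation R xs (ys₁ ++ ys₂) u tot'
          (λ p q b → inj (there p) (there q) (∈-resp-↭ (↭-sym (shift y ys₁ ys₂)) (there b)))))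
  where
  tot' : ∀ {x'} → x' ∈ xs → ∃[ y' ] y' ∈ ys₁ ++ ys₂ × R x' y'
  tot' x'∈ with tot (there x'∈)
  ... | y' , y'∈ , r' with ∈-resp-↭ (shift y ys₁ ys₂) y'∈
  ... | here refl = ⊥-elim (All.lookup x≢ x'∈ (inj (here refl) (there x'∈) y∈ r r'))
  ... | there y'∈' = y' , y'∈' , r'

∈-concatMap⁺′ : (f : A → List B) {xs : List A} {x : A} {y : B} →
  x ∈ xs → y ∈ f x → y ∈ concatMap f xs
∈-concatMap⁺′ f x∈ y∈ = ∈-concat⁺′ y∈ (∈-map⁺ f x∈)

∈-concatMap⁻′ : (f : A → List B) (xs : List A) {y : B} →
  y ∈ concatMap f xs → ∃[ x ] x ∈ xs × y ∈ f x
∈-concatMap⁻′ f xs y∈ with ∈-concat⁻′ (map f xs) y∈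
... | l , y∈l , l∈ with ∈-map⁻ f l∈
... | x , x∈ , refl = x , x∈ , y∈l

unique-concatMap : (f : A → List B) {xs : List A} → Unique xs →
  (∀ {x} → x ∈ xs → Unique (f x)) →
  (∀ {x x' y} → y ∈ f x → y ∈ f x' → x ≡ x') → Unique (concatMap f xs)
unique-concatMap f [] uf key = []
unique-concatMap f {x ∷ xs} (x≢ ∷ u) uf key =
  unique-++⁺ (uf (here refl)) (unique-concatMap f u (uf ∘ there) key)
    λ {a} p q → case ∈-concatMap⁻′ f xs q of λ { (x' , x'∈ , q') → All.lookup x≢ x'∈ (key p q') }

unique-map : (f : A → B) {xs : List A} → (∀ {x y} → f x ≡ f y → x ≡ y) →
  Unique xs → Unique (map f xs)
unique-map f inj = Uniqueₚ.map⁺ inj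

unique-cartesianProductWith : {C : Set} (f : A → B → C) (xs : List A) (ys : List B) →
  (∀ {w x y z} → f w y ≡ f x z → w ≡ x × y ≡ z) →
  Unique xs → Unique ys → Unique (cartesianProductWith f xs ys)
unique-cartesianProductWith f xs ys inj = Uniqueₚ.cartesianProductWith⁺ f inj

length-concatMap : (f : A → List B) (xs : List A) →
  length (concatMap f xs) ≡ sum (map (length ∘ f) xs)
length-concatMap f [] = refl
length-concatMap f (x ∷ xs) =
  trans (length-++ (f x)) (cong (length (f x) +_) (length-concatMap f xs))

∈-filterᵇ⁺ : (p : A → Bool) {xs : List A} {x : A} → x ∈ xs → T (p x) → x ∈ filterᵇ p xs
∈-filterᵇ⁺ p {y ∷ ys} (here refl) px with p y
... | true = here refl
∈-filterᵇ⁺ p {y ∷ ys} (there x∈) px with p y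
... | true = there (∈-filterᵇ⁺ p x∈ px)
... | false = ∈-filterᵇ⁺ p x∈ px

∈-filterᵇ⁻ : (p : A → Bool) (xs : List A) {x : A} → x ∈ filterᵇ p xs → x ∈ xs × T (p x)
∈-filterᵇ⁻ p (y ∷ ys) x∈ with p y in eq
∈-filterᵇ⁻ p (y ∷ ys) (here refl) | true = here refl , subst T (sym eq) tt
∈-filterᵇ⁻ p (y ∷ ys) (there x∈) | true with ∈-filterᵇ⁻ p ys x∈
... | q , r = there q , r
∈-filterᵇ⁻ p (y ∷ ys) x∈ | false with ∈-filterᵇ⁻ p ys x∈
... | q , r = there q , r

unique-filterᵇ : (p : A → Bool) {xs : List A} → Unique xs → Unique (filterᵇ p xs)
unique-filterᵇ p [] = []
unique-filterᵇ p {x ∷ xs} (x≢ ∷ u) with p x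
... | true = All.tabulate (λ a∈ → All.lookup x≢ (proj₁ (∈-filterᵇ⁻ p xs a∈))) ∷ unique-filterᵇ p u
... | false = unique-filterᵇ p u

all⁻ : (p : A → Bool) (xs : List A) → T (all p xs) → ∀ {x} → x ∈ xs → T (p x)
all⁻ p (x ∷ xs) t (here refl) = proj₁ (Equivalence.to T-∧ t)
all⁻ p (x ∷ xs) t (there x∈) = all⁻ p xs (proj₂ (Equivalence.to (T-∧ {p x}) t)) x∈

all⁺ : (p : A → Bool) (xs : List A) → (∀ {x} → x ∈ xs → T (p x)) → T (all p xs)
all⁺ p [] h = tt
all⁺ p (x ∷ xs) h = Equivalence.from T-∧ (h (here refl) , all⁺ p xs (h ∘ there))

any⁻ : (p : A → Bool) (xs : List A) → T (any p xs) → ∃[ x ] x ∈ xs × T (p x)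
any⁻ p (x ∷ xs) t with Equivalence.to (T-∨ {p x}) t
... | inj₁ px = x , here refl , px
... | inj₂ t' with any⁻ p xs t'
... | y , y∈ , py = y , there y∈ , py

any⁺ : (p : A → Bool) {xs : List A} {x : A} → x ∈ xs → T (p x) → T (any p xs)
any⁺ p {x ∷ xs} (here refl) px = Equivalence.from T-∨ (inj₁ px)
any⁺ p {y ∷ xs} (there x∈) px = Equivalence.from (T-∨ {p y}) (inj₂ (any⁺ p x∈ px))

++-injective : (xs : List A) {xs' ys ys' : List A} → length xs ≡ length xs' →
  xs ++ ys ≡ xs' ++ ys' → xs ≡ xs' × ys ≡ ys'
++-injective [] {[]} l e = refl , e
++-injective (x ∷ xs) {x' ∷ xs'} l e =
  let p , q = ++-injective xs (suc-injective l) (∷-injectiveʳ e)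
  in cong₂ _∷_ (∷-injectiveˡ e) p , q

-- Interleavings of two lists

-- The mask is an index because faces are later replaced by their lengths, which may coincide: then
-- only the mask tells which face went to which side.
data Part {A : Set} : List Bool → List A → List A → List A → Set where
  []    : Part [] [] [] []
  left  : ∀ {m xs ys zs x} → Part m xs ys zs → Part (true ∷ m) (x ∷ xs) ys (x ∷ zs)
  right : ∀ {m xs ys zs y} → Part m xs ys zs → Part (false ∷ m) xs (y ∷ ys) (y ∷ zs)

part-swap : {A : Set} {m : List Bool} {xs ys zs : List A} → Part m xs ys zs → Part (map not m) ys xs zs
part-swap [] = []
part-swap (left p) = right (part-swap p)
part-swap (right p) = left (part-swap p)

part-remove : {A : Set} {m : List Bool} (xs₁ : List A) {xs₂ ys zs : List A} {x : A} →
  Part m (xs₁ ++ x ∷ xs₂) ys zs →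
  ∃[ zs₁ ] ∃[ zs₂ ] ∃[ m' ] zs ≡ zs₁ ++ x ∷ zs₂ × Part m' (xs₁ ++ xs₂) ys (zs₁ ++ zs₂)
part-remove [] (left p) = [] , _ , _ , refl , p
part-remove (x ∷ xs₁) (left p) with part-remove xs₁ p
... | zs₁ , zs₂ , m' , e , q = x ∷ zs₁ , zs₂ , true ∷ m' , cong (x ∷_) e , left q
part-remove xs₁ (right {y = y} p) with part-remove xs₁ p
... | zs₁ , zs₂ , m' , e , q = y ∷ zs₁ , zs₂ , false ∷ m' , cong (y ∷_) e , right q

part-∈ˡ : {A : Set} {m : List Bool} {xs ys zs : List A} {a : A} → Part m xs ys zs → a ∈ xs → a ∈ zs
part-∈ˡ (left p) (here e) = here e
part-∈ˡ (left p) (there i) = there (part-∈ˡ p i)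
part-∈ˡ (right p) i = there (part-∈ˡ p i)

part-∈ʳ : {A : Set} {m : List Bool} {xs ys zs : List A} {a : A} → Part m xs ys zs → a ∈ ys → a ∈ zs
part-∈ʳ p = part-∈ˡ (part-swap p)

part-∈⁻ : {A : Set} {m : List Bool} {xs ys zs : List A} {a : A} → Part m xs ys zs → a ∈ zs → a ∈ xs ⊎ a ∈ ys
part-∈⁻ (left p) (here e) = inj₁ (here e)
part-∈⁻ (right p) (here e) = inj₂ (here e)
part-∈⁻ (left p) (there i) with part-∈⁻ p i
... | inj₁ j = inj₁ (there j)
... | inj₂ j = inj₂ j
part-∈⁻ (right p) (there i) with part-∈⁻ p i
... | inj₁ j = inj₁ j
... | inj₂ j = inj₂ (there j)

part-concat-↭ : {A : Set} {m : List Bool} {S S₁ S₂ : List (List A)} → Part m S₁ S₂ S →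
  concat S ↭ concat S₁ ++ concat S₂
part-concat-↭ [] = ↭-refl
part-concat-↭ {S₁ = w ∷ S₁} {S₂} (left p) =
  ↭-trans (++⁺ˡ w (part-concat-↭ p)) (↭-reflexive (sym (++-assoc w (concat S₁) (concat S₂))))
part-concat-↭ {S₁ = S₁} {w ∷ S₂} (right p) =
  ↭-trans (++⁺ˡ w (part-concat-↭ p)) (shifts w (concat S₁))

part-length : {A : Set} {m : List Bool} {xs ys zs : List A} → Part m xs ys zs →
  length zs ≡ length xs + length ys
part-length [] = refl
part-length (left p) = cong suc (part-length p)
part-length {xs = xs} (right p) = trans (cong suc (part-length p)) (sym (+-suc (length xs) _))

-- Edge removal and additivity of the vertex count

-- Root edge removal, run to the end.  An empty word stands for a sphere with one
-- vertex and no edge, so Vertices ι S k says that the glued faces S have k vertices.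
data Vertices (ι : ℕ → ℕ) : List (List ℕ) → ℕ → Set where
  none  : Vertices ι [] 0
  empty : ∀ {W k} → Vertices ι W k → Vertices ι ([] ∷ W) (suc k)
  split : ∀ {x w u v W k} → w ≡ u ++ ι x ∷ v →
    Vertices ι (u ∷ v ∷ W) k → Vertices ι ((x ∷ w) ∷ W) k
  merge : ∀ {x w v v' W W₁ W₂ k} → W ≡ W₁ ++ (v ++ ι x ∷ v') ∷ W₂ →
    Vertices ι ((w ++ v' ++ v) ∷ W₁ ++ W₂) k → Vertices ι ((x ∷ w) ∷ W) k

-- A removal step touches only the first face and the face of its partner, so derivations of two
-- systems can be run inside any shuffle of them. `vertices-partˡ` covers the time during which the
-- first word belongs to the left system; once that word is used up, the shuffle decides which
-- system goes on.
vertices-part : {ι : ℕ → ℕ} {m : List Bool} {S₁ S₂ S : List (List ℕ)} {k l : ℕ} →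
  Vertices ι S₁ k → Vertices ι S₂ l → Part m S₁ S₂ S → Vertices ι S (k + l)
vertices-partˡ : {ι : ℕ → ℕ} {m : List Bool} {w : List ℕ} {S₁ S₂ S : List (List ℕ)} {k l : ℕ} →
  Vertices ι (w ∷ S₁) k → Vertices ι S₂ l → Part m S₁ S₂ S → Vertices ι (w ∷ S) (k + l)
vertices-part none none [] = none
vertices-part d₁ d₂ (left p) = vertices-partˡ d₁ d₂ p
vertices-part {k = k} {l} d₁ d₂ (right p) =
  subst (Vertices _ _) (+-comm l k) (vertices-partˡ d₂ d₁ (part-swap p))
vertices-partˡ (empty d₁) d₂ p = empty (vertices-part d₁ d₂ p)
vertices-partˡ (split e d₁) d₂ p = split e (vertices-part d₁ d₂ (left (left p)))
-- The partner face stands among foreign faces in the shuffle; `part-remove` locates it there.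
vertices-partˡ (merge {W₁ = W₁} refl d₁) d₂ p with part-remove W₁ p
... | S₁ , S₂ , m' , refl , p' = merge refl (vertices-part d₁ d₂ (left p'))

-- Orbits of a map and the bypassing of a point

redirect : ℕ → ℕ → ℕ → ℕ
redirect z b y with y ≟ z
... | yes _ = b
... | no  _ = y

redirect-hit : (z b : ℕ) → redirect z b z ≡ b
redirect-hit z b with z ≟ z
... | yes _ = refl
... | no z≢z = ⊥-elim (z≢z refl)

redirect-miss : {z y : ℕ} (b : ℕ) → y ≢ z → redirect z b y ≡ y
redirect-miss {z} {y} b y≢z with y ≟ z
... | yes e = ⊥-elim (y≢z e)
... | no _ = refl

ClosedUnder : (ℕ → ℕ) → List ℕ → Set
ClosedUnder φ L = ∀ {a} → a ∈ L → φ a ∈ L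

-- The equivalence closure of the graph makes orbits symmetric without an inverse of `φ`.
SameOrbit : (ℕ → ℕ) → ℕ → ℕ → Set
SameOrbit φ = EqClosure (λ y z → φ y ≡ z)

record Representatives (φ : ℕ → ℕ) (L rs : List ℕ) : Set where
  constructor mkReps
  field
    unique   : Unique rs
    sound    : ∀ {r} → r ∈ rs → r ∈ L
    cover    : ∀ {y} → y ∈ L → ∃[ r ] r ∈ rs × SameOrbit φ y r
    separate : ∀ {r r'} → r ∈ rs → r' ∈ rs → SameOrbit φ r r' → r ≡ r'

fixedCount : (ℕ → ℕ) → ℕ → ℕ
fixedCount φ z with φ z ≟ z
... | yes _ = 1
... | no  _ = 0

iter-shift : (φ : ℕ → ℕ) (i y : ℕ) → iter φ i (φ y) ≡ φ (iter φ i y)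
iter-shift φ zero y = refl
iter-shift φ (suc i) y = cong φ (iter-shift φ i y)

iter-closed : (φ : ℕ → ℕ) {L : List ℕ} → ClosedUnder φ L → (i : ℕ) {y : ℕ} → y ∈ L → iter φ i y ∈ L
iter-closed φ cl zero y∈ = y∈
iter-closed φ cl (suc i) y∈ = cl (iter-closed φ cl i y∈)

orbit-step : (φ : ℕ → ℕ) {y z : ℕ} → φ y ≡ z → SameOrbit φ y z
orbit-step φ e = EqC.return e

-- Since `z` is fixed, the property that some iterate of `a` is `z` passes from `a` to `φ a` and
-- back, hence along the whole closure.
orbit-of-fixed : (φ : ℕ → ℕ) {y z : ℕ} → φ z ≡ z → SameOrbit φ y z → ∃[ i ] iter φ i y ≡ z
orbit-of-fixed φ {y} {z} fz c = go (EqC.symmetric _ c)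
  where
  go : ∀ {a} → SameOrbit φ z a → ∃[ i ] iter φ i a ≡ z
  go c = proj₁ (EqC.gfold {S = λ a b → (Q a → Q b) × (Q b → Q a)}
      (record { refl = id , id ; sym = λ (f , g) → g , f ; trans = λ (f , g) (f' , g') → f' ∘ f , g ∘ g' })
      id (λ { {a} refl → fwd a , bwd a }) c) (0 , refl)
    where
    Q : ℕ → Set
    Q a = ∃[ i ] iter φ i a ≡ z
    fwd : ∀ a → Q a → Q (φ a)
    fwd a (i , e) = i , trans (iter-shift φ i a) (trans (cong φ e) fz)
    bwd : ∀ a → Q (φ a) → Q a
    bwd a (i , e) = suc i , trans (sym (iter-shift φ i a)) e

-- Letting the predecessor of `z` jump over `z` neither joins nor breaks orbits. An orbit disappears
-- only if `z` is all of it; then `z` is a new representative, and otherwise the old representatives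
-- serve unchanged.
representatives-bypass : (φ φ' : ℕ → ℕ) (z : ℕ) {L rs : List ℕ} →
  (∀ y → φ' y ≡ redirect z (φ z) (φ y)) → z ∉ L → φ z ∈ z ∷ L →
  ClosedUnder φ' L → Representatives φ' L rs →
  ClosedUnder φ (z ∷ L) ×
  ∃[ rs' ] Representatives φ (z ∷ L) rs' × length rs' ≡ fixedCount φ z + length rs
representatives-bypass φ φ' z {L} {rs} φ'≡ z∉ φz∈ cl (mkReps uniq snd cov sep) = cl⁺ , main
  where
  cl⁺ : ClosedUnder φ (z ∷ L)
  cl⁺ (here refl) = φz∈
  cl⁺ {a} (there a∈) with φ a ≟ z
  ... | yes e = here e
  ... | no ne = there (subst (_∈ L) (trans (φ'≡ a) (redirect-miss (φ z) ne)) (cl a∈))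
  main : ∃[ rs' ] Representatives φ (z ∷ L) rs' × length rs' ≡ fixedCount φ z + length rs
  main with φ z ≟ z
  ... | yes fz = z ∷ rs , mkReps (All.tabulate (λ r∈ e → z∉ (subst (_∈ L) (sym e) (snd r∈))) ∷ uniq)
          (λ { (here e) → here e ; (there r∈) → there (snd r∈) }) cov' sep' , refl
    where
    same : ∀ y → φ' y ≡ φ y
    same y with φ y ≟ z
    ... | yes e = trans (φ'≡ y) (trans (cong (redirect z (φ z)) e) (trans (redirect-hit z (φ z)) (trans fz (sym e))))
    ... | no ne = trans (φ'≡ y) (redirect-miss (φ z) ne)
    to : ∀ {a b} → SameOrbit φ' a b → SameOrbit φ a b
    to = EqC.map (λ {a} e → trans (sym (same a)) e)
    from : ∀ {a b} → SameOrbit φ a b → SameOrbit φ' a b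
    from = EqC.map (λ {a} e → trans (same a) e)
    clφ : ClosedUnder φ L
    clφ {a} a∈ = subst (_∈ L) (same a) (cl a∈)
    apart : ∀ {r} → r ∈ L → ¬ SameOrbit φ r z
    apart r∈ c = let i , e = orbit-of-fixed φ fz c in z∉ (subst (_∈ L) e (iter-closed φ clφ i r∈))
    cov' : ∀ {y} → y ∈ z ∷ L → ∃[ r ] r ∈ z ∷ rs × SameOrbit φ y r
    cov' (here refl) = z , here refl , EqC.reflexive _
    cov' (there y∈) = let r , r∈ , c = cov y∈ in r , there r∈ , to c
    sep' : ∀ {r r'} → r ∈ z ∷ rs → r' ∈ z ∷ rs → SameOrbit φ r r' → r ≡ r'
    sep' (here refl) (here refl) c = refl
    sep' (here refl) (there r'∈) c = ⊥-elim (apart (snd r'∈) (EqC.symmetric _ c))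
    sep' (there r∈) (here refl) c = ⊥-elim (apart (snd r∈) c)
    sep' (there r∈) (there r'∈) c = sep r∈ r'∈ (from c)
  ... | no nz = rs , mkReps uniq (there ∘ snd) cov' sep' , refl
    where
    φz∈L : φ z ∈ L
    φz∈L = case φz∈ of λ { (here e) → ⊥-elim (nz e) ; (there i) → i }
    stepwise : ∀ {a b} → φ' a ≡ b → SameOrbit φ a b
    stepwise {a} refl with φ a ≟ z
    ... | yes e = EqC.transitive _ (orbit-step φ e)
            (orbit-step φ (sym (trans (φ'≡ a) (trans (cong (redirect z (φ z)) e) (redirect-hit z (φ z))))))
    ... | no ne = orbit-step φ (sym (trans (φ'≡ a) (redirect-miss (φ z) ne)))
    to : ∀ {a b} → SameOrbit φ' a b → SameOrbit φ a b
    to = EqC.fold (EqC.isEquivalence _) stepwise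
    -- `ρ` moves `z` to its successor and carries orbits of `φ` to orbits of `φ'`; it fixes the
    -- representatives, since they lie in `L` and `z` does not.
    ρ : ℕ → ℕ
    ρ = redirect z (φ z)
    from : ∀ {a b} → SameOrbit φ a b → SameOrbit φ' (ρ a) (ρ b)
    from = EqC.gfold (EqC.isEquivalence _) ρ step
      where
      step : ∀ {a b} → φ a ≡ b → SameOrbit φ' (ρ a) (ρ b)
      step {a} refl with a ≟ z
      ... | yes refl = subst (SameOrbit φ' (φ z)) (sym (redirect-miss (φ z) nz)) (EqC.reflexive _)
      ... | no _ = orbit-step φ' (φ'≡ a)
    ρ-id : ∀ {r} → r ∈ rs → ρ r ≡ r
    ρ-id r∈ = redirect-miss (φ z) λ { refl → z∉ (snd r∈) }
    cov' : ∀ {y} → y ∈ z ∷ L → ∃[ r ] r ∈ rs × SameOrbit φ y r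
    cov' (here refl) = let r , r∈ , c = cov φz∈L in r , r∈ , EqC.transitive _ (orbit-step φ refl) (to c)
    cov' (there y∈) = let r , r∈ , c = cov y∈ in r , r∈ , to c
    sep' : ∀ {r r'} → r ∈ rs → r' ∈ rs → SameOrbit φ r r' → r ≡ r'
    sep' {r} {r'} r∈ r'∈ c = sep r∈ r'∈ (subst (λ a → SameOrbit φ' a r') (ρ-id r∈) (subst (SameOrbit φ' (ρ r)) (ρ-id r'∈) (from c)))

-- Gluing systems and their stability under edge removal

record Good (ι : ℕ → ℕ) (S : List (List ℕ)) : Set where
  constructor mkGood
  field
    unique     : Unique (concat S)
    closed     : ClosedUnder ι (concat S)
    involutive : ∀ {a} → a ∈ concat S → ι (ι a) ≡ a
    fixedFree  : ∀ {a} → a ∈ concat S → ι a ≢ a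

concat-extract : {A : Set} (W₁ : List (List A)) (w : List A) (W₂ : List (List A)) →
  concat (W₁ ++ w ∷ W₂) ↭ w ++ concat (W₁ ++ W₂)
concat-extract [] w W₂ = ↭-refl
concat-extract (v ∷ W₁) w W₂ = ↭-trans (++⁺ˡ v (concat-extract W₁ w W₂)) (shifts v w)

split-↭ : (x x' : ℕ) (u v : List ℕ) (W : List (List ℕ)) →
  concat ((x ∷ u ++ x' ∷ v) ∷ W) ↭ x' ∷ x ∷ concat (u ∷ v ∷ W)
split-↭ x x' u v W = begin
  x ∷ (u ++ x' ∷ v) ++ concat W   ≡⟨ cong (x ∷_) (++-assoc u (x' ∷ v) (concat W)) ⟩
  x ∷ u ++ x' ∷ v ++ concat W     ↭⟨ Perm.prep x (shift x' u (v ++ concat W)) ⟩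
  x ∷ x' ∷ u ++ v ++ concat W     ↭⟨ Perm.swap x x' ↭-refl ⟩
  x' ∷ x ∷ u ++ v ++ concat W     ∎
  where open PermutationReasoning

merge-↭ : (x x' : ℕ) (w v v' : List ℕ) (W₁ W₂ : List (List ℕ)) →
  concat ((x ∷ w) ∷ W₁ ++ (v ++ x' ∷ v') ∷ W₂) ↭ x' ∷ x ∷ concat ((w ++ v' ++ v) ∷ W₁ ++ W₂)
merge-↭ x x' w v v' W₁ W₂ = begin
  x ∷ w ++ concat (W₁ ++ (v ++ x' ∷ v') ∷ W₂)  ↭⟨ Perm.prep x (++⁺ˡ w (concat-extract W₁ _ W₂)) ⟩
  x ∷ w ++ (v ++ x' ∷ v') ++ R                 ↭⟨ Perm.prep x (++⁺ˡ w (++⁺ʳ R (++-comm v (x' ∷ v')))) ⟩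
  x ∷ w ++ x' ∷ (v' ++ v) ++ R                 ↭⟨ Perm.prep x (shift x' w _) ⟩
  x ∷ x' ∷ w ++ (v' ++ v) ++ R                 ↭⟨ Perm.swap x x' ↭-refl ⟩
  x' ∷ x ∷ w ++ (v' ++ v) ++ R                 ≡⟨ cong (λ l → x' ∷ x ∷ l) (sym (++-assoc w (v' ++ v) R)) ⟩
  x' ∷ x ∷ (w ++ v' ++ v) ++ R                 ∎
  where
  open PermutationReasoning
  R = concat (W₁ ++ W₂)

-- A letter that `ι` sends into the removed pair would itself belong to the pair, by involutivity;
-- so the smaller set of letters is still closed under the same `ι`.
good-remove : {ι : ℕ → ℕ} {x : ℕ} {S S' : List (List ℕ)} → Good ι S →
  concat S ↭ ι x ∷ x ∷ concat S' → Good ι S'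
good-remove {ι} {x} {S} {S'} (mkGood un cl inv ff) p = mkGood (tail (tail un')) cl' (inv ∘ up) (ff ∘ up)
  where
  tail : ∀ {a : ℕ} {l} → Unique (a ∷ l) → Unique l
  tail (_ ∷ u) = u
  un' = unique-resp-↭ p un
  up : ∀ {a} → a ∈ concat S' → a ∈ concat S
  up i = ∈-resp-↭ (↭-sym p) (there (there i))
  x∈ : x ∈ concat S
  x∈ = ∈-resp-↭ (↭-sym p) (there (here refl))
  head≢ : ∀ {a b : ℕ} {l} → Unique (a ∷ l) → b ∈ l → a ≢ b
  head≢ (h ∷ _) b∈ = All.lookup h b∈
  cl' : ClosedUnder ι (concat S')
  cl' {a} a∈ with ∈-resp-↭ p (cl (up a∈))
  ... | here e = ⊥-elim (head≢ (tail un') a∈ (trans (sym (inv x∈)) (trans (cong ι (sym e)) (inv (up a∈)))))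
  ... | there (here e) = ⊥-elim (head≢ un' (there a∈) (trans (cong ι (sym e)) (inv (up a∈))))
  ... | there (there i) = i

good-split : {ι : ℕ → ℕ} {x : ℕ} (u v : List ℕ) (W : List (List ℕ)) →
  Good ι ((x ∷ u ++ ι x ∷ v) ∷ W) → Good ι (u ∷ v ∷ W)
good-split {ι} {x} u v W g = good-remove {S' = u ∷ v ∷ W} g (split-↭ x (ι x) u v W)

good-merge : {ι : ℕ → ℕ} {x : ℕ} (w v v' : List ℕ) (W₁ W₂ : List (List ℕ)) →
  Good ι ((x ∷ w) ∷ W₁ ++ (v ++ ι x ∷ v') ∷ W₂) → Good ι ((w ++ v' ++ v) ∷ W₁ ++ W₂)
good-merge {ι} {x} w v v' W₁ W₂ g =
  good-remove {S' = (w ++ v' ++ v) ∷ W₁ ++ W₂} g (merge-↭ x (ι x) w v v' W₁ W₂)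

-- Cyclic words and the face permutation after an edge is removed

rotate : List ℕ → List ℕ
rotate [] = []
rotate (a ∷ w) = w ++ a ∷ []

-- As an equation between lists, being a cycle of `τ` can be rotated, cut at a letter and recombined
-- by list algebra alone. The empty word satisfies it.
Cyclic : (ℕ → ℕ) → List ℕ → Set
Cyclic τ w = map τ w ≡ rotate w

cyclic-rotate : (τ : ℕ → ℕ) (p q : List ℕ) → Cyclic τ (p ++ q) → Cyclic τ (q ++ p)
cyclic-rotate τ [] q c = subst (Cyclic τ) (sym (++-identityʳ q)) c
cyclic-rotate τ (a ∷ p) q c =
  subst (Cyclic τ) (++-assoc q (a ∷ []) p)
    (cyclic-rotate τ p (q ++ a ∷ []) (subst (Cyclic τ) (++-assoc p q (a ∷ [])) (once (p ++ q) c)))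
  where
  once : ∀ w → Cyclic τ (a ∷ w) → Cyclic τ (w ++ a ∷ [])
  once [] c = c
  once (b ∷ w) c = trans (map-++ τ (b ∷ w) (a ∷ []))
    (cong₂ _++_ (∷-injectiveʳ c) (cong (_∷ []) (∷-injectiveˡ c)))

map-∷-++ : (τ : ℕ → ℕ) (a : ℕ) (u : List ℕ) {b : ℕ} {v : List ℕ} {c : ℕ} →
  map τ (a ∷ u ++ b ∷ v) ≡ (u ++ b ∷ v) ++ c ∷ [] →
  map τ (a ∷ u) ≡ u ++ b ∷ [] × map τ (b ∷ v) ≡ v ++ c ∷ []
map-∷-++ τ a u {b} {v} {c} e = ++-injective (map τ (a ∷ u))
  (trans (length-map τ (a ∷ u)) (trans (+-comm 1 (length u)) (sym (length-++ u))))
  (trans (sym (map-++ τ (a ∷ u) (b ∷ v)))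
    (trans e (trans (++-assoc u (b ∷ v) (c ∷ [])) (sym (++-assoc u (b ∷ []) (v ++ c ∷ []))))))

emptyCount : List ℕ → ℕ
emptyCount [] = 1
emptyCount (_ ∷ _) = 0

emptyWords : List (List ℕ) → ℕ
emptyWords S = sum (map emptyCount S)

emptyWords-insert : (W₁ : List (List ℕ)) (a : ℕ) (w : List ℕ) (W₂ : List (List ℕ)) →
  emptyWords (W₁ ++ (a ∷ w) ∷ W₂) ≡ emptyWords (W₁ ++ W₂)
emptyWords-insert [] a w W₂ = refl
emptyWords-insert (v ∷ W₁) a w W₂ = cong (emptyCount v +_) (emptyWords-insert W₁ a w W₂)

-- The two redirections are dictated by `φ = τ ∘ ι` with `ι` exchanging `x` and `x'`. As `φ x'` is
-- `τ x`, bypassing `x'` means following `τ` by `cut₁`; after that the image of `x` is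
-- `cut₁ (τ x')`, and bypassing `x` means following by `cut₂`. So `τ' ∘ ι` is `φ` with both points
-- skipped, and the lemmas below show that `τ'` is cyclic on the new faces.
module Cut (τ : ℕ → ℕ) (x x' : ℕ) (x≢x' : x ≢ x') where

  cut₁ cut₂ cut τ' : ℕ → ℕ
  cut₁ = redirect x' (τ x)
  cut₂ = redirect x (cut₁ (τ x'))
  cut = cut₂ ∘ cut₁
  τ' = cut ∘ τ

  Avoids : List ℕ → Set
  Avoids l = x ∉ l × x' ∉ l

  cut-id : ∀ {a} → a ≢ x → a ≢ x' → cut a ≡ a
  cut-id a≢x a≢x' = trans (cong cut₂ (redirect-miss _ a≢x')) (redirect-miss _ a≢x)

  cut-x : cut x ≡ cut₁ (τ x')
  cut-x = trans (cong cut₂ (redirect-miss _ x≢x')) (redirect-hit x _)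

  cut-x' : cut x' ≡ cut₂ (τ x)
  cut-x' = cong cut₂ (redirect-hit x' _)

  map-cut : ∀ {l} → Avoids l → map cut l ≡ l
  map-cut {[]} _ = refl
  map-cut {a ∷ l} (p , q) = cong₂ _∷_ (cut-id (λ { refl → p (here refl) }) (λ { refl → q (here refl) }))
    (map-cut ((p ∘ there) , (q ∘ there)))

  avoid-head : ∀ {a l} → Avoids (a ∷ l) → a ≢ x × a ≢ x'
  avoid-head (p , q) = (λ { refl → p (here refl) }) , (λ { refl → q (here refl) })

  avoid-tail : ∀ {a l} → Avoids (a ∷ l) → Avoids l
  avoid-tail (p , q) = (p ∘ there) , (q ∘ there)

  map-τ' : ∀ {l} (m : List ℕ) {b} → Avoids m → map τ l ≡ m ++ b ∷ [] → map τ' l ≡ m ++ cut b ∷ []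
  map-τ' {l} m {b} av e = trans (map-∘ l) (trans (cong (map cut) e)
    (trans (map-++ cut m (b ∷ [])) (cong (_++ cut b ∷ []) (map-cut av))))

  cyclic-avoiding : ∀ {w} → Avoids w → Cyclic τ w → Cyclic τ' w
  cyclic-avoiding {[]} av c = refl
  cyclic-avoiding {a ∷ w} av c = trans (map-τ' w (avoid-tail av) c)
    (cong (λ b → w ++ b ∷ []) (cut-id (proj₁ (avoid-head av)) (proj₂ (avoid-head av))))

  cyclic-u : ∀ u → Avoids u → map τ (x ∷ u) ≡ u ++ x' ∷ [] → Cyclic τ' u
  cyclic-u [] av e = refl
  cyclic-u (a ∷ u) av e = trans (map-τ' u (avoid-tail av) (∷-injectiveʳ e))
    (cong (λ b → u ++ b ∷ []) (trans cut-x' (trans (cong cut₂ (∷-injectiveˡ e)) (redirect-miss _ (proj₁ (avoid-head av))))))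

  cyclic-v : ∀ v → Avoids v → map τ (x' ∷ v) ≡ v ++ x ∷ [] → Cyclic τ' v
  cyclic-v [] av e = refl
  cyclic-v (a ∷ v) av e = trans (map-τ' v (avoid-tail av) (∷-injectiveʳ e))
    (cong (λ b → v ++ b ∷ []) (trans cut-x (trans (cong cut₁ (∷-injectiveˡ e)) (redirect-miss _ (proj₂ (avoid-head av))))))

  -- The last letter of `u`, which led to `x`, now leads to the head of `t`, and the last letter of
  -- `t` to the head of `u`. If one word is empty, its removed letter pointed to itself and both
  -- redirections act in succession, hence the four cases.
  cyclic-join : ∀ u t → Avoids u → Avoids t → map τ (x ∷ u) ≡ u ++ x ∷ [] → map τ (x' ∷ t) ≡ t ++ x' ∷ [] →
    Cyclic τ' (u ++ t)
  cyclic-join [] [] au at eu et = refl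
  cyclic-join [] (b ∷ t) au at eu et = trans (map-τ' t (avoid-tail at) (∷-injectiveʳ et))
    (cong (λ c → t ++ c ∷ []) (trans cut-x' (trans (cong cut₂ (∷-injectiveˡ eu)) (trans (redirect-hit x _)
      (trans (cong cut₁ (∷-injectiveˡ et)) (redirect-miss _ (proj₂ (avoid-head at))))))))
  cyclic-join (a ∷ u) [] au at eu et =
    subst (λ l → map τ' (a ∷ l) ≡ l ++ a ∷ []) (sym (++-identityʳ u))
    (trans (map-τ' u (avoid-tail au) (∷-injectiveʳ eu))
    (cong (λ c → u ++ c ∷ []) (trans cut-x (trans (cong cut₁ (∷-injectiveˡ et)) (trans (redirect-hit x' _) (∷-injectiveˡ eu))))))
  cyclic-join (a ∷ u) (b ∷ t) au at eu et = trans (map-++ τ' (a ∷ u) (b ∷ t))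
    (trans (cong₂ _++_
      (trans (map-τ' u (avoid-tail au) (∷-injectiveʳ eu)) (cong (λ c → u ++ c ∷ [])
        (trans cut-x (trans (cong cut₁ (∷-injectiveˡ et)) (redirect-miss _ (proj₂ (avoid-head at)))))))
      (trans (map-τ' t (avoid-tail at) (∷-injectiveʳ et)) (cong (λ c → t ++ c ∷ [])
        (trans cut-x' (trans (cong cut₂ (∷-injectiveˡ eu)) (redirect-miss _ (proj₁ (avoid-head au))))))))
    (trans (++-assoc u (b ∷ []) (t ++ a ∷ [])) (sym (++-assoc u (b ∷ t) (a ∷ [])))))

-- Counted vertices are cycles of `τ ∘ ι`

fixedCount-fixed : (φ : ℕ → ℕ) {z : ℕ} → φ z ≡ z → fixedCount φ z ≡ 1
fixedCount-fixed φ {z} e with φ z ≟ z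
... | yes _ = refl
... | no ne = ⊥-elim (ne e)

fixedCount-moved : (φ : ℕ → ℕ) {z : ℕ} → φ z ≢ z → fixedCount φ z ≡ 0
fixedCount-moved φ {z} ne with φ z ≟ z
... | yes e = ⊥-elim (ne e)
... | no _ = refl

representatives-resp-↭ : {φ : ℕ → ℕ} {L L' rs : List ℕ} → L ↭ L' → Representatives φ L rs → Representatives φ L' rs
representatives-resp-↭ p (mkReps un snd cov sep) =
  mkReps un (∈-resp-↭ p ∘ snd) (cov ∘ ∈-resp-↭ (↭-sym p)) sep

-- The two bypasses are undone in reverse order: putting back `x` leads from `τ' ∘ ι` to
-- `cut₁ ∘ τ ∘ ι`, and putting back `ι x` leads to `τ ∘ ι`.
reinsert : (τ ι : ℕ → ℕ) (x : ℕ) (x≢ : x ≢ ι x) {L rs : List ℕ} → let open Cut τ x (ι x) x≢ in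
  ι (ι x) ≡ x → x ∉ L → ι x ∉ x ∷ L → cut₁ (τ (ι x)) ∈ x ∷ L → τ x ∈ ι x ∷ x ∷ L →
  ClosedUnder (τ' ∘ ι) L → Representatives (τ' ∘ ι) L rs →
  ClosedUnder (τ ∘ ι) (ι x ∷ x ∷ L) ×
  ∃[ rs' ] Representatives (τ ∘ ι) (ι x ∷ x ∷ L) rs' ×
    length rs' ≡ fixedCount (τ ∘ ι) (ι x) + (fixedCount (cut₁ ∘ τ ∘ ι) x + length rs)
reinsert τ ι x x≢ {L} {rs} inv x∉ x'∉ m₁ m₂ cl reps =
  let cl₁ , rs₁ , reps₁ , e₁ = representatives-bypass (cut₁ ∘ τ ∘ ι) (τ' ∘ ι) x (λ _ → refl) x∉ m₁ cl reps
      cl₂ , rs₂ , reps₂ , e₂ = representatives-bypass (τ ∘ ι) (cut₁ ∘ τ ∘ ι) (ι x)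
        (λ y → cong (λ b → redirect (ι x) b (τ (ι y))) (cong τ (sym inv))) x'∉
        (subst (_∈ ι x ∷ x ∷ L) (cong τ (sym inv)) m₂) cl₁ reps₁
  in cl₂ , rs₂ , reps₂ , trans e₂ (cong (fixedCount (τ ∘ ι) (ι x) +_) e₁)
  where open Cut τ x (ι x) x≢

closed-resp-↭ : {φ : ℕ → ℕ} {L L' : List ℕ} → L ↭ L' → ClosedUnder φ L → ClosedUnder φ L'
closed-resp-↭ p cl = ∈-resp-↭ p ∘ cl ∘ ∈-resp-↭ (↭-sym p)

unique-pair : {a b : ℕ} {L : List ℕ} → Unique (a ∷ b ∷ L) → b ≢ a × b ∉ L × a ∉ b ∷ L
unique-pair (p ∷ q ∷ _) = (λ e → All.lookup p (here refl) (sym e)) ,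
  (λ i → All.lookup q i refl) , (λ i → All.lookup p i refl)

-- Cycles plus empty words is an invariant of removal. In a split, `ι x` is a fixed point exactly
-- when `u` is empty, and `x` becomes one after the first bypass exactly when `v` is empty. In a
-- merge, `ι x` is never fixed, and `x` becomes fixed exactly when the merged word is empty. The
-- statement holds for every `τ`, because the induction needs it for `τ'`.
vertices-representatives : {ι : ℕ → ℕ} {S : List (List ℕ)} {k : ℕ} → Vertices ι S k →
  (τ : ℕ → ℕ) → Good ι S → All (Cyclic τ) S →
  ClosedUnder (τ ∘ ι) (concat S) ×
  ∃[ rs ] Representatives (τ ∘ ι) (concat S) rs × length rs + emptyWords S ≡ k
vertices-representatives none τ g cs = (λ ()) , [] , mkReps [] (λ ()) (λ ()) (λ ()) , refl
vertices-representatives (empty {W} {k} d) τ (mkGood a b c e) (_ ∷ cs) =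
  let cl , rs , reps , eq = vertices-representatives d τ (mkGood a b c e) cs
  in cl , rs , reps , trans (+-suc (length rs) (emptyWords W)) (cong suc eq)
vertices-representatives {ι} (split {x} {.(u ++ ι x ∷ v)} {u} {v} {W} {k} refl d) τ g@(mkGood un _ inv _) (c ∷ cs) =
  let cl , rs , reps , eq = vertices-representatives d τ' (good-split u v W g)
        (cyclic-u u avu eu ∷ cyclic-v v avv ev ∷
         All.tabulate λ {w} w∈ → cyclic-avoiding (avoid (λ i → ∈-++⁺ʳ u (∈-++⁺ʳ v (∈-concat⁺′ i w∈)))) (All.lookup cs w∈))
      cl' , rs' , reps' , eq' = reinsert τ ι x x≢ ιιx x∉ x'∉ m₁ m₂ cl reps
  in closed-resp-↭ (↭-sym perm) cl' , rs' , representatives-resp-↭ (↭-sym perm) reps' ,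
     trans (cong (_+ emptyWords W) (trans eq' (cong₂ (λ a b → a + (b + length rs)) f₂ f₁)))
       (trans (arith (emptyCount u) (emptyCount v) (length rs) (emptyWords W)) eq)
  where
  L = concat (u ∷ v ∷ W)
  perm : concat ((x ∷ u ++ ι x ∷ v) ∷ W) ↭ ι x ∷ x ∷ L
  perm = split-↭ x (ι x) u v W
  ιιx : ι (ι x) ≡ x
  ιιx = inv (here refl)
  facts = unique-pair (unique-resp-↭ perm un)
  x≢ = proj₁ facts
  x∉ = proj₁ (proj₂ facts)
  x'∉ = proj₂ (proj₂ facts)
  open Cut τ x (ι x) x≢
  avoid : ∀ {l} → (∀ {a} → a ∈ l → a ∈ L) → Avoids l
  avoid s = (x∉ ∘ s) , (x'∉ ∘ there ∘ s)
  avu : Avoids u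
  avu = avoid ∈-++⁺ˡ
  avv : Avoids v
  avv = avoid (λ i → ∈-++⁺ʳ u (∈-++⁺ˡ i))
  eu = proj₁ (map-∷-++ τ x u c)
  ev = proj₂ (map-∷-++ τ x u c)
  fu : ∀ u → Avoids u → map τ (x ∷ u) ≡ u ++ ι x ∷ [] → fixedCount (τ ∘ ι) (ι x) ≡ emptyCount u
  fu [] _ e = fixedCount-fixed (τ ∘ ι) (trans (cong τ ιιx) (∷-injectiveˡ e))
  fu (a ∷ u) av e = fixedCount-moved (τ ∘ ι) (λ h → proj₂ (avoid-head av)
    (trans (sym (∷-injectiveˡ e)) (trans (cong τ (sym ιιx)) h)))
  fv : ∀ v → Avoids v → map τ (ι x ∷ v) ≡ v ++ x ∷ [] → fixedCount (cut₁ ∘ τ ∘ ι) x ≡ emptyCount v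
  fv [] _ e = fixedCount-fixed (cut₁ ∘ τ ∘ ι) (trans (cong cut₁ (∷-injectiveˡ e)) (redirect-miss _ x≢))
  fv (a ∷ v) av e = fixedCount-moved (cut₁ ∘ τ ∘ ι) (λ h → proj₁ (avoid-head av)
    (trans (sym (trans (cong cut₁ (∷-injectiveˡ e)) (redirect-miss _ (proj₂ (avoid-head av))))) h))
  f₂ = fu u avu eu
  f₁ = fv v avv ev
  mu : ∀ u → map τ (x ∷ u) ≡ u ++ ι x ∷ [] → τ x ∈ ι x ∷ x ∷ u
  mu [] e = here (∷-injectiveˡ e)
  mu (a ∷ u) e = there (there (here (∷-injectiveˡ e)))
  mv : ∀ v → Avoids v → map τ (ι x ∷ v) ≡ v ++ x ∷ [] → cut₁ (τ (ι x)) ∈ x ∷ v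
  mv [] av e = here (trans (cong cut₁ (∷-injectiveˡ e)) (redirect-miss _ x≢))
  mv (a ∷ v) av e = there (here (trans (cong cut₁ (∷-injectiveˡ e)) (redirect-miss _ (proj₂ (avoid-head av)))))
  m₂ : τ x ∈ ι x ∷ x ∷ L
  m₂ = ∈-++⁺ˡ (mu u eu)
  m₁ : cut₁ (τ (ι x)) ∈ x ∷ L
  m₁ = case mv v avv ev of λ { (here e) → here e ; (there i) → there (∈-++⁺ʳ u (∈-++⁺ˡ i)) }
  arith : ∀ a b c d → a + (b + c) + d ≡ c + (a + (b + d))
  arith = solve 4 (λ a b c d → a :+ (b :+ c) :+ d := c :+ (a :+ (b :+ d))) refl
    where open +-*-Solver
vertices-representatives {ι} (merge {x} {w} {v} {v'} {_} {W₁} {W₂} {k} refl d) τ g@(mkGood un _ inv _) (c ∷ cs) =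
  let cl , rs , reps , eq = vertices-representatives d τ' (good-merge w v v' W₁ W₂ g)
        (cyclic-join w t avw avt c et ∷
         All.tabulate λ {w'} w'∈ → cyclic-avoiding (avoid (λ i → ∈-++⁺ʳ (w ++ t) (∈-concat⁺′ i w'∈))) (All.lookup cs (up w'∈)))
      cl' , rs' , reps' , eq' = reinsert τ ι x x≢ ιιx x∉ x'∉ m₁ m₂ cl reps
  in closed-resp-↭ (↭-sym perm) cl' , rs' , representatives-resp-↭ (↭-sym perm) reps' ,
     trans (cong₂ _+_ (trans eq' (cong₂ (λ a b → a + (b + length rs)) (f₂ w avw c) (f₁ w t avw avt c et))) (ins v))
       (trans (arith (emptyCount (w ++ t)) (length rs) (emptyWords (W₁ ++ W₂))) eq)
  where
  t = v' ++ v
  L = concat ((w ++ t) ∷ W₁ ++ W₂)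
  perm : concat ((x ∷ w) ∷ W₁ ++ (v ++ ι x ∷ v') ∷ W₂) ↭ ι x ∷ x ∷ L
  perm = merge-↭ x (ι x) w v v' W₁ W₂
  ιιx : ι (ι x) ≡ x
  ιιx = inv (here refl)
  facts = unique-pair (unique-resp-↭ perm un)
  x≢ = proj₁ facts
  x∉ = proj₁ (proj₂ facts)
  x'∉ = proj₂ (proj₂ facts)
  open Cut τ x (ι x) x≢
  avoid : ∀ {l} → (∀ {a} → a ∈ l → a ∈ L) → Avoids l
  avoid s = (x∉ ∘ s) , (x'∉ ∘ there ∘ s)
  avw : Avoids w
  avw = avoid (∈-++⁺ˡ ∘ ∈-++⁺ˡ)
  avt : Avoids t
  avt = avoid (∈-++⁺ˡ ∘ ∈-++⁺ʳ w)
  up : ∀ {y} → y ∈ W₁ ++ W₂ → y ∈ W₁ ++ (v ++ ι x ∷ v') ∷ W₂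
  up y∈ = case ∈-++⁻ W₁ y∈ of λ { (inj₁ i) → ∈-++⁺ˡ i ; (inj₂ i) → ∈-++⁺ʳ W₁ (there i) }
  -- The partner face may be read from `ι x` on, which is why its remainder enters the merged word
  -- as `v' ++ v`.
  et : map τ (ι x ∷ t) ≡ t ++ ι x ∷ []
  et = cyclic-rotate τ v (ι x ∷ v') (All.lookup cs (∈-++⁺ʳ W₁ (here refl)))
  τx : ∀ w → Avoids w → map τ (x ∷ w) ≡ w ++ x ∷ [] → τ x ∈ x ∷ w
  τx [] av e = here (∷-injectiveˡ e)
  τx (a ∷ w) av e = there (here (∷-injectiveˡ e))
  f₂ : ∀ w → Avoids w → map τ (x ∷ w) ≡ w ++ x ∷ [] → fixedCount (τ ∘ ι) (ι x) ≡ 0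
  f₂ w av e = fixedCount-moved (τ ∘ ι) λ h →
    case subst (_∈ x ∷ w) (trans (cong τ (sym ιιx)) h) (τx w av e) of λ
      { (here e) → x≢ (sym e) ; (there i) → proj₂ av i }
  cut₁τx' : ∀ w t → Avoids w → Avoids t → map τ (x ∷ w) ≡ w ++ x ∷ [] → map τ (ι x ∷ t) ≡ t ++ ι x ∷ [] →
    (w ++ t ≡ [] × cut₁ (τ (ι x)) ≡ x) ⊎ (∃[ a ] ∃[ l ] w ++ t ≡ a ∷ l × a ∈ w ++ t × cut₁ (τ (ι x)) ∈ w ++ t)
  cut₁τx' [] [] aw at ew et = inj₁ (refl , trans (cong cut₁ (∷-injectiveˡ et)) (trans (redirect-hit (ι x) _) (∷-injectiveˡ ew)))
  cut₁τx' (a ∷ w) [] aw at ew et = inj₂ (a , w ++ [] , refl , here refl ,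
    here (trans (cong cut₁ (∷-injectiveˡ et)) (trans (redirect-hit (ι x) _) (∷-injectiveˡ ew))))
  cut₁τx' [] (b ∷ t) aw at ew et = inj₂ (b , t , refl , here refl ,
    here (trans (cong cut₁ (∷-injectiveˡ et)) (redirect-miss _ (proj₂ (avoid-head at)))))
  cut₁τx' (a ∷ w) (b ∷ t) aw at ew et = inj₂ (a , w ++ b ∷ t , refl , here refl ,
    ∈-++⁺ʳ (a ∷ w) (here (trans (cong cut₁ (∷-injectiveˡ et)) (redirect-miss _ (proj₂ (avoid-head at))))))
  f₁ : ∀ w t → Avoids w → Avoids t → map τ (x ∷ w) ≡ w ++ x ∷ [] → map τ (ι x ∷ t) ≡ t ++ ι x ∷ [] →
    fixedCount (cut₁ ∘ τ ∘ ι) x ≡ emptyCount (w ++ t)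
  f₁ w t aw at ew et with cut₁τx' w t aw at ew et
  ... | inj₁ (e , h) = trans (fixedCount-fixed (cut₁ ∘ τ ∘ ι) h) (cong emptyCount (sym e))
  ... | inj₂ (a , l , e , _ , i) = trans (fixedCount-moved (cut₁ ∘ τ ∘ ι)
          (λ h → case ∈-++⁻ w (subst (_∈ w ++ t) h i) of λ { (inj₁ j) → proj₁ aw j ; (inj₂ j) → proj₁ at j }))
          (cong emptyCount (sym e))
  m₂ : τ x ∈ ι x ∷ x ∷ L
  m₂ = there (∈-++⁺ˡ (∈-++⁺ˡ {xs = x ∷ w} (τx w avw c)))
  m₁ : cut₁ (τ (ι x)) ∈ x ∷ L
  m₁ = case cut₁τx' w t avw avt c et of λ
    { (inj₁ (_ , h)) → here h ; (inj₂ (_ , _ , _ , _ , i)) → there (∈-++⁺ˡ i) }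
  ins : ∀ v → emptyWords (W₁ ++ (v ++ ι x ∷ v') ∷ W₂) ≡ emptyWords (W₁ ++ W₂)
  ins [] = emptyWords-insert W₁ (ι x) v' W₂
  ins (a ∷ v) = emptyWords-insert W₁ a (v ++ ι x ∷ v') W₂
  arith : ∀ a b c → 0 + (a + b) + c ≡ b + (a + c)
  arith = solve 3 (λ a b c → con 0 :+ (a :+ b) :+ c := b :+ (a :+ c)) refl
    where open +-*-Solver

-- Cycle minima and systems of representatives

¬all⁻ : {A : Set} (p : A → Bool) (xs : List A) → ¬ T (all p xs) → ∃[ x ] x ∈ xs × ¬ T (p x)
¬all⁻ p [] h = ⊥-elim (h tt)
¬all⁻ p (x ∷ xs) h with p x in eq
... | false = x , here refl , λ t → subst T eq t
... | true = let y , y∈ , ne = ¬all⁻ p xs h in y , there y∈ , ne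

iter-+ : (φ : ℕ → ℕ) (a b y : ℕ) → iter φ (a + b) y ≡ iter φ a (iter φ b y)
iter-+ φ zero b y = refl
iter-+ φ (suc a) b y = cong φ (iter-+ φ a b y)

-- Forward iterates are enough: having a common iterate is transitive because iterates of one map
-- commute.
orbits-meet : (φ : ℕ → ℕ) {a b : ℕ} → SameOrbit φ a b → ∃[ i ] ∃[ j ] iter φ i a ≡ iter φ j b
orbits-meet φ = EqC.fold {S = λ a b → ∃[ i ] ∃[ j ] iter φ i a ≡ iter φ j b}
  (record
    { refl = 0 , 0 , refl
    ; sym = λ (i , j , e) → j , i , sym e
    ; trans = λ {a} {b} {c} (i , j , e) (k , l , f) → k + i , j + l ,
        (trans (iter-+ φ k i a) (trans (cong (iter φ k) e) (trans (sym (iter-+ φ k j b))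
          (trans (cong (λ t → iter φ t b) (+-comm k j)) (trans (iter-+ φ j k b)
            (trans (cong (iter φ j) f) (sym (iter-+ φ j l c))))))))
    })
  (λ {a} e → 1 , 0 , e)

iter-orbit : (φ : ℕ → ℕ) (i y : ℕ) → SameOrbit φ y (iter φ i y)
iter-orbit φ zero y = EqC.reflexive _
iter-orbit φ (suc i) y = EqC.transitive _ (iter-orbit φ i y) (orbit-step φ refl)

module PermutationOfRange (n : ℕ) (φ : ℕ → ℕ) (φ< : ∀ {y} → y < n → φ y < n)
  (φ-inj : ∀ {y z} → y < n → z < n → φ y ≡ φ z → y ≡ z) where

  iter< : ∀ i {y} → y < n → iter φ i y < n
  iter< zero y< = y<
  iter< (suc i) y< = φ< (iter< i y<)

  iter-cancel : ∀ i d {y} → y < n → iter φ i y ≡ iter φ (i + d) y → y ≡ iter φ d y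
  iter-cancel zero d y< e = e
  iter-cancel (suc i) d y< e = iter-cancel i d y< (φ-inj (iter< i y<) (iter< (i + d) y<) e)

  -- Two of the iterates with exponents 0 to `n` coincide by the pigeonhole principle, and
  -- injectivity cancels the common part. The bound on `p` matters, since `numCycles` inspects only
  -- `n` iterates.
  period : ∀ {y} → y < n → ∃[ p ] p < n × iter φ (suc p) y ≡ y
  period {y} y< with pigeonhole (n<1+n n) (λ (i : Fin (suc n)) → fromℕ< (iter< (toℕ i) y<))
  ... | i , j , i<j , e = p , ≤-trans (≤-reflexive p+) (≤-trans (m∸n≤m (toℕ j) (toℕ i)) (≤-pred (toℕ<n j))) ,
        sym (iter-cancel (toℕ i) (suc p) y< (trans e' (cong (λ t → iter φ t y) (sym eqn))))
    where
    p = toℕ j ∸ suc (toℕ i)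
    p+ : suc p ≡ toℕ j ∸ toℕ i
    p+ = sym (+-∸-assoc 1 i<j)
    eqn : toℕ i + suc p ≡ toℕ j
    eqn = trans (cong (toℕ i +_) p+) (m+[n∸m]≡n (<⇒≤ i<j))
    e' : iter φ (toℕ i) y ≡ iter φ (toℕ j) y
    e' = trans (sym (toℕ-fromℕ< (iter< (toℕ i) y<))) (trans (cong toℕ e) (toℕ-fromℕ< (iter< (toℕ j) y<)))

  -- `numCycles` tests the exponents 1 to `n`; exponent 0 is covered by a full period.
  iter-bounded : ∀ {y} → y < n → ∀ a → ∃[ k ] k < n × iter φ a y ≡ iter φ (suc k) y
  iter-bounded {y} y< a = let k , k≤ , e = go a in k , ≤-<-trans k≤ p< , e
    where
    p = proj₁ (period y<)
    p< = proj₁ (proj₂ (period y<))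
    pe = proj₂ (proj₂ (period y<))
    go : ∀ a → ∃[ k ] k ≤ p × iter φ a y ≡ iter φ (suc k) y
    go zero = p , ≤-refl , sym pe
    go (suc a) with go a
    ... | k , k≤ , e with k <? p
    ... | yes k<p = suc k , k<p , cong φ e
    ... | no k≮p = 0 , z≤n , cong φ (trans e (trans (cong (λ t → iter φ (suc t) y) (≤-antisym k≤ (≮⇒≥ k≮p))) pe))

  iter-return : ∀ {y} → y < n → ∀ j → ∃[ l ] iter φ l (iter φ j y) ≡ y
  -- With period `suc p`, `j * p` further steps after `j` steps complete `j` periods.
  iter-return {y} y< j = j * p , trans (sym (iter-+ φ (j * p) j y))
      (trans (cong (λ t → iter φ t y) (trans (+-comm (j * p) j) (sym (*-suc j p)))) (mult j))
    where
    p = proj₁ (period y<)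
    mult : ∀ j → iter φ (j * suc p) y ≡ y
    mult zero = refl
    mult (suc j) = trans (iter-+ φ (suc p) (j * suc p) y)
      (trans (cong (iter φ (suc p)) (mult j)) (proj₂ (proj₂ (period y<))))

  isMin : ℕ → Bool
  isMin j = all (λ k → j ≤ᵇ iter φ (suc k) j) (upTo n)

  isMin-≤ : ∀ {m} → m < n → T (isMin m) → ∀ a → m ≤ iter φ a m
  isMin-≤ {m} m< t a = let k , k< , e = iter-bounded m< a in
    subst (m ≤_) (sym e) (≤ᵇ⇒≤ m _ (all⁻ _ (upTo n) t (∈-upTo⁺ k<)))

  -- A common iterate of `m` and `m'` runs on to `m'` by periodicity, so `m'` is itself an iterate
  -- of `m`.
  min-≤ : ∀ {m m'} → m < n → m' < n → T (isMin m) → SameOrbit φ m m' → m ≤ m'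
  min-≤ {m} {m'} m< m'< t c =
    let i , j , e = orbits-meet φ c
        l , f = iter-return m'< j
    in subst (m ≤_) (trans (iter-+ φ l i m) (trans (cong (iter φ l) e) f)) (isMin-≤ m< t (l + i))

  -- Descent: a point that is not minimal has a strictly smaller iterate, and `b` bounds the number
  -- of such steps.
  find-min : ∀ b {y} → y < b → y < n → ∃[ m ] m < n × T (isMin m) × SameOrbit φ y m
  find-min (suc b) {y} y<b y< with isMin y in eq
  ... | true = y , y< , subst T (sym eq) tt , EqC.reflexive _
  ... | false =
    let k , k∈ , nt = ¬all⁻ (λ k → y ≤ᵇ iter φ (suc k) y) (upTo n) (λ t → subst T eq t)
        m , m< , t , c = find-min b (<-≤-trans (≰⇒> (nt ∘ ≤⇒≤ᵇ)) (≤-pred y<b)) (iter< (suc k) y<)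
    in m , m< , t , EqC.transitive _ (iter-orbit φ (suc k) y) c

  numCycles-representatives : ∀ {rs} → Representatives φ (upTo n) rs → numCycles n φ ≡ length rs
  numCycles-representatives {rs} (mkReps un snd cov sep) = ≤-antisym
    (length≤-by-relation (SameOrbit φ) mins rs (unique-filterᵇ isMin (Uniqueₚ.upTo⁺ n))
      (λ m∈ → cov (proj₁ (∈-filterᵇ⁻ isMin (upTo n) m∈)))
      (λ m∈ m'∈ _ c c' → same m∈ m'∈ (EqC.transitive _ c (EqC.symmetric _ c'))))
    (length≤-by-relation (SameOrbit φ) rs mins un
      (λ {r} r∈ → let m , m< , t , c = find-min (suc r) (n<1+n r) (∈-upTo⁻ (snd r∈)) in m , ∈-filterᵇ⁺ isMin (∈-upTo⁺ m<) t , c)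
      (λ r∈ r'∈ _ c c' → sep r∈ r'∈ (EqC.transitive _ c (EqC.symmetric _ c'))))
    where
    mins = filterᵇ isMin (upTo n)
    same : ∀ {m m'} → m ∈ mins → m' ∈ mins → SameOrbit φ m m' → m ≡ m'
    same m∈ m'∈ c =
      let i , t = ∈-filterᵇ⁻ isMin (upTo n) m∈
          i' , t' = ∈-filterᵇ⁻ isMin (upTo n) m'∈
      in ≤-antisym (min-≤ (∈-upTo⁻ i) (∈-upTo⁻ i') t c) (min-≤ (∈-upTo⁻ i') (∈-upTo⁻ i) t' (EqC.symmetric _ c))

-- Distributing faces over two sides, and trees of choices

bipartitions : {A : Set} → List A → List (List Bool × List A × List A)
bipartitions [] = ([] , [] , []) ∷ []
bipartitions (x ∷ xs) =
  map (λ (m , ys , zs) → true ∷ m , x ∷ ys , zs) (bipartitions xs) ++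
  map (λ (m , ys , zs) → false ∷ m , ys , x ∷ zs) (bipartitions xs)

bipartitions⁺ : {A : Set} {m : List Bool} {xs ys zs : List A} → Part m ys zs xs → (m , ys , zs) ∈ bipartitions xs
bipartitions⁺ [] = here refl
bipartitions⁺ (left p) = ∈-++⁺ˡ (∈-map⁺ _ (bipartitions⁺ p))
bipartitions⁺ {xs = x ∷ xs} (right p) =
  ∈-++⁺ʳ (map (λ (m , ys , zs) → true ∷ m , x ∷ ys , zs) (bipartitions xs)) (∈-map⁺ _ (bipartitions⁺ p))

bipartitions⁻ : {A : Set} {m : List Bool} (xs : List A) {ys zs : List A} → (m , ys , zs) ∈ bipartitions xs → Part m ys zs xs
bipartitions⁻ [] (here refl) = []
bipartitions⁻ (x ∷ xs) i with ∈-++⁻ (map (λ (m , ys , zs) → true ∷ m , x ∷ ys , zs) (bipartitions xs)) i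
... | inj₁ j with ∈-map⁻ _ j
... | _ , k , refl = left (bipartitions⁻ xs k)
bipartitions⁻ (x ∷ xs) i | inj₂ j with ∈-map⁻ _ j
... | _ , k , refl = right (bipartitions⁻ xs k)

part-by : {A : Set} (f : A → Bool) (xs : List A) → ∃[ m ] ∃[ ys ] ∃[ zs ] Part m ys zs xs ×
  (∀ {y} → y ∈ ys → f y ≡ true) × (∀ {z} → z ∈ zs → f z ≡ false)
part-by f [] = _ , _ , _ , [] , (λ ()) , (λ ())
part-by f (x ∷ xs) with part-by f xs | f x in eq
... | _ , _ , _ , p , l , r | true = _ , _ , _ , left p , (λ { (here refl) → eq ; (there i) → l i }) , r
... | _ , _ , _ , p , l , r | false = _ , _ , _ , right p , l , (λ { (here refl) → eq ; (there i) → r i })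

part-all-left : {A : Set} (xs : List A) → ∃[ m ] Part m xs [] xs
part-all-left [] = _ , []
part-all-left (x ∷ xs) = _ , left (proj₂ (part-all-left xs))

-- The tree of choices made while root edges are removed; faces enter only
-- through their lengths.
data Tree : Set where
  leaf : Tree
  node : ℕ → ℕ → List Bool → List ℕ → List ℕ → Tree → Tree → Tree
  join : List ℕ → ℕ → ℕ → List ℕ → Tree → Tree

-- In contrast to `Vertices`, a split hands each remaining face to one of two sides that never
-- interact again, and a branch may end only in a lone empty word. The indices of the tree record
-- where the partner of `x` stands.
data Planar (ι : ℕ → ℕ) : List (List ℕ) → Tree → Set where
  done  : Planar ι ([] ∷ []) leaf
  split : ∀ {x w u v m W W₁ W₂ t₁ t₂} → w ≡ u ++ ι x ∷ v → Part m W₁ W₂ W →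
    Planar ι (u ∷ W₁) t₁ → Planar ι (v ∷ W₂) t₂ →
    Planar ι ((x ∷ w) ∷ W) (node (length u) (length v) m (map length W₁) (map length W₂) t₁ t₂)
  merge : ∀ {x w v v' W W₁ W₂ t} → W ≡ W₁ ++ (v ++ ι x ∷ v') ∷ W₂ →
    Planar ι ((w ++ v' ++ v) ∷ W₁ ++ W₂) t →
    Planar ι ((x ∷ w) ∷ W) (join (map length W₁) (length v) (length v') (map length W₂) t)

-- Connectedness through two-colourings

-- Colourings see letters only, so an empty word would be an invisible separate sphere; `nonEmpty`
-- excludes it. The sphere with one vertex is therefore a case apart in `IsSphereOrConnected`.
record Connected (ι : ℕ → ℕ) (S : List (List ℕ)) : Set where
  constructor mkConn
  field
    nonEmpty   : ∀ {w} → w ∈ S → w ≢ []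
    monochrome : (c : ℕ → Bool) → (∀ {w a b} → w ∈ S → a ∈ w → b ∈ w → c a ≡ c b) →
      (∀ {a} → a ∈ concat S → c (ι a) ≡ c a) →
      ∀ {a b} → a ∈ concat S → b ∈ concat S → c a ≡ c b

IsSphereOrConnected : (ι : ℕ → ℕ) → List (List ℕ) → Set
IsSphereOrConnected ι S = S ≡ [] ∷ [] ⊎ Connected ι S

extend : List ℕ → (ℕ → Bool) → Bool → ℕ → Bool
extend L c c₀ a = if does (a ∈? L) then c a else c₀

extend-in : (L : List ℕ) (c : ℕ → Bool) (c₀ : Bool) {a : ℕ} → a ∈ L → extend L c c₀ a ≡ c a
extend-in L c c₀ {a} i with a ∈? L
... | yes _ = refl
... | no n = ⊥-elim (n i)

extend-out : (L : List ℕ) (c : ℕ → Bool) (c₀ : Bool) {a : ℕ} → a ∉ L → extend L c c₀ a ≡ c₀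
extend-out L c c₀ {a} n with a ∈? L
... | yes i = ⊥-elim (n i)
... | no _ = refl

extend-default : (L : List ℕ) (c : ℕ → Bool) (c₀ : Bool) {a : ℕ} → (a ∈ L → c a ≡ c₀) → extend L c c₀ a ≡ c₀
extend-default L c c₀ {a} h with a ∈? L
... | yes i = h i
... | no _ = refl

-- This is how connectedness of a large system is used on a smaller letter set `L`. Letters outside
-- `L` receive the default `c₀`, so a face that has lost letters stays monochrome if its remainder
-- in `L` has that colour.
extend-monochrome : {ι : ℕ → ℕ} {S : List (List ℕ)} → Connected ι S → Good ι S →
  (L : List ℕ) → ClosedUnder ι L → (c : ℕ → Bool) (c₀ : Bool) → (∀ {a} → a ∈ L → c (ι a) ≡ c a) →
  (∀ {w} → w ∈ S → (∀ {a} → a ∈ w → a ∈ L → c a ≡ c₀) ⊎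
                   ((∀ {a} → a ∈ w → a ∈ L) × (∀ {a b} → a ∈ w → b ∈ w → c a ≡ c b))) →
  ∀ {a b} → a ∈ concat S → b ∈ concat S → extend L c c₀ a ≡ extend L c c₀ b
extend-monochrome {ι} {S} C g L cl c c₀ inv words = Connected.monochrome C (extend L c c₀) const inv'
  where
  const : ∀ {w a b} → w ∈ S → a ∈ w → b ∈ w → extend L c c₀ a ≡ extend L c c₀ b
  const w∈ a∈ b∈ with words w∈
  ... | inj₁ h = trans (extend-default L c c₀ (h a∈)) (sym (extend-default L c c₀ (h b∈)))
  ... | inj₂ (s , h) = trans (extend-in L c c₀ (s a∈)) (trans (h a∈ b∈) (sym (extend-in L c c₀ (s b∈))))
  inv' : ∀ {a} → a ∈ concat S → extend L c c₀ (ι a) ≡ extend L c c₀ a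
  inv' {a} a∈ with a ∈? L
  ... | yes i = trans (extend-in L c c₀ (cl i)) (inv i)
  ... | no n = extend-out L c c₀ (λ i → n (subst (_∈ L) (Good.involutive g a∈) (cl i)))

no-letters : {W : List (List ℕ)} → (∀ {w} → w ∈ W → w ≢ []) → (∀ {a} → a ∉ concat W) → W ≡ []
no-letters {[]} ne em = refl
no-letters {[] ∷ W} ne em = ⊥-elim (ne (here refl) refl)
no-letters {(a ∷ w) ∷ W} ne em = ⊥-elim (em (here refl))

true≢false : true ≢ false
true≢false ()

-- For empty `u`, colour the letters of `W₁` `true` and all others `false`: since `x` is `false`
-- there can be no such letters, hence no faces. Otherwise a colouring of the side is extended by
-- the colour of the first letter of `u`, the only piece in which the side meets the old first face.
connected-restrict : {ι : ℕ → ℕ} {x : ℕ} {w : List ℕ} {W : List (List ℕ)} →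
  Connected ι ((x ∷ w) ∷ W) → Good ι ((x ∷ w) ∷ W) →
  (u : List ℕ) (W₁ : List (List ℕ)) → ClosedUnder ι (u ++ concat W₁) → x ∉ u ++ concat W₁ →
  (∀ {a} → a ∈ u → a ∈ w) →
  (∀ {y} → y ∈ W₁ → y ∈ W) →
  (∀ {y} → y ∈ W → y ∈ W₁ ⊎ (∀ {a} → a ∈ y → a ∉ u ++ concat W₁)) →
  (∀ {a} → a ∈ w → a ∈ u ++ concat W₁ → a ∈ u) →
  IsSphereOrConnected ι (u ∷ W₁)
connected-restrict {ι} {x} {w} {W} C g [] W₁ cl x∉ u⊆ sub dich inw =
  inj₁ (cong ([] ∷_) (no-letters (Connected.nonEmpty C ∘ there ∘ sub) λ {a} a∈ → true≢false
    (trans (sym (extend-in L _ false a∈)) (trans (col (up a∈) (here refl)) (extend-out L (λ _ → true) false x∉)))))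
  where
  L = concat W₁
  up : ∀ {a} → a ∈ L → a ∈ concat ((x ∷ w) ∷ W)
  up a∈ = let y , a∈y , y∈ = ∈-concat⁻′ W₁ a∈ in there (∈-++⁺ʳ w (∈-concat⁺′ a∈y (sub y∈)))
  col : ∀ {a b} → a ∈ concat ((x ∷ w) ∷ W) → b ∈ concat ((x ∷ w) ∷ W) →
    extend L (λ _ → true) false a ≡ extend L (λ _ → true) false b
  col = extend-monochrome C g L cl (λ _ → true) false (λ _ → refl) words
    where
    words : ∀ {y} → y ∈ (x ∷ w) ∷ W → (∀ {a} → a ∈ y → a ∈ L → true ≡ false) ⊎
      ((∀ {a} → a ∈ y → a ∈ L) × (∀ {a b : ℕ} → a ∈ y → b ∈ y → true ≡ true))
    words (here refl) = inj₁ λ { (here refl) i → ⊥-elim (x∉ i) ; (there a∈) i → case inw a∈ i of λ () }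
    words (there y∈) with dich y∈
    ... | inj₁ y∈₁ = inj₂ ((λ a∈ → ∈-concat⁺′ a∈ y∈₁) , λ _ _ → refl)
    ... | inj₂ out = inj₁ λ a∈ i → ⊥-elim (out a∈ i)
connected-restrict {ι} {x} {w} {W} C g (u₀ ∷ us) W₁ cl x∉ u⊆ sub dich inw =
  inj₂ (mkConn (λ { (here refl) () ; (there y∈) → Connected.nonEmpty C (there (sub y∈)) }) mono)
  where
  L = u₀ ∷ us ++ concat W₁
  up : ∀ {a} → a ∈ L → a ∈ concat ((x ∷ w) ∷ W)
  up a∈ = case ∈-++⁻ (u₀ ∷ us) a∈ of λ
    { (inj₁ i) → there (∈-++⁺ˡ (u⊆ i))
    ; (inj₂ i) → let y , a∈y , y∈ = ∈-concat⁻′ W₁ i in there (∈-++⁺ʳ w (∈-concat⁺′ a∈y (sub y∈))) }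
  mono : (c : ℕ → Bool) → (∀ {w a b} → w ∈ (u₀ ∷ us) ∷ W₁ → a ∈ w → b ∈ w → c a ≡ c b) →
      (∀ {a} → a ∈ L → c (ι a) ≡ c a) → ∀ {a b} → a ∈ L → b ∈ L → c a ≡ c b
  mono c const inv a∈ b∈ = trans (sym (extend-in L c (c u₀) a∈)) (trans (col (up a∈) (up b∈)) (extend-in L c (c u₀) b∈))
    where
    words : ∀ {y} → y ∈ (x ∷ w) ∷ W → (∀ {a} → a ∈ y → a ∈ L → c a ≡ c u₀) ⊎
      ((∀ {a} → a ∈ y → a ∈ L) × (∀ {a b} → a ∈ y → b ∈ y → c a ≡ c b))
    words (here refl) = inj₁ λ { (here refl) i → ⊥-elim (x∉ i) ; (there a∈) i → const (here refl) (inw a∈ i) (here refl) }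
    words (there y∈) with dich y∈
    ... | inj₁ y∈₁ = inj₂ ((λ a∈ → ∈-++⁺ʳ (u₀ ∷ us) (∈-concat⁺′ a∈ y∈₁)) , const (there y∈₁))
    ... | inj₂ out = inj₁ λ a∈ i → ⊥-elim (out a∈ i)
    col = extend-monochrome C g L cl c (c u₀) inv words

good-part : {ι : ℕ → ℕ} {m : List Bool} {S S₁ S₂ : List (List ℕ)} → Part m S₁ S₂ S → Good ι S →
  ClosedUnder ι (concat S₁) → Good ι S₁
good-part {S₁ = S₁} p (mkGood un _ inv ff) cl =
  mkGood (proj₁ (unique-++⁻ (concat S₁) (unique-resp-↭ (part-concat-↭ p) un))) cl (inv ∘ up) (ff ∘ up)
  where
  up : ∀ {a} → a ∈ concat S₁ → _
  up i = ∈-resp-↭ (↭-sym (part-concat-↭ p)) (∈-++⁺ˡ i)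

part-disjoint : {m : List Bool} {S S₁ S₂ : List (List ℕ)} → Part m S₁ S₂ S → Unique (concat S) →
  ∀ {a} → a ∈ concat S₁ → a ∉ concat S₂
part-disjoint {S₁ = S₁} p un = proj₂ (proj₂ (unique-++⁻ (concat S₁) (unique-resp-↭ (part-concat-↭ p) un)))

-- Whether the removed edge separates is settled constructively by a search through the finitely
-- many distributions of the other faces.
closedPart? : (ι : ℕ → ℕ) (u v : List ℕ) (W : List (List ℕ)) →
  (∃[ m ] ∃[ W₁ ] ∃[ W₂ ] Part m W₁ W₂ W × ClosedUnder ι (u ++ concat W₁) × ClosedUnder ι (v ++ concat W₂)) ⊎
  (∀ {m W₁ W₂} → Part m W₁ W₂ W → ClosedUnder ι (u ++ concat W₁) → ¬ ClosedUnder ι (v ++ concat W₂))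
closedPart? ι u v W with Any.any? (λ (m , W₁ , W₂) →
    All.all? (λ a → ι a ∈? u ++ concat W₁) (u ++ concat W₁) ×-dec
    All.all? (λ a → ι a ∈? v ++ concat W₂) (v ++ concat W₂)) (bipartitions W)
... | yes i = let (m , W₁ , W₂) , i∈ , h₁ , h₂ = find i in
        inj₁ (m , W₁ , W₂ , bipartitions⁻ W i∈ , All.lookup h₁ , All.lookup h₂)
... | no n = inj₂ λ p c₁ c₂ → n (lose (bipartitions⁺ p) (All.tabulate c₁ , All.tabulate c₂))

module _ {ι : ℕ → ℕ} {x : ℕ} {u v : List ℕ} {W : List (List ℕ)}
  (g : Good ι ((x ∷ u ++ ι x ∷ v) ∷ W)) where

  private
    L = concat (u ∷ v ∷ W)
    g' : Good ι (u ∷ v ∷ W)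
    g' = good-split u v W g
    perm = split-↭ x (ι x) u v W
    facts = unique-pair (unique-resp-↭ perm (Good.unique g))
    x∉ : x ∉ L
    x∉ = proj₁ (proj₂ facts)
    x'∉ : ι x ∉ L
    x'∉ = proj₂ (proj₂ facts) ∘ there

  connected-left : {m : List Bool} {W₁ W₂ : List (List ℕ)} → Part m W₁ W₂ W →
    ClosedUnder ι (u ++ concat W₁) → Connected ι ((x ∷ u ++ ι x ∷ v) ∷ W) → IsSphereOrConnected ι (u ∷ W₁)
  connected-left {W₁ = W₁} {W₂} p cl C = connected-restrict C g u W₁ cl (x∉ ∘ up) ∈-++⁺ˡ (part-∈ˡ p) dich inw
    where
    p⁺ : Part (true ∷ false ∷ _) (u ∷ W₁) (v ∷ W₂) (u ∷ v ∷ W)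
    p⁺ = left (right p)
    up : ∀ {a} → a ∈ u ++ concat W₁ → a ∈ L
    up i = ∈-resp-↭ (↭-sym (part-concat-↭ p⁺)) (∈-++⁺ˡ i)
    dich : ∀ {y} → y ∈ W → y ∈ W₁ ⊎ (∀ {a} → a ∈ y → a ∉ u ++ concat W₁)
    dich y∈ with part-∈⁻ p y∈
    ... | inj₁ i = inj₁ i
    ... | inj₂ i = inj₂ λ a∈ a∈L → part-disjoint p⁺ (Good.unique g') a∈L (∈-++⁺ʳ v (∈-concat⁺′ a∈ i))
    inw : ∀ {a} → a ∈ u ++ ι x ∷ v → a ∈ u ++ concat W₁ → a ∈ u
    inw a∈ a∈L with ∈-++⁻ u a∈
    ... | inj₁ i = i
    ... | inj₂ (here refl) = ⊥-elim (x'∉ (up a∈L))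
    ... | inj₂ (there i) = ⊥-elim (part-disjoint p⁺ (Good.unique g') a∈L (∈-++⁺ˡ i))

  connected-right : {m : List Bool} {W₁ W₂ : List (List ℕ)} → Part m W₁ W₂ W →
    ClosedUnder ι (v ++ concat W₂) → Connected ι ((x ∷ u ++ ι x ∷ v) ∷ W) → IsSphereOrConnected ι (v ∷ W₂)
  connected-right {W₁ = W₁} {W₂} p cl C =
    connected-restrict C g v W₂ cl (x∉ ∘ up) (∈-++⁺ʳ u ∘ there) (part-∈ʳ p) dich inw
    where
    p⁺ : Part (true ∷ false ∷ _) (u ∷ W₁) (v ∷ W₂) (u ∷ v ∷ W)
    p⁺ = left (right p)
    up : ∀ {a} → a ∈ v ++ concat W₂ → a ∈ L
    up i = ∈-resp-↭ (↭-sym (part-concat-↭ p⁺)) (∈-++⁺ʳ (u ++ concat W₁) i)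
    dich : ∀ {y} → y ∈ W → y ∈ W₂ ⊎ (∀ {a} → a ∈ y → a ∉ v ++ concat W₂)
    dich y∈ with part-∈⁻ p y∈
    ... | inj₂ i = inj₁ i
    ... | inj₁ i = inj₂ λ a∈ a∈L → part-disjoint p⁺ (Good.unique g') (∈-++⁺ʳ u (∈-concat⁺′ a∈ i)) a∈L
    inw : ∀ {a} → a ∈ u ++ ι x ∷ v → a ∈ v ++ concat W₂ → a ∈ v
    inw a∈ a∈L with ∈-++⁻ u a∈
    ... | inj₁ i = ⊥-elim (part-disjoint p⁺ (Good.unique g') (∈-++⁺ˡ i) a∈L)
    ... | inj₂ (here refl) = ⊥-elim (x'∉ (up a∈L))
    ... | inj₂ (there i) = i

  -- If an admissible colouring gave `u` and `v` different colours, sorting the other faces by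
  -- colour would be a separation. So `u` and `v` agree, and the colouring is admissible before the
  -- removal as well.
  connected-nonseparating : Connected ι ((x ∷ u ++ ι x ∷ v) ∷ W) →
    (∀ {m W₁ W₂} → Part m W₁ W₂ W → ClosedUnder ι (u ++ concat W₁) → ¬ ClosedUnder ι (v ++ concat W₂)) →
    Connected ι (u ∷ v ∷ W)
  connected-nonseparating C nosep = mkConn ne mono
    where
    cl' : ClosedUnder ι L
    cl' = Good.closed g'
    -- With `u` empty, all other faces could be given to `v`, and the empty side would be closed for
    -- trivial reasons.
    u≢[] : u ≢ []
    u≢[] refl = let m , p = part-all-left W in nosep (part-swap p) (λ ()) cl'
    v≢[] : v ≢ []
    v≢[] refl = let m , p = part-all-left W in nosep p cl' (λ ())
    ne : ∀ {y} → y ∈ u ∷ v ∷ W → y ≢ []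
    ne (here refl) = u≢[]
    ne (there (here refl)) = v≢[]
    ne (there (there y∈)) = Connected.nonEmpty C (there y∈)
    mono : (c : ℕ → Bool) → (∀ {w a b} → w ∈ u ∷ v ∷ W → a ∈ w → b ∈ w → c a ≡ c b) →
      (∀ {a} → a ∈ L → c (ι a) ≡ c a) → ∀ {a b} → a ∈ L → b ∈ L → c a ≡ c b
    mono c const inv a∈ b∈ = trans (sym (extend-in L c cu a∈)) (trans (col (up a∈) (up b∈)) (extend-in L c cu b∈))
      where
      headColour : List ℕ → Bool
      headColour [] = true
      headColour (a ∷ _) = c a
      cu = headColour u
      headColour-∈ : ∀ {y a} → y ∈ u ∷ v ∷ W → a ∈ y → c a ≡ headColour y
      headColour-∈ {b ∷ y} y∈ a∈ = const y∈ a∈ (here refl)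
      u≡v : headColour v ≡ cu
      u≡v with headColour v ≟ᵇ cu
      ... | yes e = e
      ... | no ne = ⊥-elim (nosep p clu clv)
        where
        bip = part-by (λ y → does (headColour y ≟ᵇ cu)) W
        W₁ = proj₁ (proj₂ bip)
        W₂ = proj₁ (proj₂ (proj₂ bip))
        p = proj₁ (proj₂ (proj₂ (proj₂ bip)))
        p⁺ : Part (true ∷ false ∷ _) (u ∷ W₁) (v ∷ W₂) (u ∷ v ∷ W)
        p⁺ = left (right p)
        on₁ : ∀ {y} → y ∈ W₁ → headColour y ≡ cu
        on₁ {y} y∈ with headColour y ≟ᵇ cu | proj₁ (proj₂ (proj₂ (proj₂ (proj₂ bip)))) y∈
        ... | yes e | _ = e
        on₂ : ∀ {y} → y ∈ W₂ → headColour y ≢ cu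
        on₂ {y} y∈ with headColour y ≟ᵇ cu | proj₂ (proj₂ (proj₂ (proj₂ (proj₂ bip)))) y∈
        ... | no n | _ = n
        col₁ : ∀ {a} → a ∈ u ++ concat W₁ → a ∈ L × c a ≡ cu
        col₁ a∈ with ∈-++⁻ u a∈
        ... | inj₁ i = ∈-++⁺ˡ i , headColour-∈ (here refl) i
        ... | inj₂ i = let y , a∈y , y∈ = ∈-concat⁻′ W₁ i in
          ∈-++⁺ʳ u (∈-++⁺ʳ v (∈-concat⁺′ a∈y (part-∈ˡ p y∈))) ,
          trans (headColour-∈ (there (there (part-∈ˡ p y∈))) a∈y) (on₁ y∈)
        col₂ : ∀ {a} → a ∈ v ++ concat W₂ → a ∈ L × c a ≢ cu
        col₂ a∈ with ∈-++⁻ v a∈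
        ... | inj₁ i = ∈-++⁺ʳ u (∈-++⁺ˡ i) , λ e → ne (trans (sym (headColour-∈ (there (here refl)) i)) e)
        ... | inj₂ i = let y , a∈y , y∈ = ∈-concat⁻′ W₂ i in
          ∈-++⁺ʳ u (∈-++⁺ʳ v (∈-concat⁺′ a∈y (part-∈ʳ p y∈))) ,
          λ e → on₂ y∈ (trans (sym (headColour-∈ (there (there (part-∈ʳ p y∈))) a∈y)) e)
        side : ∀ {a} → a ∈ L → a ∈ u ++ concat W₁ ⊎ a ∈ v ++ concat W₂
        side a∈ = ∈-++⁻ (u ++ concat W₁) (∈-resp-↭ (part-concat-↭ p⁺) a∈)
        clu : ClosedUnder ι (u ++ concat W₁)
        clu a∈ with side (cl' (proj₁ (col₁ a∈)))
        ... | inj₁ i = i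
        ... | inj₂ i = ⊥-elim (proj₂ (col₂ i) (trans (inv (proj₁ (col₁ a∈))) (proj₂ (col₁ a∈))))
        clv : ClosedUnder ι (v ++ concat W₂)
        clv a∈ with side (cl' (proj₁ (col₂ a∈)))
        ... | inj₂ i = i
        ... | inj₁ i = ⊥-elim (proj₂ (col₂ a∈) (trans (sym (inv (proj₁ (col₂ a∈)))) (proj₂ (col₁ i))))
      words : ∀ {y} → y ∈ (x ∷ u ++ ι x ∷ v) ∷ W → (∀ {a} → a ∈ y → a ∈ L → c a ≡ cu) ⊎
        ((∀ {a} → a ∈ y → a ∈ L) × (∀ {a b} → a ∈ y → b ∈ y → c a ≡ c b))
      words (there y∈) = inj₂ ((λ a∈ → ∈-++⁺ʳ u (∈-++⁺ʳ v (∈-concat⁺′ a∈ y∈))) , const (there (there y∈)))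
      words (here refl) = inj₁ h
        where
        h : ∀ {a} → a ∈ x ∷ u ++ ι x ∷ v → a ∈ L → c a ≡ cu
        h (here refl) i = ⊥-elim (x∉ i)
        h (there a∈) i with ∈-++⁻ u a∈
        ... | inj₁ j = headColour-∈ (here refl) j
        ... | inj₂ (here refl) = ⊥-elim (x'∉ i)
        ... | inj₂ (there j) = trans (headColour-∈ (there (here refl)) j) u≡v
      up : ∀ {a} → a ∈ L → a ∈ concat ((x ∷ u ++ ι x ∷ v) ∷ W)
      up i = ∈-resp-↭ (↭-sym perm) (there (there i))
      col = extend-monochrome C g L cl' c cu inv words

module _ {ι : ℕ → ℕ} {x : ℕ} {w v v' : List ℕ} {W₁ W₂ : List (List ℕ)}
  (g : Good ι ((x ∷ w) ∷ W₁ ++ (v ++ ι x ∷ v') ∷ W₂)) where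

  private
    L = concat ((w ++ v' ++ v) ∷ W₁ ++ W₂)
    g' : Good ι ((w ++ v' ++ v) ∷ W₁ ++ W₂)
    g' = good-merge w v v' W₁ W₂ g
    perm = merge-↭ x (ι x) w v v' W₁ W₂
    facts = unique-pair (unique-resp-↭ perm (Good.unique g))
    x∉ : x ∉ L
    x∉ = proj₁ (proj₂ facts)
    x'∉ : ι x ∉ L
    x'∉ = proj₂ (proj₂ facts) ∘ there
    up : ∀ {a} → a ∈ L → a ∈ concat ((x ∷ w) ∷ W₁ ++ (v ++ ι x ∷ v') ∷ W₂)
    up i = ∈-resp-↭ (↭-sym perm) (there (there i))
    word-cases : ∀ {y} → y ∈ (x ∷ w) ∷ W₁ ++ (v ++ ι x ∷ v') ∷ W₂ →
      (∀ {a} → a ∈ y → a ∈ L → a ∈ w ++ v' ++ v) ⊎ y ∈ W₁ ++ W₂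
    word-cases (here refl) = inj₁ λ { (here refl) i → ⊥-elim (x∉ i) ; (there j) i → ∈-++⁺ˡ j }
    word-cases (there y∈) with ∈-++⁻ W₁ y∈
    ... | inj₁ i = inj₂ (∈-++⁺ˡ i)
    ... | inj₂ (there i) = inj₂ (∈-++⁺ʳ W₁ i)
    ... | inj₂ (here refl) = inj₁ h
      where
      h : ∀ {a} → a ∈ v ++ ι x ∷ v' → a ∈ L → a ∈ w ++ v' ++ v
      h a∈ i with ∈-++⁻ v a∈
      ... | inj₁ j = ∈-++⁺ʳ w (∈-++⁺ʳ v' j)
      ... | inj₂ (here refl) = ⊥-elim (x'∉ i)
      ... | inj₂ (there j) = ∈-++⁺ʳ w (∈-++⁺ˡ j)
    rest-nonEmpty : Connected ι ((x ∷ w) ∷ W₁ ++ (v ++ ι x ∷ v') ∷ W₂) → ∀ {y} → y ∈ W₁ ++ W₂ → y ≢ []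
    rest-nonEmpty C y∈ with ∈-++⁻ W₁ y∈
    ... | inj₁ i = Connected.nonEmpty C (there (∈-++⁺ˡ i))
    ... | inj₂ i = Connected.nonEmpty C (there (∈-++⁺ʳ W₁ (there i)))

  connected-merge : Connected ι ((x ∷ w) ∷ W₁ ++ (v ++ ι x ∷ v') ∷ W₂) →
    IsSphereOrConnected ι ((w ++ v' ++ v) ∷ W₁ ++ W₂)
  connected-merge C with w ++ v' ++ v in eq
  ... | [] = inj₁ (cong ([] ∷_) (no-letters (rest-nonEmpty C) λ {a} a∈ →
        let a∈L = subst (a ∈_) (cong (_++ concat (W₁ ++ W₂)) (sym eq)) a∈ in
        true≢false (trans (sym (extend-in L _ false a∈L)) (trans (col (up a∈L) (here refl)) (extend-out L (λ _ → true) false x∉)))))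
    where
    words : ∀ {y} → y ∈ (x ∷ w) ∷ W₁ ++ (v ++ ι x ∷ v') ∷ W₂ → (∀ {a} → a ∈ y → a ∈ L → true ≡ false) ⊎
      ((∀ {a} → a ∈ y → a ∈ L) × (∀ {a b : ℕ} → a ∈ y → b ∈ y → true ≡ true))
    words y∈ with word-cases y∈
    ... | inj₁ h = inj₁ λ {a} a∈ i → case subst (a ∈_) eq (h a∈ i) of λ ()
    ... | inj₂ h = inj₂ ((λ a∈ → ∈-++⁺ʳ (w ++ v' ++ v) (∈-concat⁺′ a∈ h)) , λ _ _ → refl)
    col = extend-monochrome C g L (Good.closed g') (λ _ → true) false (λ _ → refl) words
  ... | h ∷ t = inj₂ (mkConn (λ { (here refl) () ; (there i) → rest-nonEmpty C i }) mono)
    where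
    L≡ : concat ((h ∷ t) ∷ W₁ ++ W₂) ≡ L
    L≡ = cong (_++ concat (W₁ ++ W₂)) (sym eq)
    mono : (c : ℕ → Bool) → (∀ {w a b} → w ∈ (h ∷ t) ∷ W₁ ++ W₂ → a ∈ w → b ∈ w → c a ≡ c b) →
      (∀ {a} → a ∈ concat ((h ∷ t) ∷ W₁ ++ W₂) → c (ι a) ≡ c a) →
      ∀ {a b} → a ∈ concat ((h ∷ t) ∷ W₁ ++ W₂) → b ∈ concat ((h ∷ t) ∷ W₁ ++ W₂) → c a ≡ c b
    mono c const inv {a} {b} a∈ b∈ = trans (sym (extend-in L c (c h) a∈L))
        (trans (col (up a∈L) (up b∈L)) (extend-in L c (c h) b∈L))
      where
      a∈L = subst (a ∈_) L≡ a∈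
      b∈L = subst (b ∈_) L≡ b∈
      words : ∀ {y} → y ∈ (x ∷ w) ∷ W₁ ++ (v ++ ι x ∷ v') ∷ W₂ → (∀ {a} → a ∈ y → a ∈ L → c a ≡ c h) ⊎
        ((∀ {a} → a ∈ y → a ∈ L) × (∀ {a b : ℕ} → a ∈ y → b ∈ y → c a ≡ c b))
      words y∈ with word-cases y∈
      ... | inj₁ k = inj₁ λ {a} a∈ i → const (here refl) (subst (a ∈_) eq (k a∈ i)) (here refl)
      ... | inj₂ k = inj₂ ((λ a∈ → ∈-++⁺ʳ (w ++ v' ++ v) (∈-concat⁺′ a∈ k)) , const (there k))
      col = extend-monochrome C g L (Good.closed g') c (c h)
        (λ {a} i → inv (subst (a ∈_) (sym L≡) i)) words

-- Euler's inequality and its case of equality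

-- The inequality is doubled, so that the number of letters stands for twice the number of edges.
-- Only equality comes with a tree.
Euler : (ι : ℕ → ℕ) → List (List ℕ) → Set
Euler ι S = ∃[ k ] Vertices ι S k ×
  (2 * (k + length S) < 4 + length (concat S) ⊎
   (2 * (k + length S) ≡ 4 + length (concat S) × ∃[ t ] Planar ι S t))

≡⊎<⇒≤ : {a b : ℕ} {P : Set} → a < b ⊎ (a ≡ b × P) → a ≤ b
≡⊎<⇒≤ (inj₁ l) = <⇒≤ l
≡⊎<⇒≤ (inj₂ (e , _)) = ≤-reflexive e

split-sum : ∀ k₁ k₂ a b → 2 * (k₁ + suc a) + 2 * (k₂ + suc b) ≡ 2 + 2 * ((k₁ + k₂) + suc (a + b))
split-sum = solve 4 (λ k₁ k₂ a b → con 2 :* (k₁ :+ (con 1 :+ a)) :+ con 2 :* (k₂ :+ (con 1 :+ b)) :=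
  con 2 :+ con 2 :* ((k₁ :+ k₂) :+ (con 1 :+ (a :+ b)))) refl
  where open +-*-Solver

split-bound : ∀ n₁ n₂ → (4 + n₁) + (4 + n₂) ≡ 2 + (4 + (2 + (n₁ + n₂)))
split-bound = solve 2 (λ a b → (con 4 :+ a) :+ (con 4 :+ b) := con 2 :+ (con 4 :+ (con 2 :+ (a :+ b)))) refl
  where open +-*-Solver

-- Of the constants 4 + 4 of the two sides, 2 pays for the additional face and 2 for the two removed
-- letters, which leaves exactly 4. The bound is thus preserved without slack.
split-< : ∀ k₁ k₂ a b n₁ n₂ → 2 * (k₁ + suc a) + 2 * (k₂ + suc b) < (4 + n₁) + (4 + n₂) →
  2 * ((k₁ + k₂) + suc (a + b)) < 4 + (2 + (n₁ + n₂))
split-< k₁ k₂ a b n₁ n₂ l = +-cancelˡ-< 2 _ _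
  (subst (_< 2 + (4 + (2 + (n₁ + n₂)))) (split-sum k₁ k₂ a b)
    (subst (2 * (k₁ + suc a) + 2 * (k₂ + suc b) <_) (split-bound n₁ n₂) l))

split-≡ : ∀ k₁ k₂ a b n₁ n₂ → 2 * (k₁ + suc a) ≡ 4 + n₁ → 2 * (k₂ + suc b) ≡ 4 + n₂ →
  2 * ((k₁ + k₂) + suc (a + b)) ≡ 4 + (2 + (n₁ + n₂))
split-≡ k₁ k₂ a b n₁ n₂ e₁ e₂ = +-cancelˡ-≡ 2 _ _
  (trans (sym (split-sum k₁ k₂ a b)) (trans (cong₂ _+_ e₁ e₂) (split-bound n₁ n₂)))

double-suc : ∀ k l → 2 * (k + suc l) ≡ 2 + 2 * (k + l)
double-suc = solve 2 (λ k l → con 2 :* (k :+ (con 1 :+ l)) := con 2 :+ con 2 :* (k :+ l)) refl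
  where open +-*-Solver

double-suc-≡ : ∀ k l n → 2 * (k + l) ≡ 4 + n → 2 * (k + suc l) ≡ 4 + (2 + n)
double-suc-≡ k l n e = trans (double-suc k l) (cong (2 +_) e)

length-insert : {A : Set} (xs : List A) (y : A) (ys : List A) → length (xs ++ y ∷ ys) ≡ suc (length (xs ++ ys))
length-insert [] y ys = refl
length-insert (x ∷ xs) y ys = cong suc (length-insert xs y ys)

split-length : (x x' : ℕ) (u v : List ℕ) {m : List Bool} {W W₁ W₂ : List (List ℕ)} → Part m W₁ W₂ W →
  length (concat ((x ∷ u ++ x' ∷ v) ∷ W)) ≡ 2 + (length (concat (u ∷ W₁)) + length (concat (v ∷ W₂)))
split-length x x' u v {W = W} {W₁} {W₂} p = trans (↭-length (split-↭ x x' u v W))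
  (cong (2 +_) (trans (↭-length (part-concat-↭ p⁺)) (length-++ (concat (u ∷ W₁)))))
  where
  p⁺ : Part (true ∷ false ∷ _) (u ∷ W₁) (v ∷ W₂) (u ∷ v ∷ W)
  p⁺ = left (right p)

-- The smaller systems are not structural parts of the given one, so `f` bounds the number of
-- letters.
euler : (f : ℕ) {ι : ℕ → ℕ} (w : List ℕ) (W : List (List ℕ)) → length (concat (w ∷ W)) ≤ f →
  Good ι (w ∷ W) → IsSphereOrConnected ι (w ∷ W) → Euler ι (w ∷ W)
euler f [] .[] f≤ g (inj₁ refl) = 1 , empty none , inj₂ (refl , leaf , done)
euler f [] W f≤ g (inj₂ C) = ⊥-elim (Connected.nonEmpty C (here refl) refl)
euler (suc f) {ι} (x ∷ w) W (s≤s f≤) g (inj₂ C) with ∈-++⁻ (x ∷ w) (Good.closed g (here refl))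
... | inj₁ (here e) = ⊥-elim (Good.fixedFree g (here refl) e)
... | inj₁ (there x'∈) with ∈-∃++ x'∈
... | u , v , refl with closedPart? ι u v W
... | inj₁ (m , W₁ , W₂ , p , cl₁ , cl₂) = result (euler f u W₁ l₁ g₁ (connected-left g p cl₁ C)) (euler f v W₂ l₂ g₂ (connected-right g p cl₂ C))
  where
  n₁ = length (concat (u ∷ W₁))
  n₂ = length (concat (v ∷ W₂))
  n≡ : length (concat ((x ∷ u ++ ι x ∷ v) ∷ W)) ≡ 2 + (n₁ + n₂)
  n≡ = split-length x (ι x) u v p
  bound : n₁ + n₂ ≤ f
  bound = ≤-trans (n≤1+n _) (≤-trans (≤-reflexive (sym (suc-injective n≡))) f≤)
  l₁ = ≤-trans (m≤m+n n₁ n₂) bound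
  l₂ = ≤-trans (m≤n+m n₂ n₁) bound
  p⁺ : Part (true ∷ false ∷ m) (u ∷ W₁) (v ∷ W₂) (u ∷ v ∷ W)
  p⁺ = left (right p)
  g₁ = good-part p⁺ (good-split u v W g) cl₁
  g₂ = good-part (part-swap p⁺) (good-split u v W g) cl₂
  K≡ : length W ≡ length W₁ + length W₂
  K≡ = part-length p
  result : Euler ι (u ∷ W₁) → Euler ι (v ∷ W₂) → Euler ι ((x ∷ u ++ ι x ∷ v) ∷ W)
  result (k₁ , d₁ , c₁) (k₂ , d₂ , c₂) = k₁ + k₂ , split refl (vertices-part d₁ d₂ p⁺) , cases c₁ c₂
    where
    a = length W₁
    b = length W₂
    strict : 2 * (k₁ + suc a) + 2 * (k₂ + suc b) < (4 + n₁) + (4 + n₂) →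
      2 * ((k₁ + k₂) + suc (length W)) < 4 + length (concat ((x ∷ u ++ ι x ∷ v) ∷ W))
    strict l rewrite n≡ | K≡ = split-< k₁ k₂ a b n₁ n₂ l
    cases : 2 * (k₁ + suc a) < 4 + n₁ ⊎ (2 * (k₁ + suc a) ≡ 4 + n₁ × ∃[ t ] Planar ι (u ∷ W₁) t) →
      2 * (k₂ + suc b) < 4 + n₂ ⊎ (2 * (k₂ + suc b) ≡ 4 + n₂ × ∃[ t ] Planar ι (v ∷ W₂) t) → _
    cases (inj₁ l) c = inj₁ (strict (+-mono-<-≤ l (≡⊎<⇒≤ c)))
    cases (inj₂ (e , _)) (inj₁ l) = inj₁ (strict (+-mono-≤-< (≤-reflexive e) l))
    cases (inj₂ (e₁ , t₁ , P₁)) (inj₂ (e₂ , t₂ , P₂)) = inj₂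
      (trans (cong (λ K → 2 * ((k₁ + k₂) + suc K)) K≡)
        (trans (split-≡ k₁ k₂ a b n₁ n₂ e₁ e₂) (cong (4 +_) (sym n≡))) ,
       _ , split refl p P₁ P₂)
-- A nonseparating split has one face more and two letters fewer with the same vertices. The bound
-- for the new system therefore leaves a slack of 4 in the old one, the cost of one handle, and the
-- inequality is strict.
... | inj₂ nosep = result (euler f u (v ∷ W) l' (good-split u v W g) (inj₂ (connected-nonseparating g C nosep)))
  where
  n' = length (concat (u ∷ v ∷ W))
  n≡ : length (concat ((x ∷ u ++ ι x ∷ v) ∷ W)) ≡ 2 + n'
  n≡ = ↭-length (split-↭ x (ι x) u v W)
  l' : n' ≤ f
  l' = ≤-trans (n≤1+n _) (≤-trans (≤-reflexive (sym (suc-injective n≡))) f≤)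
  result : Euler ι (u ∷ v ∷ W) → Euler ι ((x ∷ u ++ ι x ∷ v) ∷ W)
  result (k , d , c) = k , split refl d , inj₁ (≤-trans (s≤s (<⇒≤ lt)) (≤-trans (s≤s (≡⊎<⇒≤ c)) (+-monoʳ-≤ 4 (≤-trans (n≤1+n _) (≤-reflexive (sym n≡)))) ))
    where
    lt : 2 * (k + suc (length W)) < 2 * (k + suc (suc (length W)))
    lt = subst (2 * (k + suc (length W)) <_) (sym (double-suc k (suc (length W)))) (s≤s (n≤1+n _))
euler (suc f) {ι} (x ∷ w) W (s≤s f≤) g (inj₂ C) | inj₂ x'∈ with ∈-concat⁻′ W x'∈
... | y , x'∈y , y∈ with ∈-∃++ x'∈y | ∈-∃++ y∈
... | v , v' , refl | W₁ , W₂ , refl = result (euler f (w ++ v' ++ v) (W₁ ++ W₂) l' (good-merge w v v' W₁ W₂ g) (connected-merge g C))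
  where
  S = (x ∷ w) ∷ W₁ ++ (v ++ ι x ∷ v') ∷ W₂
  S' = (w ++ v' ++ v) ∷ W₁ ++ W₂
  n' = length (concat S')
  n≡ : length (concat S) ≡ 2 + n'
  n≡ = ↭-length (merge-↭ x (ι x) w v v' W₁ W₂)
  l' : n' ≤ f
  l' = ≤-trans (n≤1+n _) (≤-trans (≤-reflexive (sym (suc-injective n≡))) f≤)
  K≡ : length S ≡ suc (length S')
  K≡ = cong suc (length-insert W₁ _ W₂)
  result : Euler ι S' → Euler ι S
  -- A merge loses one face and two letters, so both sides of the bound drop by 2 and its kind is
  -- kept.
  result (k , d , c) = k , merge refl d , cases c
    where
    cases : 2 * (k + length S') < 4 + n' ⊎ (2 * (k + length S') ≡ 4 + n' × ∃[ t ] Planar ι S' t) →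
      2 * (k + length S) < 4 + length (concat S) ⊎ (2 * (k + length S) ≡ 4 + length (concat S) × ∃[ t ] Planar ι S t)
    cases (inj₁ l) = inj₁ (subst (λ K → 2 * (k + K) < 4 + length (concat S)) (sym K≡)
      (subst (λ n → 2 * (k + suc (length S')) < 4 + n) (sym n≡)
        (subst (_< 4 + (2 + n')) (sym (double-suc k (length S'))) (s≤s (s≤s l)))))
    cases (inj₂ (e , t , P)) = inj₂ (subst (λ K → 2 * (k + K) ≡ 4 + length (concat S)) (sym K≡)
      (subst (λ n → 2 * (k + suc (length S')) ≡ 4 + n) (sym n≡) (double-suc-≡ k (length S') n' e)) ,
      _ , merge refl P)

-- Planar derivations give connected systems

split-part-↭ : (x x' : ℕ) (u v : List ℕ) {m : List Bool} {W W₁ W₂ : List (List ℕ)} → Part m W₁ W₂ W →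
  concat ((x ∷ u ++ x' ∷ v) ∷ W) ↭ x' ∷ x ∷ concat (u ∷ W₁) ++ concat (v ∷ W₂)
split-part-↭ x x' u v {W = W} {W₁} {W₂} p =
  ↭-trans (split-↭ x x' u v W) (Perm.prep x' (Perm.prep x (part-concat-↭ p⁺)))
  where
  p⁺ : Part (true ∷ false ∷ _) (u ∷ W₁) (v ∷ W₂) (u ∷ v ∷ W)
  p⁺ = left (right p)

planar-vertices : {ι : ℕ → ℕ} {S : List (List ℕ)} {t : Tree} → Planar ι S t →
  ∃[ k ] Vertices ι S k × 2 * (k + length S) ≡ 4 + length (concat S)
planar-vertices done = 1 , empty none , refl
planar-vertices {ι} (split {x} {_} {u} {v} {m} {W} {W₁} {W₂} refl p P₁ P₂) =
  let k₁ , d₁ , e₁ = planar-vertices P₁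
      k₂ , d₂ , e₂ = planar-vertices P₂
  in k₁ + k₂ , split refl (vertices-part d₁ d₂ (left (right p))) ,
     trans (cong (λ K → 2 * ((k₁ + k₂) + suc K)) (part-length p))
       (trans (split-≡ k₁ k₂ (length W₁) (length W₂) _ _ e₁ e₂) (cong (4 +_) (sym (split-length x (ι x) u v p))))
planar-vertices {ι} (merge {x} {w} {v} {v'} {_} {W₁} {W₂} refl P) =
  let k , d , e = planar-vertices P
  in k , merge refl d ,
     trans (cong (λ K → 2 * (k + suc K)) (length-insert W₁ _ W₂))
       (trans (double-suc-≡ k _ _ e) (cong (4 +_) (sym (↭-length (merge-↭ x (ι x) w v v' W₁ W₂)))))

pair-closed : {ι : ℕ → ℕ} {x : ℕ} {L M : List ℕ} → L ↭ ι x ∷ x ∷ M → ι (ι x) ≡ x → ClosedUnder ι M → ClosedUnder ι L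
pair-closed {ι} {x} p e cl a∈ with ∈-resp-↭ p a∈
... | here refl = ∈-resp-↭ (↭-sym p) (there (here e))
... | there (here refl) = ∈-resp-↭ (↭-sym p) (here refl)
... | there (there i) = ∈-resp-↭ (↭-sym p) (there (there (cl i)))

++-closed : {φ : ℕ → ℕ} (L : List ℕ) {M : List ℕ} → ClosedUnder φ L → ClosedUnder φ M → ClosedUnder φ (L ++ M)
++-closed L cl cm a∈ with ∈-++⁻ L a∈
... | inj₁ i = ∈-++⁺ˡ (cl i)
... | inj₂ i = ∈-++⁺ʳ L (cm i)

-- A derivation consumes letters in pairs `x`, `ι x`, so closure comes for free. This is what makes
-- each side of a split a gluing system in its own right.
planar-closed : {ι : ℕ → ℕ} {S : List (List ℕ)} {t : Tree} → Planar ι S t →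
  (∀ {a} → a ∈ concat S → ι (ι a) ≡ a) → ClosedUnder ι (concat S)
planar-closed done inv ()
planar-closed {ι} (split {x} {_} {u} {v} {m} {W} {W₁} {W₂} refl p P₁ P₂) inv =
  pair-closed perm (inv (here refl)) (++-closed (u ++ concat W₁)
    (planar-closed P₁ (inv ∘ down ∘ ∈-++⁺ˡ)) (planar-closed P₂ (inv ∘ down ∘ ∈-++⁺ʳ (u ++ concat W₁))))
  where
  perm = split-part-↭ x (ι x) u v p
  down : ∀ {a} → a ∈ concat (u ∷ W₁) ++ concat (v ∷ W₂) → _
  down i = ∈-resp-↭ (↭-sym perm) (there (there i))
planar-closed {ι} (merge {x} {w} {v} {v'} {_} {W₁} {W₂} refl P) inv =
  pair-closed perm (inv (here refl)) (planar-closed P (λ i → inv (∈-resp-↭ (↭-sym perm) (there (there i)))))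
  where perm = merge-↭ x (ι x) w v v' W₁ W₂

module SplitParts {ι : ℕ → ℕ} {x : ℕ} (u v : List ℕ) {m : List Bool} {W W₁ W₂ : List (List ℕ)}
  (g : Good ι ((x ∷ u ++ ι x ∷ v) ∷ W)) (p : Part m W₁ W₂ W) where

  p⁺ : Part (true ∷ false ∷ m) (u ∷ W₁) (v ∷ W₂) (u ∷ v ∷ W)
  p⁺ = left (right p)
  perm = split-part-↭ x (ι x) u v p
  up : ∀ {a} → a ∈ concat (u ∷ W₁) ++ concat (v ∷ W₂) → a ∈ concat ((x ∷ u ++ ι x ∷ v) ∷ W)
  up i = ∈-resp-↭ (↭-sym perm) (there (there i))
  inv₁ : ∀ {a} → a ∈ concat (u ∷ W₁) → ι (ι a) ≡ a
  inv₁ i = Good.involutive g (up (∈-++⁺ˡ i))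
  inv₂ : ∀ {a} → a ∈ concat (v ∷ W₂) → ι (ι a) ≡ a
  inv₂ i = Good.involutive g (up (∈-++⁺ʳ (u ++ concat W₁) i))
  good₁ : ∀ {t} → Planar ι (u ∷ W₁) t → Good ι (u ∷ W₁)
  good₁ P = good-part p⁺ (good-split u v W g) (planar-closed P inv₁)
  good₂ : ∀ {t} → Planar ι (v ∷ W₂) t → Good ι (v ∷ W₂)
  good₂ P = good-part (part-swap p⁺) (good-split u v W g) (planar-closed P inv₂)

tail-nonEmpty : {ι : ℕ → ℕ} {u : List ℕ} {W : List (List ℕ)} → IsSphereOrConnected ι (u ∷ W) →
  ∀ {y} → y ∈ W → y ≢ []
tail-nonEmpty (inj₁ refl) ()
tail-nonEmpty (inj₂ C) i = Connected.nonEmpty C (there i)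

tail-colour : {ι : ℕ → ℕ} {u : List ℕ} {W : List (List ℕ)} → IsSphereOrConnected ι (u ∷ W) →
  (c : ℕ → Bool) (c₀ : Bool) → (∀ {a} → a ∈ u → c a ≡ c₀) →
  (∀ {y a b} → y ∈ W → a ∈ y → b ∈ y → c a ≡ c b) →
  (∀ {a} → a ∈ concat (u ∷ W) → c (ι a) ≡ c a) →
  ∀ {a} → a ∈ concat W → c a ≡ c₀
tail-colour (inj₁ refl) c c₀ hu hw inv ()
tail-colour {u = []} (inj₂ C) c c₀ hu hw inv a∈ = ⊥-elim (Connected.nonEmpty C (here refl) refl)
tail-colour {u = u₀ ∷ u} (inj₂ C) c c₀ hu hw inv a∈ = trans
  (Connected.monochrome C c
    (λ { (here refl) a∈ b∈ → trans (hu a∈) (sym (hu b∈)) ; (there i) → hw i }) inv (there (∈-++⁺ʳ u a∈)) (here refl))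
  (hu (here refl))

-- The colour of `x` spreads over the first face, and each side of a split either meets that face or
-- is a lone empty word; in a merge it reaches the partner face through `ι x`.
planar-connected : {ι : ℕ → ℕ} {S : List (List ℕ)} {t : Tree} → Planar ι S t → Good ι S → IsSphereOrConnected ι S
planar-connected done g = inj₁ refl
planar-connected {ι} (split {x} {_} {u} {v} {m} {W} {W₁} {W₂} refl p P₁ P₂) g = inj₂ (mkConn ne mono)
  where
  open SplitParts u v g p
  C₁ = planar-connected P₁ (good₁ P₁)
  C₂ = planar-connected P₂ (good₂ P₂)
  ne : ∀ {y} → y ∈ (x ∷ u ++ ι x ∷ v) ∷ W → y ≢ []
  ne (here refl) ()
  ne (there y∈) with part-∈⁻ p y∈
  ... | inj₁ i = tail-nonEmpty C₁ i
  ... | inj₂ i = tail-nonEmpty C₂ i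
  mono : (c : ℕ → Bool) → (∀ {w a b} → w ∈ (x ∷ u ++ ι x ∷ v) ∷ W → a ∈ w → b ∈ w → c a ≡ c b) →
      (∀ {a} → a ∈ concat ((x ∷ u ++ ι x ∷ v) ∷ W) → c (ι a) ≡ c a) →
      ∀ {a b} → a ∈ concat ((x ∷ u ++ ι x ∷ v) ∷ W) → b ∈ concat ((x ∷ u ++ ι x ∷ v) ∷ W) → c a ≡ c b
  mono c const inv a∈ b∈ = trans (to-x a∈) (sym (to-x b∈))
    where
    to-x : ∀ {a} → a ∈ concat ((x ∷ u ++ ι x ∷ v) ∷ W) → c a ≡ c x
    to-x a∈ with ∈-++⁻ (x ∷ u ++ ι x ∷ v) a∈
    ... | inj₁ i = const (here refl) i (here refl)
    ... | inj₂ i with ∈-++⁻ (concat W₁) (∈-resp-↭ (part-concat-↭ p) i)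
    ... | inj₁ j = tail-colour C₁ c (c x) (λ k → const (here refl) (there (∈-++⁺ˡ k)) (here refl))
                     (λ k → const (there (part-∈ˡ p k))) (inv ∘ up ∘ ∈-++⁺ˡ) j
    ... | inj₂ j = tail-colour C₂ c (c x) (λ k → const (here refl) (there (∈-++⁺ʳ u (there k))) (here refl))
                     (λ k → const (there (part-∈ʳ p k))) (inv ∘ up ∘ ∈-++⁺ʳ (u ++ concat W₁)) j
planar-connected {ι} (merge {x} {w} {v} {v'} {_} {W₁} {W₂} refl P) g = inj₂ (mkConn ne mono)
  where
  S = (x ∷ w) ∷ W₁ ++ (v ++ ι x ∷ v') ∷ W₂
  C' = planar-connected P (good-merge w v v' W₁ W₂ g)
  perm = merge-↭ x (ι x) w v v' W₁ W₂
  b≢[] : ∀ v → v ++ ι x ∷ v' ≢ []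
  b≢[] [] ()
  b≢[] (_ ∷ _) ()
  ne : ∀ {y} → y ∈ S → y ≢ []
  ne (here refl) ()
  ne (there y∈) with ∈-++⁻ W₁ y∈
  ... | inj₁ i = tail-nonEmpty C' (∈-++⁺ˡ i)
  ... | inj₂ (here refl) = b≢[] v
  ... | inj₂ (there i) = tail-nonEmpty C' (∈-++⁺ʳ W₁ i)
  mono : (c : ℕ → Bool) → (∀ {w a b} → w ∈ S → a ∈ w → b ∈ w → c a ≡ c b) →
      (∀ {a} → a ∈ concat S → c (ι a) ≡ c a) →
      ∀ {a b} → a ∈ concat S → b ∈ concat S → c a ≡ c b
  mono c const inv a∈ b∈ = trans (to-x a∈) (sym (to-x b∈))
    where
    old : ∀ {y} → y ∈ W₁ ++ W₂ → y ∈ S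
    old y∈ with ∈-++⁻ W₁ y∈
    ... | inj₁ i = there (∈-++⁺ˡ i)
    ... | inj₂ i = there (∈-++⁺ʳ W₁ (there i))
    b-colour : ∀ {a} → a ∈ v ++ ι x ∷ v' → c a ≡ c x
    b-colour i = trans (const (there (∈-++⁺ʳ W₁ (here refl))) i (∈-insert v)) (inv (here refl))
    merged : ∀ {a} → a ∈ w ++ v' ++ v → c a ≡ c x
    merged i with ∈-++⁻ w i
    ... | inj₁ j = const (here refl) (there j) (here refl)
    ... | inj₂ j with ∈-++⁻ v' j
    ... | inj₁ k = b-colour (∈-++⁺ʳ v (there k))
    ... | inj₂ k = b-colour (∈-++⁺ˡ k)
    to-x : ∀ {a} → a ∈ concat S → c a ≡ c x
    to-x a∈ with ∈-resp-↭ perm a∈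
    ... | here refl = inv (here refl)
    ... | there (here refl) = refl
    ... | there (there i) with ∈-++⁻ (w ++ v' ++ v) i
    ... | inj₁ j = merged j
    ... | inj₂ j = tail-colour C' c (c x) merged (λ k → const (old k))
                     (λ k → inv (∈-resp-↭ (↭-sym perm) (there (there k)))) j

-- Tree and involution determine each other

part-functional : {A : Set} {m : List Bool} {xs xs' ys ys' zs : List A} →
  Part m xs ys zs → Part m xs' ys' zs → xs ≡ xs' × ys ≡ ys'
part-functional [] [] = refl , refl
part-functional (left p) (left q) with part-functional p q
... | refl , refl = refl , refl
part-functional (right p) (right q) with part-functional p q
... | refl , refl = refl , refl

node-injective : ∀ {i i' j j' m m' A A' B B' t₁ t₁' t₂ t₂'} → node i j m A B t₁ t₂ ≡ node i' j' m' A' B' t₁' t₂' →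
  i ≡ i' × m ≡ m' × t₁ ≡ t₁' × t₂ ≡ t₂'
node-injective refl = refl , refl , refl , refl

join-injective : ∀ {A A' i i' j j' B B' t t'} → join A i j B t ≡ join A' i' j' B' t' →
  A ≡ A' × i ≡ i' × t ≡ t'
join-injective refl = refl , refl , refl

map-length-injective : {A : Set} (xs ys : List (List A)) → map length xs ≡ map length ys → length xs ≡ length ys
map-length-injective xs ys e = trans (sym (length-map length xs)) (trans (cong length e) (length-map length ys))

agree-on-pair : {ι ι' : ℕ → ℕ} {x : ℕ} {L M : List ℕ} → L ↭ ι x ∷ x ∷ M → ι x ≡ ι' x → ι (ι x) ≡ x → ι' (ι' x) ≡ x →
  (∀ {a} → a ∈ M → ι a ≡ ι' a) → ∀ {a} → a ∈ L → ι a ≡ ι' a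
agree-on-pair {ι' = ι'} p e i i' h a∈ with ∈-resp-↭ p a∈
... | here refl = trans i (trans (sym i') (cong ι' (sym e)))
... | there (here refl) = e
... | there (there j) = h j

-- The tree stores the position of each partner, so two involutions with the same tree agree on one
-- pair after the other.
planar-injective : {ι ι' : ℕ → ℕ} {S : List (List ℕ)} {t t' : Tree} → Planar ι S t → Planar ι' S t' → t ≡ t' →
  (∀ {a} → a ∈ concat S → ι (ι a) ≡ a) → (∀ {a} → a ∈ concat S → ι' (ι' a) ≡ a) →
  ∀ {a} → a ∈ concat S → ι a ≡ ι' a
planar-injective done done e i i' ()
planar-injective {ι} {ι'} (split {x} {_} {u} {v} {W₁ = W₁} {W₂} refl p P₁ P₂) (split {u = u'} e' p' P₁' P₂') e i i'
  with node-injective e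
... | lu , refl , e₁ , e₂ with ++-injective u {u'} lu e' | part-functional p p'
... | refl , ev | refl , refl with ∷-injective ev
... | ιx , refl = agree-on-pair perm ιx (i (here refl)) (i' (here refl)) λ a∈ → case ∈-++⁻ (u ++ concat W₁) a∈ of λ
    { (inj₁ k) → planar-injective P₁ P₁' e₁ (i ∘ up ∘ ∈-++⁺ˡ) (i' ∘ up ∘ ∈-++⁺ˡ) k
    ; (inj₂ k) → planar-injective P₂ P₂' e₂ (i ∘ up ∘ ∈-++⁺ʳ (u ++ concat W₁)) (i' ∘ up ∘ ∈-++⁺ʳ (u ++ concat W₁)) k }
  where
  perm = split-part-↭ x (ι x) u v p
  up : ∀ {a} → a ∈ concat (u ∷ W₁) ++ concat (v ∷ W₂) → _
  up k = ∈-resp-↭ (↭-sym perm) (there (there k))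
planar-injective (split _ _ _ _) (merge _ _) () i i'
planar-injective (merge _ _) (split _ _ _ _) () i i'
planar-injective {ι} {ι'} (merge {x} {w} {v} {v'} {_} {W₁} {W₂} refl P) (merge {v = v₁} {W₁ = W₁'} e' P') e i i'
  with join-injective e
... | lW , lv , et with ++-injective W₁ {W₁'} (map-length-injective W₁ W₁' lW) e'
... | refl , eb with ∷-injective eb
... | ew , refl with ++-injective v {v₁} lv ew
... | refl , ev with ∷-injective ev
... | ιx , refl = agree-on-pair perm ιx (i (here refl)) (i' (here refl)) (planar-injective P P' et (i ∘ up) (i' ∘ up))
  where
  perm = merge-↭ x (ι x) w v v' W₁ W₂
  up : ∀ {a} → a ∈ concat ((w ++ v' ++ v) ∷ W₁ ++ W₂) → _
  up k = ∈-resp-↭ (↭-sym perm) (there (there k))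

unique-decomposition : {y : ℕ} (u u' : List ℕ) {v v' : List ℕ} → Unique (u ++ y ∷ v) →
  u ++ y ∷ v ≡ u' ++ y ∷ v' → u ≡ u' × v ≡ v'
unique-decomposition [] [] un e = refl , ∷-injectiveʳ e
unique-decomposition [] (a ∷ u') {v} (h ∷ un) e with ∷-injective e
... | refl , refl = ⊥-elim (All.lookup h (∈-insert u') refl)
unique-decomposition (a ∷ u) [] (h ∷ un) e with ∷-injective e
... | refl , e' = ⊥-elim (All.lookup h (∈-insert u) refl)
unique-decomposition (a ∷ u) (a' ∷ u') (h ∷ un) e with ∷-injective e
... | refl , e' with unique-decomposition u u' un e'
... | refl , refl = refl , refl

unique-word : {y : ℕ} (W₁ W₁' : List (List ℕ)) {w w' : List ℕ} {W₂ W₂' : List (List ℕ)} →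
  Unique (concat (W₁ ++ w ∷ W₂)) → y ∈ w → y ∈ w' → W₁ ++ w ∷ W₂ ≡ W₁' ++ w' ∷ W₂' →
  W₁ ≡ W₁' × w ≡ w' × W₂ ≡ W₂'
unique-word [] [] un i i' e = refl , ∷-injectiveˡ e , ∷-injectiveʳ e
unique-word [] (z ∷ W₁') {w} un i i' e with ∷-injective e
... | refl , refl = ⊥-elim (proj₂ (proj₂ (unique-++⁻ w un)) i (∈-concat⁺′ i' (∈-insert W₁')))
unique-word (z ∷ W₁) [] {w} un i i' e with ∷-injective e
... | refl , _ = ⊥-elim (proj₂ (proj₂ (unique-++⁻ z un)) i' (∈-concat⁺′ i (∈-insert W₁)))
unique-word (z ∷ W₁) (z' ∷ W₁') un i i' e with ∷-injective e
... | refl , e' with unique-word W₁ W₁' (proj₁ (proj₂ (unique-++⁻ z un))) i i' e'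
... | refl , refl , refl = refl , refl , refl

part-unique : {A : Set} {m m' : List Bool} {xs xs' ys ys' zs : List A} →
  Part m xs ys zs → Part m' xs' ys' zs →
  (∀ {z} → z ∈ xs → z ∉ ys') → (∀ {z} → z ∈ ys → z ∉ xs') → m ≡ m'
part-unique [] [] h k = refl
part-unique (left p) (left q) h k = cong (true ∷_) (part-unique p q (h ∘ there) (λ i j → k i (there j)))
part-unique (left p) (right q) h k = ⊥-elim (h (here refl) (here refl))
part-unique (right p) (left q) h k = ⊥-elim (k (here refl) (here refl))
part-unique (right p) (right q) h k = cong (false ∷_) (part-unique p q (λ i j → h i (there j)) (k ∘ there))

nonEmpty-head : {w : List ℕ} → w ≢ [] → ∃[ a ] a ∈ w
nonEmpty-head {[]} h = ⊥-elim (h refl)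
nonEmpty-head {a ∷ w} h = a , here refl

-- Colour the letters of `u` and `W₁'` `true` and all others `false`. This is admissible on the
-- connected side `u ∷ W₁`, hence constant there, and no face of `W₁` can lie in `W₂'`. Consequently
-- the mask at a separating edge is forced.
component-avoids : {ι : ℕ → ℕ} {u : List ℕ} {W₁ W₁' W₂' : List (List ℕ)} → IsSphereOrConnected ι (u ∷ W₁) →
  (∀ {a} → a ∈ concat (u ∷ W₁) → ι (ι a) ≡ a) → ClosedUnder ι (u ++ concat W₁') →
  (∀ {y} → y ∈ W₁ → y ∈ W₁' ⊎ y ∈ W₂') → (∀ {a} → a ∈ u ++ concat W₁' → a ∉ concat W₂') →
  ∀ {y} → y ∈ W₁ → y ∉ W₂'
component-avoids {ι} {u} {W₁} {W₁'} {W₂'} C inv cl dich dis y∈ y∈' =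
  let a , a∈ = nonEmpty-head (tail-nonEmpty C y∈)
  in true≢false (trans (sym (all-in (∈-concat⁺′ a∈ y∈))) (extend-out L (λ _ → true) false (λ i → dis i (∈-concat⁺′ a∈ y∈'))))
  where
  L = u ++ concat W₁'
  c = extend L (λ _ → true) false
  const : ∀ {y a b} → y ∈ W₁ → a ∈ y → b ∈ y → c a ≡ c b
  const y∈ a∈ b∈ with dich y∈
  ... | inj₁ i = trans (extend-in L _ false (∈-++⁺ʳ u (∈-concat⁺′ a∈ i))) (sym (extend-in L _ false (∈-++⁺ʳ u (∈-concat⁺′ b∈ i))))
  ... | inj₂ i = trans (extend-out L _ false (λ k → dis k (∈-concat⁺′ a∈ i))) (sym (extend-out L _ false (λ k → dis k (∈-concat⁺′ b∈ i))))
  inv' : ∀ {a} → a ∈ concat (u ∷ W₁) → c (ι a) ≡ c a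
  inv' {a} a∈ with a ∈? L
  ... | yes i = extend-in L _ false (cl i)
  ... | no n = extend-out L _ false (λ i → n (subst (_∈ L) (inv a∈) (cl i)))
  all-in : ∀ {a} → a ∈ concat W₁ → c a ≡ true
  all-in = tail-colour C c true (λ i → extend-in L _ false (∈-++⁺ˡ i)) const inv'

-- Letters are distinct, so `ι x` occurs at one place only; this fixes the kind of step and the cut,
-- and `component-avoids` fixes the mask.
planar-deterministic : {ι : ℕ → ℕ} {S : List (List ℕ)} {t t' : Tree} → Planar ι S t → Planar ι S t' → Good ι S → t ≡ t'
planar-deterministic done done g = refl
planar-deterministic {ι} (split {x} {w} {u} {v} {m} {W} {W₁} {W₂} refl p P₁ P₂) (split {u = u'} {m = m'} e p' P₁' P₂') g
  with unique-decomposition u u' (proj₁ (proj₂ (unique-++⁻ (x ∷ []) (proj₁ (unique-++⁻ (x ∷ u ++ ι x ∷ v) (Good.unique g)))))) e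
... | refl , refl with part-unique p p'
      (component-avoids (planar-connected P₁ (Sp.good₁ P₁)) Sp.inv₁ (Good.closed (Sp'.good₁ P₁')) (part-∈⁻ p' ∘ part-∈ˡ p)
        (λ i k → part-disjoint Sp'.p⁺ (Good.unique g') i (∈-++⁺ʳ v k)))
      (component-avoids (planar-connected P₂ (Sp.good₂ P₂)) Sp.inv₂ (Good.closed (Sp'.good₂ P₂')) (λ i → part-∈⁻ (part-swap p') (part-∈ʳ p i))
        (λ i k → part-disjoint Sp'.p⁺ (Good.unique g') (∈-++⁺ʳ u k) i))
  where
  module Sp = SplitParts u v g p
  module Sp' = SplitParts u v g p'
  g' = good-split u v W g
... | refl with part-functional p p'
... | refl , refl = cong₂ (node (length u) (length v) m (map length W₁) (map length W₂))
    (planar-deterministic P₁ P₁' (SplitParts.good₁ u v g p P₁)) (planar-deterministic P₂ P₂' (SplitParts.good₂ u v g p P₂))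
planar-deterministic {ι} (split {x} {w} {u} {v} refl _ _ _) (merge {v = v₁} {W₁ = W₁} refl _) g =
  ⊥-elim (proj₂ (proj₂ (unique-++⁻ (x ∷ w) (Good.unique g))) (there (∈-insert u)) (∈-concat⁺′ (∈-insert v₁) (∈-insert W₁)))
planar-deterministic {ι} (merge {x} {w} {v₁} {W₁ = W₁} refl _) (split {u = u} refl _ _ _) g =
  ⊥-elim (proj₂ (proj₂ (unique-++⁻ (x ∷ w) (Good.unique g))) (there (∈-insert u)) (∈-concat⁺′ (∈-insert v₁) (∈-insert W₁)))
planar-deterministic {ι} (merge {x} {w} {v} {v'} {_} {W₁} {W₂} refl P) (merge {v = v₁} {W₁ = W₁'} e P') g
  with unique-word W₁ W₁' (proj₁ (proj₂ (unique-++⁻ (x ∷ w) (Good.unique g)))) (∈-insert v) (∈-insert v₁) e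
... | refl , eb , refl with unique-decomposition v v₁ (proj₁ (unique-++⁻ (v ++ ι x ∷ v') (unique-resp-↭ (concat-extract W₁ _ W₂)
        (proj₁ (proj₂ (unique-++⁻ (x ∷ w) (Good.unique g))))))) eb
... | refl , refl = cong (join (map length W₁) (length v) (length v') (map length W₂))
    (planar-deterministic P P' (good-merge w v v' W₁ W₂ g))

-- Enumeration of the trees for given face lengths

splittings : ℕ → List (ℕ × ℕ)
splittings zero = []
splittings (suc m) = (0 , m) ∷ map (λ (i , j) → suc i , j) (splittings m)

splittings⁺ : (i j : ℕ) → (i , j) ∈ splittings (i + suc j)
splittings⁺ zero j = here refl
splittings⁺ (suc i) j = there (∈-map⁺ _ (splittings⁺ i j))

splittings⁻ : {m i j : ℕ} → (i , j) ∈ splittings m → m ≡ i + suc j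
splittings⁻ {suc m} (here refl) = refl
splittings⁻ {suc m} (there k) with ∈-map⁻ _ k
... | _ , k' , refl = cong suc (splittings⁻ k')

splittings-unique : (m : ℕ) → Unique (splittings m)
splittings-unique zero = []
splittings-unique (suc m) = All.tabulate (λ k e → case ∈-map⁻ _ k of λ { (_ , _ , e') → 0≢1+n (cong proj₁ (trans e e')) }) ∷
  unique-map _ (λ { refl → refl }) (splittings-unique m)

picks : {A : Set} → List A → List (List A × A × List A)
picks [] = []
picks (x ∷ xs) = ([] , x , xs) ∷ map (λ (l , y , r) → x ∷ l , y , r) (picks xs)

picks⁺ : {A : Set} (l : List A) (y : A) (r : List A) → (l , y , r) ∈ picks (l ++ y ∷ r)
picks⁺ [] y r = here refl
picks⁺ (x ∷ l) y r = there (∈-map⁺ _ (picks⁺ l y r))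

picks⁻ : {A : Set} (xs : List A) {l : List A} {y : A} {r : List A} → (l , y , r) ∈ picks xs → xs ≡ l ++ y ∷ r
picks⁻ (x ∷ xs) (here refl) = refl
picks⁻ (x ∷ xs) (there k) with ∈-map⁻ _ k
... | _ , k' , refl = cong (x ∷_) (picks⁻ xs k')

picks-unique : {A : Set} (xs : List A) → Unique (picks xs)
picks-unique [] = []
picks-unique (x ∷ xs) = All.tabulate (λ k e → case ∈-map⁻ _ k of λ { (_ , _ , e') → case trans e e' of λ () }) ∷
  unique-map _ (λ { refl → refl }) (picks-unique xs)

bipartitions-unique : {A : Set} (xs : List A) → Unique (bipartitions xs)
bipartitions-unique [] = [] ∷ []
bipartitions-unique (x ∷ xs) = unique-++⁺
  (unique-map _ (λ { refl → refl }) (bipartitions-unique xs))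
  (unique-map _ (λ { refl → refl }) (bipartitions-unique xs))
  λ i j → case ∈-map⁻ _ i of λ { (_ , _ , e) → case ∈-map⁻ _ j of λ { (_ , _ , e') → case trans (sym e) e' of λ () } }

-- An empty first face next to other faces has no tree, since the system would be disconnected. In
-- `joins` the partner has `i` letters before and `j` after it in a face of length `b`, and the
-- merged face has length `m + (j + i)`. The first argument is fuel; each step uses two letters.
trees : ℕ → List ℕ → List Tree
nodes : ℕ → List ℕ → ℕ × ℕ → List Tree
joins : ℕ → ℕ → List ℕ × ℕ × List ℕ → List Tree
trees f [] = []
trees f (zero ∷ []) = leaf ∷ []
trees f (zero ∷ _ ∷ _) = []
trees zero (suc m ∷ W) = []
trees (suc f) (suc m ∷ W) = concatMap (nodes f W) (splittings m) ++ concatMap (joins f m) (picks W)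
nodes f W (i , j) = concatMap (λ (μ , A , B) → cartesianProductWith (node i j μ A B) (trees f (i ∷ A)) (trees f (j ∷ B)))
  (bipartitions W)
joins f m (A , b , B) = concatMap (λ (i , j) → map (join A i j B) (trees f (m + (j + i) ∷ A ++ B))) (splittings b)

node-position : ∀ {i i' j j' m m' A A' B B' t₁ t₁' t₂ t₂'} → node i j m A B t₁ t₂ ≡ node i' j' m' A' B' t₁' t₂' →
  (i , j) ≡ (i' , j')
node-position refl = refl

node-bipartition : ∀ {i i' j j' m m' A A' B B' t₁ t₁' t₂ t₂'} → node i j m A B t₁ t₂ ≡ node i' j' m' A' B' t₁' t₂' →
  (m , A , B) ≡ (m' , A' , B')
node-bipartition refl = refl

join-position : ∀ {A A' i i' j j' B B' t t'} → join A i j B t ≡ join A' i' j' B' t' → (i , j) ≡ (i' , j')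
join-position refl = refl

join-pick : ∀ {A A' i i' j j' B B' t t'} → join A i j B t ≡ join A' i' j' B' t' →
  _≡_ {A = List ℕ × ℕ × List ℕ} (A , i + suc j , B) (A' , i' + suc j' , B')
join-pick refl = refl

nodes⁻ : (f : ℕ) (W : List ℕ) {i j : ℕ} {t : Tree} → t ∈ nodes f W (i , j) →
  ∃[ μ ] ∃[ A ] ∃[ B ] ∃[ t₁ ] ∃[ t₂ ] Part μ A B W × t₁ ∈ trees f (i ∷ A) × t₂ ∈ trees f (j ∷ B) × t ≡ node i j μ A B t₁ t₂
nodes⁻ f W {i} {j} t∈ with ∈-concatMap⁻′ _ (bipartitions W) t∈
... | (μ , A , B) , k , t∈' with ∈-cartesianProductWith⁻ (node i j μ A B) (trees f (i ∷ A)) (trees f (j ∷ B)) t∈'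
... | t₁ , t₂ , k₁ , k₂ , e = μ , A , B , t₁ , t₂ , bipartitions⁻ W k , k₁ , k₂ , e

joins⁻ : (f m : ℕ) {A B : List ℕ} {b : ℕ} {t : Tree} → t ∈ joins f m (A , b , B) →
  ∃[ i ] ∃[ j ] ∃[ t' ] b ≡ i + suc j × t' ∈ trees f (m + (j + i) ∷ A ++ B) × t ≡ join A i j B t'
joins⁻ f m {A} {B} {b} t∈ with ∈-concatMap⁻′ _ (splittings b) t∈
... | (i , j) , k , t∈' with ∈-map⁻ _ t∈'
... | t' , k' , e = i , j , t' , splittings⁻ k , k' , e

trees-unique : (f : ℕ) (W : List ℕ) → Unique (trees f W)
trees-unique f [] = []
trees-unique f (zero ∷ []) = [] ∷ []
trees-unique f (zero ∷ _ ∷ _) = []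
trees-unique zero (suc m ∷ W) = []
trees-unique (suc f) (suc m ∷ W) = unique-++⁺
  (unique-concatMap (nodes f W) (splittings-unique m) (λ {(i , j)} _ → nodes-unique i j) nodes-key)
  (unique-concatMap (joins f m) (picks-unique W) (λ {(A , b , B)} _ → joins-unique A b B) joins-key)
  λ k l → let (i , j) , _ , k' = ∈-concatMap⁻′ (nodes f W) (splittings m) k
              (A , b , B) , _ , l' = ∈-concatMap⁻′ (joins f m) (picks W) l
              _ , _ , _ , _ , _ , _ , _ , _ , e = nodes⁻ f W {i} {j} k'
              _ , _ , _ , _ , _ , e' = joins⁻ f m {A} {B} {b} l'
          in case trans (sym e) e' of λ ()
  where
  nodes-unique : ∀ i j → Unique (nodes f W (i , j))
  nodes-unique i j = unique-concatMap _ (bipartitions-unique W)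
    (λ {(μ , A , B)} _ → unique-cartesianProductWith (node i j μ A B) (trees f (i ∷ A)) (trees f (j ∷ B))
      (λ { refl → refl , refl }) (trees-unique f (i ∷ A)) (trees-unique f (j ∷ B)))
    λ {(μ , A , B)} {(μ' , A' , B')} k l →
      let _ , _ , _ , _ , e = ∈-cartesianProductWith⁻ (node i j μ A B) (trees f (i ∷ A)) (trees f (j ∷ B)) k
          _ , _ , _ , _ , e' = ∈-cartesianProductWith⁻ (node i j μ' A' B') (trees f (i ∷ A')) (trees f (j ∷ B')) l
      in node-bipartition (trans (sym e) e')
  nodes-key : ∀ {p p' t} → t ∈ nodes f W p → t ∈ nodes f W p' → p ≡ p'
  nodes-key {i , j} {i' , j'} k l =
    let _ , _ , _ , _ , _ , _ , _ , _ , e = nodes⁻ f W {i} {j} k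
        _ , _ , _ , _ , _ , _ , _ , _ , e' = nodes⁻ f W {i'} {j'} l
    in node-position (trans (sym e) e')
  joins-unique : ∀ A b B → Unique (joins f m (A , b , B))
  joins-unique A b B = unique-concatMap _ (splittings-unique b)
    (λ {(i , j)} _ → unique-map (join A i j B) (λ { refl → refl }) (trees-unique f (m + (j + i) ∷ A ++ B)))
    λ k l → let _ , _ , e = ∈-map⁻ _ k
                _ , _ , e' = ∈-map⁻ _ l
            in join-position (trans (sym e) e')
  joins-key : ∀ {p p' t} → t ∈ joins f m p → t ∈ joins f m p' → p ≡ p'
  joins-key {A , b , B} {A' , b' , B'} k l =
    let _ , _ , _ , b≡ , _ , e = joins⁻ f m {A} {B} {b} k
        _ , _ , _ , b'≡ , _ , e' = joins⁻ f m {A'} {B'} {b'} l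
    in trans (cong (λ c → A , c , B) b≡) (trans (join-pick (trans (sym e) e')) (cong (λ c → A' , c , B') (sym b'≡)))

-- Enumerated trees are exactly those of planar gluings

part-map⁺ : {A B : Set} (f : A → B) {m : List Bool} {xs ys zs : List A} → Part m xs ys zs → Part m (map f xs) (map f ys) (map f zs)
part-map⁺ f [] = []
part-map⁺ f (left p) = left (part-map⁺ f p)
part-map⁺ f (right p) = right (part-map⁺ f p)

part-map⁻ : {A B : Set} (f : A → B) {m : List Bool} (zs : List A) {xs ys : List B} → Part m xs ys (map f zs) →
  ∃[ xs' ] ∃[ ys' ] Part m xs' ys' zs × xs ≡ map f xs' × ys ≡ map f ys'
part-map⁻ f [] [] = [] , [] , [] , refl , refl
part-map⁻ f (z ∷ zs) (left p) = let xs , ys , q , e , e' = part-map⁻ f zs p in z ∷ xs , ys , left q , cong (f z ∷_) e , e'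
part-map⁻ f (z ∷ zs) (right p) = let xs , ys , q , e , e' = part-map⁻ f zs p in xs , z ∷ ys , right q , e , cong (f z ∷_) e'

map-++⁻ : {A B : Set} (f : A → B) (zs : List A) (xs : List B) {y : B} {ys : List B} → map f zs ≡ xs ++ y ∷ ys →
  ∃[ xs' ] ∃[ y' ] ∃[ ys' ] zs ≡ xs' ++ y' ∷ ys' × xs ≡ map f xs' × y ≡ f y' × ys ≡ map f ys'
map-++⁻ f (z ∷ zs) [] refl = [] , z , zs , refl , refl , refl , refl
map-++⁻ f (z ∷ zs) (x ∷ xs) e with ∷-injective e
... | refl , e' = let xs' , y' , ys' , a , b , c , d = map-++⁻ f zs xs e' in z ∷ xs' , y' , ys' , cong (z ∷_) a , cong (f z ∷_) b , c , d

length-split⁻ : {A : Set} (w : List A) (i : ℕ) {j : ℕ} → length w ≡ i + suc j →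
  ∃[ u ] ∃[ x ] ∃[ v ] w ≡ u ++ x ∷ v × i ≡ length u × j ≡ length v
length-split⁻ (x ∷ w) zero refl = [] , x , w , refl , refl , refl
length-split⁻ (x ∷ w) (suc i) e = let u , y , v , a , b , c = length-split⁻ w i (suc-injective e) in
  x ∷ u , y , v , cong (x ∷_) a , cong suc b , c

length-merge : (w v v' : List ℕ) → length (w ++ v' ++ v) ≡ length w + (length v' + length v)
length-merge w v v' = trans (length-++ w) (cong (length w +_) (length-++ v'))

planar-trees : (f : ℕ) {ι : ℕ → ℕ} {S : List (List ℕ)} {t : Tree} → Planar ι S t → length (concat S) ≤ f →
  t ∈ trees f (map length S)
planar-trees f done f≤ = here refl
planar-trees (suc f) {ι} (split {x} {_} {u} {v} {m} {W} {W₁} {W₂} refl p P₁ P₂) (s≤s f≤) =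
  ∈-++⁺ˡ (∈-concatMap⁺′ (nodes f (map length W)) (subst (λ l → (length u , length v) ∈ splittings l) (sym (length-++ u)) (splittings⁺ (length u) (length v)))
    (∈-concatMap⁺′ _ (bipartitions⁺ (part-map⁺ length p))
      (∈-cartesianProductWith⁺ _ (planar-trees f P₁ (≤-trans (m≤m+n n₁ n₂) bound)) (planar-trees f P₂ (≤-trans (m≤n+m n₂ n₁) bound)))))
  where
  n₁ = length (concat (u ∷ W₁))
  n₂ = length (concat (v ∷ W₂))
  bound : n₁ + n₂ ≤ f
  bound = ≤-trans (n≤1+n _) (≤-trans (≤-reflexive (sym (suc-injective (split-length x (ι x) u v p)))) f≤)
planar-trees (suc f) {ι} (merge {x} {w} {v} {v'} {_} {W₁} {W₂} {t} refl P) (s≤s f≤) =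
  ∈-++⁺ʳ (concatMap (nodes f (map length (W₁ ++ (v ++ ι x ∷ v') ∷ W₂))) (splittings (length w)))
    (∈-concatMap⁺′ (joins f (length w)) {x = map length W₁ , length (v ++ ι x ∷ v') , map length W₂}
      (subst (λ l → (map length W₁ , length (v ++ ι x ∷ v') , map length W₂) ∈ picks l) (sym (map-++ length W₁ _)) (picks⁺ (map length W₁) _ _))
      (∈-concatMap⁺′ _ (subst (λ l → (length v , length v') ∈ splittings l) (sym (length-++ v)) (splittings⁺ (length v) (length v')))
        (∈-map⁺ _ (subst (λ l → t ∈ trees f l) (cong₂ _∷_ (length-merge w v v') (map-++ length W₁ W₂)) (planar-trees f P bound)))))
  where
  bound : length (concat ((w ++ v' ++ v) ∷ W₁ ++ W₂)) ≤ f
  bound = ≤-trans (n≤1+n _) (≤-trans (≤-reflexive (sym (suc-injective (↭-length (merge-↭ x (ι x) w v v' W₁ W₂))))) f≤)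

planar-cong : {ι ι' : ℕ → ℕ} {S : List (List ℕ)} {t : Tree} → (∀ {a} → a ∈ concat S → ι a ≡ ι' a) →
  Planar ι S t → Planar ι' S t
planar-cong h done = done
planar-cong {ι} h (split {x} {_} {u} {v} {W₁ = W₁} {W₂} refl p P₁ P₂) =
  split (cong (λ y → u ++ y ∷ v) (h (here refl))) p
    (planar-cong (h ∘ up ∘ ∈-++⁺ˡ) P₁) (planar-cong (h ∘ up ∘ ∈-++⁺ʳ (u ++ concat W₁)) P₂)
  where
  up : ∀ {a} → a ∈ concat (u ∷ W₁) ++ concat (v ∷ W₂) → _
  up k = ∈-resp-↭ (↭-sym (split-part-↭ x (ι x) u v p)) (there (there k))
planar-cong {ι} h (merge {x} {w} {v} {v'} {_} {W₁} {W₂} refl P) =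
  merge (cong (λ y → W₁ ++ (v ++ y ∷ v') ∷ W₂) (h (here refl)))
    (planar-cong (λ k → h (∈-resp-↭ (↭-sym (merge-↭ x (ι x) w v v' W₁ W₂)) (there (there k)))) P)

glue : ℕ → ℕ → (ℕ → ℕ) → ℕ → ℕ
glue x x' ι a with a ≟ x | a ≟ x'
... | yes _ | _     = x'
... | no _  | yes _ = x
... | no _  | no _  = ι a

glue-x : (x x' : ℕ) (ι : ℕ → ℕ) → glue x x' ι x ≡ x'
glue-x x x' ι with x ≟ x | x ≟ x'
... | yes _ | _ = refl
... | no n | _ = ⊥-elim (n refl)

glue-x' : (x x' : ℕ) (ι : ℕ → ℕ) → x ≢ x' → glue x x' ι x' ≡ x
glue-x' x x' ι x≢x' with x' ≟ x | x' ≟ x'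
... | yes e | _ = ⊥-elim (x≢x' (sym e))
... | no _ | yes _ = refl
... | no _ | no n = ⊥-elim (n refl)

glue-other : {x x' a : ℕ} (ι : ℕ → ℕ) → a ≢ x → a ≢ x' → glue x x' ι a ≡ ι a
glue-other {x} {x'} {a} ι n n' with a ≟ x | a ≟ x'
... | yes e | _ = ⊥-elim (n e)
... | no _ | yes e = ⊥-elim (n' e)
... | no _ | no _ = refl

glue-good : {ι : ℕ → ℕ} {x x' : ℕ} {S S' : List (List ℕ)} → Unique (concat S) → concat S ↭ x' ∷ x ∷ concat S' →
  Good ι S' → Good (glue x x' ι) S × (∀ {a} → a ∈ concat S' → ι a ≡ glue x x' ι a)
glue-good {ι} {x} {x'} {S} {S'} un p (mkGood _ cl inv ff) = mkGood un (down ∘ cl' ∘ ∈-resp-↭ p) (inv' ∘ ∈-resp-↭ p) (ff' ∘ ∈-resp-↭ p) , old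
  where
  facts = unique-pair (unique-resp-↭ p un)
  x≢x' : x ≢ x'
  x≢x' = proj₁ facts
  down : ∀ {a} → a ∈ x' ∷ x ∷ concat S' → a ∈ concat S
  down = ∈-resp-↭ (↭-sym p)
  old : ∀ {a} → a ∈ concat S' → ι a ≡ glue x x' ι a
  old a∈ = sym (glue-other ι (λ { refl → proj₁ (proj₂ facts) a∈ }) (λ { refl → proj₂ (proj₂ facts) (there a∈) }))
  cl' : ∀ {a} → a ∈ x' ∷ x ∷ concat S' → glue x x' ι a ∈ x' ∷ x ∷ concat S'
  cl' (here refl) = there (here (glue-x' x x' ι x≢x'))
  cl' (there (here refl)) = here (glue-x x x' ι)
  cl' (there (there i)) = there (there (subst (_∈ concat S') (old i) (cl i)))
  inv' : ∀ {a} → a ∈ x' ∷ x ∷ concat S' → glue x x' ι (glue x x' ι a) ≡ a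
  inv' (here refl) = trans (cong (glue x x' ι) (glue-x' x x' ι x≢x')) (glue-x x x' ι)
  inv' (there (here refl)) = trans (cong (glue x x' ι) (glue-x x x' ι)) (glue-x' x x' ι x≢x')
  inv' (there (there i)) = trans (cong (glue x x' ι) (sym (old i))) (trans (sym (old (cl i))) (inv i))
  ff' : ∀ {a} → a ∈ x' ∷ x ∷ concat S' → glue x x' ι a ≢ a
  ff' (here refl) e = x≢x' (trans (sym (glue-x' x x' ι x≢x')) e)
  ff' (there (here refl)) e = x≢x' (sym (trans (sym (glue-x x x' ι)) e))
  ff' (there (there i)) e = ff i (trans (old i) e)

union-good : {m : List Bool} {ι₁ ι₂ : ℕ → ℕ} {S S₁ S₂ : List (List ℕ)} → Unique (concat S) → Part m S₁ S₂ S →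
  Good ι₁ S₁ → Good ι₂ S₂ →
  ∃[ ι ] Good ι S × (∀ {a} → a ∈ concat S₁ → ι₁ a ≡ ι a) × (∀ {a} → a ∈ concat S₂ → ι₂ a ≡ ι a)
union-good {ι₁ = ι₁} {ι₂} {S} {S₁} {S₂} un p (mkGood _ cl₁ inv₁ ff₁) (mkGood _ cl₂ inv₂ ff₂) = ι , mkGood un cl inv ff , on₁ , on₂
  where
  ι : ℕ → ℕ
  ι a = if does (a ∈? concat S₁) then ι₁ a else ι₂ a
  perm = part-concat-↭ p
  on₁ : ∀ {a} → a ∈ concat S₁ → ι₁ a ≡ ι a
  on₁ {a} i with a ∈? concat S₁
  ... | yes _ = refl
  ... | no n = ⊥-elim (n i)
  on₂ : ∀ {a} → a ∈ concat S₂ → ι₂ a ≡ ι a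
  on₂ {a} i with a ∈? concat S₁
  ... | yes k = ⊥-elim (part-disjoint p un k i)
  ... | no _ = refl
  side : ∀ {a} → a ∈ concat S → a ∈ concat S₁ ⊎ a ∈ concat S₂
  side i = ∈-++⁻ (concat S₁) (∈-resp-↭ perm i)
  cl : ClosedUnder ι (concat S)
  cl i with side i
  ... | inj₁ k = ∈-resp-↭ (↭-sym perm) (∈-++⁺ˡ (subst (_∈ concat S₁) (on₁ k) (cl₁ k)))
  ... | inj₂ k = ∈-resp-↭ (↭-sym perm) (∈-++⁺ʳ (concat S₁) (subst (_∈ concat S₂) (on₂ k) (cl₂ k)))
  inv : ∀ {a} → a ∈ concat S → ι (ι a) ≡ a
  inv i with side i
  ... | inj₁ k = trans (cong ι (sym (on₁ k))) (trans (sym (on₁ (cl₁ k))) (inv₁ k))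
  ... | inj₂ k = trans (cong ι (sym (on₂ k))) (trans (sym (on₂ (cl₂ k))) (inv₂ k))
  ff : ∀ {a} → a ∈ concat S → ι a ≢ a
  ff i e with side i
  ... | inj₁ k = ff₁ k (trans (on₁ k) e)
  ... | inj₂ k = ff₂ k (trans (on₂ k) e)

-- The involution is assembled from the leaves upwards: at a node the involutions of the two sides
-- act on disjoint letters and are united, and then the pair `x`, `x'` is glued on.
trees-planar : (f : ℕ) (S : List (List ℕ)) {t : Tree} → Unique (concat S) → t ∈ trees f (map length S) →
  ∃[ ι ] Good ι S × Planar ι S t
trees-planar f ([] ∷ []) un (here refl) = id , mkGood [] (λ ()) (λ ()) (λ ()) , done
trees-planar (suc f) ((x ∷ w) ∷ W) un t∈ with ∈-++⁻ (concatMap (nodes f (map length W)) (splittings (length w))) t∈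
... | inj₁ k with ∈-concatMap⁻′ (nodes f (map length W)) (splittings (length w)) k
... | (i , j) , ij∈ , t∈' with nodes⁻ f (map length W) {i} {j} t∈' | length-split⁻ w i (splittings⁻ ij∈)
... | μ , A , B , t₁ , t₂ , p , k₁ , k₂ , refl | u , x' , v , refl , refl , refl with part-map⁻ length W p
... | W₁ , W₂ , q , refl , refl =
  let un' = unique-resp-↭ perm un
      unM = unique-tail (unique-tail un')
      ι₁ , g₁ , P₁ = trees-planar f (u ∷ W₁) (proj₁ (unique-++⁻ (concat (u ∷ W₁)) unM)) k₁
      ι₂ , g₂ , P₂ = trees-planar f (v ∷ W₂) (proj₁ (proj₂ (unique-++⁻ (concat (u ∷ W₁)) unM))) k₂
      ι₀ , g₀ , on₁ , on₂ = union-good (unique-tail (unique-tail (unique-resp-↭ (split-↭ x x' u v W) un))) p⁺ g₁ g₂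
      g , old = glue-good {S' = u ∷ v ∷ W} un (split-↭ x x' u v W) g₀
      lift : ∀ {a} → a ∈ concat (u ∷ W₁) ++ concat (v ∷ W₂) → a ∈ concat (u ∷ v ∷ W)
      lift = ∈-resp-↭ (↭-sym (part-concat-↭ p⁺))
  in glue x x' ι₀ , g , split (cong (λ y → u ++ y ∷ v) (sym (glue-x x x' ι₀))) q
       (planar-cong (λ i → trans (on₁ i) (old (lift (∈-++⁺ˡ i)))) P₁)
       (planar-cong (λ i → trans (on₂ i) (old (lift (∈-++⁺ʳ (concat (u ∷ W₁)) i)))) P₂)
  where
  perm = split-part-↭ x x' u v q
  p⁺ : Part (true ∷ false ∷ μ) (u ∷ W₁) (v ∷ W₂) (u ∷ v ∷ W)
  p⁺ = left (right q)
  unique-tail : ∀ {a : ℕ} {l} → Unique (a ∷ l) → Unique l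
  unique-tail (_ ∷ u) = u
trees-planar (suc f) ((x ∷ w) ∷ W) un t∈ | inj₂ k with ∈-concatMap⁻′ (joins f (length w)) (picks (map length W)) k
... | (A , b , B) , pk , t∈' with joins⁻ f (length w) {A} {B} {b} t∈' | map-++⁻ length W A (picks⁻ (map length W) pk)
... | i , j , t' , b≡ , k' , refl | W₁ , y , W₂ , refl , refl , refl , refl with length-split⁻ y i b≡
... | v , x' , v' , refl , refl , refl =
  let ι₀ , g₀ , P = trees-planar f ((w ++ v' ++ v) ∷ W₁ ++ W₂) (unique-tail (unique-tail (unique-resp-↭ perm un)))
        (subst (λ l → t' ∈ trees f l) (sym (cong₂ _∷_ (length-merge w v v') (map-++ length W₁ W₂))) k')
      g , old = glue-good {S' = (w ++ v' ++ v) ∷ W₁ ++ W₂} un perm g₀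
  in glue x x' ι₀ , g , merge (cong (λ y → W₁ ++ (v ++ y ∷ v') ∷ W₂) (sym (glue-x x x' ι₀))) (planar-cong old P)
  where
  perm = merge-↭ x x' w v v' W₁ W₂
  unique-tail : ∀ {a : ℕ} {l} → Unique (a ∷ l) → Unique l
  unique-tail (_ ∷ u) = u

-- The faces of a composition and the permutation `tau`

range : ℕ → ℕ → List ℕ
range off zero = []
range off (suc m) = off ∷ range (suc off) m

faces : ℕ → List ℕ → List (List ℕ)
faces off [] = []
faces off (m ∷ ms) = range off m ∷ faces (off + m) ms

applyUpTo-range : (f : ℕ → ℕ) (off n : ℕ) → (∀ j → f j ≡ off + j) → applyUpTo f n ≡ range off n
applyUpTo-range f off zero h = refl
applyUpTo-range f off (suc n) h = cong₂ _∷_ (trans (h 0) (+-identityʳ off))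
  (applyUpTo-range (f ∘ suc) (suc off) n (λ j → trans (h (suc j)) (+-suc off j)))

range-++ : (off m k : ℕ) → range off (m + k) ≡ range off m ++ range (off + m) k
range-++ off zero k = cong (λ o → range o k) (sym (+-identityʳ off))
range-++ off (suc m) k = cong (off ∷_) (trans (range-++ (suc off) m k) (cong (λ o → range (suc off) m ++ range o k) (sym (+-suc off m))))

concat-faces : (off : ℕ) (ms : List ℕ) → concat (faces off ms) ≡ range off (sum ms)
concat-faces off [] = refl
concat-faces off (m ∷ ms) = trans (cong (range off m ++_) (concat-faces (off + m) ms)) (sym (range-++ off m (sum ms)))

concat-faces-upTo : (ms : List ℕ) → concat (faces 0 ms) ≡ upTo (sum ms)
concat-faces-upTo ms = trans (concat-faces 0 ms) (sym (applyUpTo-range id 0 (sum ms) (λ _ → refl)))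

length-range : (off m : ℕ) → length (range off m) ≡ m
length-range off zero = refl
length-range off (suc m) = cong suc (length-range (suc off) m)

lengths-faces : (off : ℕ) (ms : List ℕ) → map length (faces off ms) ≡ ms
lengths-faces off [] = refl
lengths-faces off (m ∷ ms) = cong₂ _∷_ (length-range off m) (lengths-faces (off + m) ms)

∈-range : (off m : ℕ) {a : ℕ} → a ∈ range off m → off ≤ a
∈-range off (suc m) (here refl) = ≤-refl
∈-range off (suc m) (there i) = ≤-trans (n≤1+n off) (∈-range (suc off) m i)

<ᵇ-true : {m n : ℕ} → m < n → (m <ᵇ n) ≡ true
<ᵇ-true m<n = Equivalence.to T-≡ (<⇒<ᵇ m<n)

<ᵇ-false : {m n : ℕ} → n ≤ m → (m <ᵇ n) ≡ false
<ᵇ-false {m} {n} n≤m with m <ᵇ n in eq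
... | false = refl
... | true = ⊥-elim (<⇒≱ (<ᵇ⇒< m n (subst T (sym eq) tt)) n≤m)

tau-later : (m : ℕ) (ms : List ℕ) {off j : ℕ} → off + m ≤ j → tauAux (m ∷ ms) off j ≡ tauAux ms (off + m) j
tau-later m ms le rewrite <ᵇ-false le = refl

-- The start `s` travels through the block for the induction, while `off` stays the place to which
-- the last position returns.
tau-block : (m : ℕ) (ms : List ℕ) (off s k : ℕ) → s + suc k ≡ off + m →
  map (tauAux (m ∷ ms) off) (range s (suc k)) ≡ range (suc s) k ++ off ∷ []
tau-block m ms off s zero e = cong (_∷ []) h
  where
  h : tauAux (m ∷ ms) off s ≡ off
  h rewrite <ᵇ-true {s} {off + m} (≤-reflexive (trans (+-comm 1 s) e))
          | <ᵇ-false {suc s} {off + m} (≤-reflexive (trans (sym e) (+-comm s 1))) = refl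
tau-block m ms off s (suc k) e = cong₂ _∷_ h (tau-block m ms off (suc s) k (trans (sym (+-suc s (suc k))) e))
  where
  le : suc (suc s) ≤ off + m
  le = ≤-trans (≤-trans (≤-reflexive (+-comm 2 s)) (+-monoʳ-≤ s (s≤s (s≤s z≤n)))) (≤-reflexive e)
  h : tauAux (m ∷ ms) off s ≡ suc s
  h rewrite <ᵇ-true {s} {off + m} (≤-trans (n≤1+n _) le) | <ᵇ-true {suc s} {off + m} le = refl

cyclic-cong : {τ τ' : ℕ → ℕ} (w : List ℕ) → (∀ {a} → a ∈ w → τ a ≡ τ' a) → Cyclic τ w → Cyclic τ' w
cyclic-cong w h c = trans (map-cong-∈ w (λ i → sym (h i))) c
  where
  map-cong-∈ : ∀ {f g : ℕ → ℕ} l → (∀ {a} → a ∈ l → f a ≡ g a) → map f l ≡ map g l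
  map-cong-∈ [] h = refl
  map-cong-∈ (x ∷ l) h = cong₂ _∷_ (h (here refl)) (map-cong-∈ l (h ∘ there))

tau-cyclic : (off : ℕ) (ms : List ℕ) → All (Cyclic (tauAux ms off)) (faces off ms)
tau-cyclic off [] = []
tau-cyclic off (m ∷ ms) = block m ∷ All.tabulate λ {w} w∈ → cyclic-cong w
    (λ {a} a∈ → sym (tau-later m ms (∈-range (off + m) (sum ms) (subst (a ∈_) (concat-faces (off + m) ms) (∈-concat⁺′ a∈ w∈)))))
    (All.lookup (tau-cyclic (off + m) ms) w∈)
  where
  block : ∀ m → Cyclic (tauAux (m ∷ ms) off) (range off m)
  block zero = refl
  block (suc k) = tau-block (suc k) ms off off k refl

rotate-↭ : (w : List ℕ) → rotate w ↭ w
rotate-↭ [] = ↭-refl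
rotate-↭ (a ∷ w) = ++-comm w (a ∷ [])

cyclic-∈ : {τ : ℕ → ℕ} {w : List ℕ} → Cyclic τ w → ∀ {a} → a ∈ w → τ a ∈ w
cyclic-∈ {τ} {w} c {a} a∈ = ∈-resp-↭ (rotate-↭ w) (subst (τ a ∈_) c (∈-map⁺ τ a∈))

map-cyclic-↭ : {τ : ℕ → ℕ} {S : List (List ℕ)} → All (Cyclic τ) S → map τ (concat S) ↭ concat S
map-cyclic-↭ [] = ↭-refl
map-cyclic-↭ {τ} {w ∷ S} (c ∷ cs) = ↭-trans (↭-reflexive (map-++ τ w (concat S)))
  (++⁺ (↭-trans (↭-reflexive c) (rotate-↭ w)) (map-cyclic-↭ cs))

unique-map⁻ : {f : ℕ → ℕ} (L : List ℕ) → Unique (map f L) → ∀ {x y} → x ∈ L → y ∈ L → f x ≡ f y → x ≡ y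
unique-map⁻ {f} (a ∷ L) (h ∷ u) (here refl) (here refl) e = refl
unique-map⁻ {f} (a ∷ L) (h ∷ u) (here refl) (there j) e = ⊥-elim (All.lookup h (∈-map⁺ f j) e)
unique-map⁻ {f} (a ∷ L) (h ∷ u) (there i) (here refl) e = ⊥-elim (All.lookup h (∈-map⁺ f i) (sym e))
unique-map⁻ {f} (a ∷ L) (h ∷ u) (there i) (there j) e = unique-map⁻ L u i j e

-- Forward steps go all the way round: after rotating `a` to the front, the property is passed along
-- the word. This makes up for `reach` never stepping along the inverse of `τ`.
cyclic-transport : {τ : ℕ → ℕ} {w : List ℕ} (P : ℕ → Set) → Cyclic τ w → (∀ {a} → a ∈ w → P a → P (τ a)) →
  ∀ {a} → a ∈ w → P a → ∀ {b} → b ∈ w → P b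
cyclic-transport {τ} {w} P c step {a} a∈ pa b∈ with ∈-∃++ a∈
... | p , q , refl = find' (∈-resp-↭ (++-comm p (a ∷ q)) b∈)
  where
  step' : ∀ {y} → y ∈ a ∷ q ++ p → P y → P (τ y)
  step' i = step (∈-resp-↭ (++-comm (a ∷ q) p) i)
  chain : ∀ a l {z} → map τ (a ∷ l) ≡ l ++ z ∷ [] → (∀ {y} → y ∈ a ∷ l → P y → P (τ y)) → P a → ∀ {b} → b ∈ l → P b
  chain a (h ∷ l) e st pa (here refl) = subst P (∷-injectiveˡ e) (st (here refl) pa)
  chain a (h ∷ l) e st pa (there i) = chain h l (∷-injectiveʳ e) (st ∘ there) (subst P (∷-injectiveˡ e) (st (here refl) pa)) i
  find' : ∀ {b} → b ∈ a ∷ q ++ p → P b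
  find' (here refl) = pa
  find' (there i) = chain a (q ++ p) (cyclic-rotate τ p (a ∷ q) c) step' pa i

-- Reachability and connectedness agree

T-ext : {x y : Bool} → (T x → T y) → (T y → T x) → x ≡ y
T-ext {true} {true} f g = refl
T-ext {true} {false} f g = ⊥-elim (f tt)
T-ext {false} {true} f g = ⊥-elim (g tt)
T-ext {false} {false} f g = refl

filterᵇ-< : (p q : ℕ → Bool) {xs : List ℕ} {z : ℕ} → Unique xs → (∀ x → T (p x) → T (q x)) →
  z ∈ xs → ¬ T (p z) → T (q z) → length (filterᵇ p xs) < length (filterᵇ q xs)
filterᵇ-< p q {xs} {z} un h z∈ nz qz = length≤-by-relation _≡_ (z ∷ filterᵇ p xs) (filterᵇ q xs)
  (All.tabulate (λ i e → nz (subst (T ∘ p) (sym e) (proj₂ (∈-filterᵇ⁻ p xs i)))) ∷ unique-filterᵇ p un)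
  (λ { (here refl) → z , ∈-filterᵇ⁺ q z∈ qz , refl
     ; (there i) → let i' , t = ∈-filterᵇ⁻ p xs i in _ , ∈-filterᵇ⁺ q i' (h _ t) , refl })
  (λ _ _ _ e e' → trans e (sym e'))

module Reachability (n : ℕ) (ι τ : ℕ → ℕ) (S : List (List ℕ)) (concat≡ : concat S ≡ upTo n)
  (g : Good ι S) (cyc : All (Cyclic τ) S) (1≤n : 1 ≤ n) where

  private
    R = reach n ι τ
    in-S : ∀ {a} → a < n → a ∈ concat S
    in-S {a} a< = subst (a ∈_) (sym concat≡) (∈-upTo⁺ a<)
    <n : ∀ {a} → a ∈ concat S → a < n
    <n {a} a∈ = ∈-upTo⁻ (subst (a ∈_) concat≡ a∈)
    τ-word : ∀ {a} → a < n → ∃[ w ] w ∈ S × a ∈ w × τ a ∈ w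
    τ-word a< = let w , a∈ , w∈ = ∈-concat⁻′ S (in-S a<) in w , w∈ , a∈ , cyclic-∈ (All.lookup cyc w∈) a∈

  reach-colour : (c : ℕ → Bool) → (∀ {w a b} → w ∈ S → a ∈ w → b ∈ w → c a ≡ c b) →
    (∀ {a} → a ∈ concat S → c (ι a) ≡ c a) → ∀ k x → T (R k x) → c x ≡ c 0
  reach-colour c const inv zero x t = cong c (≡ᵇ⇒≡ x 0 t)
  reach-colour c const inv (suc k) x t with Equivalence.to (T-∨ {R k x}) t
  ... | inj₁ t' = reach-colour c const inv k x t'
  ... | inj₂ t' with any⁻ _ (upTo n) t'
  ... | y , y∈ , ty with Equivalence.to (T-∧ {R k y}) ty
  ... | ry , tx with Equivalence.to (T-∨ {ι y ≡ᵇ x}) tx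
  ... | inj₁ e = trans (cong c (sym (≡ᵇ⇒≡ (ι y) x e))) (trans (inv (in-S (∈-upTo⁻ y∈))) (reach-colour c const inv k y ry))
  ... | inj₂ e = let w , w∈ , y∈w , τy∈ = τ-word (∈-upTo⁻ y∈) in
        trans (cong c (sym (≡ᵇ⇒≡ (τ y) x e))) (trans (const w∈ τy∈ y∈w) (reach-colour c const inv k y ry))

  connected⇒Connected : (∀ {w} → w ∈ S → w ≢ []) → T (connected n ι τ) → Connected ι S
  connected⇒Connected ne t = mkConn ne λ c const inv a∈ b∈ →
    trans (reach-colour c const inv n _ (reached a∈)) (sym (reach-colour c const inv n _ (reached b∈)))
    where
    reached : ∀ {a} → a ∈ concat S → T (R n a)
    reached {a} a∈ = all⁻ (R n) (upTo n) t (∈-upTo⁺ (<n a∈))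

  reach-mono : ∀ k x → T (R k x) → T (R (suc k) x)
  reach-mono k x t = Equivalence.from (T-∨ {R k x}) (inj₁ t)

  reach-ι : ∀ k {y} → y < n → T (R k y) → T (R (suc k) (ι y))
  reach-ι k {y} y< t = Equivalence.from (T-∨ {R k (ι y)}) (inj₂ (any⁺ _ (∈-upTo⁺ y<)
    (Equivalence.from T-∧ (t , Equivalence.from T-∨ (inj₁ (≡⇒≡ᵇ (ι y) (ι y) refl))))))

  reach-τ : ∀ k {y} → y < n → T (R k y) → T (R (suc k) (τ y))
  reach-τ k {y} y< t = Equivalence.from (T-∨ {R k (τ y)}) (inj₂ (any⁺ _ (∈-upTo⁺ y<)
    (Equivalence.from T-∧ (t , Equivalence.from (T-∨ {ι y ≡ᵇ τ y}) (inj₂ (≡⇒≡ᵇ (τ y) (τ y) refl))))))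

  reach-zero : ∀ k → T (R k 0)
  reach-zero zero = tt
  reach-zero (suc k) = reach-mono k 0 (reach-zero k)

  -- This is why n steps suffice: as long as not everything is reached, each step adds a point.
  reach-grows : Connected ι S → ∀ k → (∀ {x} → x < n → T (R k x)) ⊎ suc k ≤ length (filterᵇ (R k) (upTo n))
  reach-grows C zero = inj₂ (∈-length (∈-filterᵇ⁺ (R 0) (∈-upTo⁺ 1≤n) tt))
  reach-grows C (suc k) with reach-grows C k
  ... | inj₁ h = inj₁ (λ {x} x< → reach-mono k x (h x<))
  ... | inj₂ l with Any.any? (λ y → T? (R k y) ×-dec ¬? (T? (R k (ι y)) ×-dec T? (R k (τ y)))) (upTo n)
  ... | yes i with find i
  ... | y , y∈ , ry , nr with T? (R k (ι y)) | T? (R k (τ y))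
  ... | no nι | _ = inj₂ (≤-<-trans l (filterᵇ-< (R k) (R (suc k)) (Uniqueₚ.upTo⁺ n) (reach-mono k)
          (∈-upTo⁺ (<n (Good.closed g (in-S (∈-upTo⁻ y∈))))) nι (reach-ι k (∈-upTo⁻ y∈) ry)))
  ... | yes rι | no nτ = inj₂ (≤-<-trans l (filterᵇ-< (R k) (R (suc k)) (Uniqueₚ.upTo⁺ n) (reach-mono k)
          (let w , w∈ , _ , τy∈ = τ-word (∈-upTo⁻ y∈) in ∈-upTo⁺ (<n (∈-concat⁺′ τy∈ w∈))) nτ (reach-τ k (∈-upTo⁻ y∈) ry)))
  ... | yes rι | yes rτ = ⊥-elim (nr (rι , rτ))
  -- No step leaves the reached set, so its characteristic function is an admissible colouring; it
  -- is constant and `true` at 0.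
  reach-grows C (suc k) | inj₂ l | no ni = inj₁ λ {x} x< → reach-mono k x
      (subst T (sym (Connected.monochrome C (R k) const inv (in-S x<) (in-S 1≤n))) (reach-zero k))
    where
    closedR : ∀ {y} → y < n → T (R k y) → T (R k (ι y)) × T (R k (τ y))
    closedR {y} y< t with T? (R k (ι y)) ×-dec T? (R k (τ y))
    ... | yes h = h
    ... | no h = ⊥-elim (ni (lose (∈-upTo⁺ y<) (t , h)))
    const : ∀ {w a b} → w ∈ S → a ∈ w → b ∈ w → R k a ≡ R k b
    const w∈ a∈ b∈ = T-ext (λ t → tr a∈ t b∈) (λ t → tr b∈ t a∈)
      where
      tr : ∀ {a} → a ∈ _ → T (R k a) → ∀ {b} → b ∈ _ → T (R k b)
      tr = cyclic-transport (T ∘ R k) (All.lookup cyc w∈) (λ i t → proj₂ (closedR (<n (∈-concat⁺′ i w∈)) t))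
    inv : ∀ {a} → a ∈ concat S → R k (ι a) ≡ R k a
    inv a∈ = T-ext (λ t → subst (T ∘ R k) (Good.involutive g a∈) (proj₁ (closedR (<n (Good.closed g a∈)) t)))
                   (λ t → proj₁ (closedR (<n a∈) t))

  Connected⇒connected : Connected ι S → T (connected n ι τ)
  Connected⇒connected C with reach-grows C n
  ... | inj₁ h = all⁺ (R n) (upTo n) (h ∘ ∈-upTo⁻)
  -- This would be more than `n` reached points among `n` positions.
  ... | inj₂ l = ⊥-elim (<⇒≱ l (≤-trans (length≤-by-relation _≡_ (filterᵇ (R n) (upTo n)) (upTo n)
        (unique-filterᵇ (R n) (Uniqueₚ.upTo⁺ n)) (λ i → _ , proj₁ (∈-filterᵇ⁻ (R n) (upTo n) i) , refl)
        (λ _ _ _ e e' → trans e (sym e'))) (≤-reflexive (length-applyUpTo id n))))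

  numCycles-vertices : ∀ {k} → (∀ {w} → w ∈ S → w ≢ []) → Vertices ι S k → numCycles n (τ ∘ ι) ≡ k
  numCycles-vertices {k} ne d =
    let cl , rs , reps , e = vertices-representatives d τ g cyc
        φ< : ∀ {y} → y < n → τ (ι y) < n
        φ< y< = <n (cl (in-S y<))
        φ-inj : ∀ {y z} → y < n → z < n → τ (ι y) ≡ τ (ι z) → y ≡ z
        φ-inj {y} {z} y< z< eq = trans (sym (Good.involutive g (in-S y<))) (trans (cong ι
          (unique-map⁻ (concat S) (unique-resp-↭ (↭-sym (map-cyclic-↭ cyc)) (Good.unique g))
            (Good.closed g (in-S y<)) (Good.closed g (in-S z<)) eq)) (Good.involutive g (in-S z<)))
    in trans (PermutationOfRange.numCycles-representatives n (τ ∘ ι) φ< φ-inj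
         (subst (λ L → Representatives (τ ∘ ι) L rs) concat≡ reps))
       (trans (sym (+-identityʳ (length rs))) (trans (cong (length rs +_) (sym (no-empty S ne))) e))
    where
    no-empty : ∀ S → (∀ {w} → w ∈ S → w ≢ []) → emptyWords S ≡ 0
    no-empty [] ne = refl
    no-empty ([] ∷ S) ne = ⊥-elim (ne (here refl) refl)
    no-empty ((_ ∷ _) ∷ S) ne = no-empty S (ne ∘ there)

-- Genus-0 data of one composition are counted by trees

compositions-spec : (n K : ℕ) {comp : List ℕ} → comp ∈ compositions n K →
  sum comp ≡ n × length comp ≡ K × (∀ {m} → m ∈ comp → m ≢ 0)
compositions-suc : (n K : ℕ) {comp : List ℕ} →
  comp ∈ concatMap (λ a → map (λ c → suc a ∷ c) (compositions (n ∸ suc a) K)) (upTo n) →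
  sum comp ≡ n × length comp ≡ suc K × (∀ {m} → m ∈ comp → m ≢ 0)
compositions-spec zero zero (here refl) = refl , refl , λ ()
compositions-spec zero (suc K) i = compositions-suc zero K i
compositions-spec (suc n) (suc K) i = compositions-suc (suc n) K i
compositions-suc n K i with ∈-concatMap⁻′ (λ a → map (λ c → suc a ∷ c) (compositions (n ∸ suc a) K)) (upTo n) i
... | a , a∈ , j with ∈-map⁻ _ j
... | c , c∈ , refl with compositions-spec (n ∸ suc a) K c∈
... | s , l , p = trans (cong (suc a +_) s) (m+[n∸m]≡n (∈-upTo⁻ a∈)) , cong suc l ,
      λ { (here refl) () ; (there k) → p k }

allTables⁺ : (n m : ℕ) (t : List ℕ) → length t ≡ n → (∀ {a} → a ∈ t → a < m) → t ∈ allTables n m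
allTables⁺ zero m [] e h = here refl
allTables⁺ (suc n) m (a ∷ t) e h = ∈-concatMap⁺′ (λ t → map (λ a → a ∷ t) (upTo m))
  (allTables⁺ n m t (suc-injective e) (h ∘ there)) (∈-map⁺ _ (∈-upTo⁺ (h (here refl))))

allTables⁻ : (n m : ℕ) {t : List ℕ} → t ∈ allTables n m → length t ≡ n × (∀ {a} → a ∈ t → a < m)
allTables⁻ zero m (here refl) = refl , λ ()
allTables⁻ (suc n) m i with ∈-concatMap⁻′ (λ t → map (λ a → a ∷ t) (upTo m)) (allTables n m) i
... | t , t∈ , j with ∈-map⁻ _ j
... | a , a∈ , refl with allTables⁻ n m t∈
... | l , h = cong suc l , λ { (here refl) → ∈-upTo⁻ a∈ ; (there k) → h k }

allTables-unique : (n m : ℕ) → Unique (allTables n m)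
allTables-unique zero m = [] ∷ []
allTables-unique (suc n) m = unique-concatMap (λ t → map (λ a → a ∷ t) (upTo m)) (allTables-unique n m)
  (λ {t} _ → unique-map (λ a → a ∷ t) (λ { refl → refl }) (Uniqueₚ.upTo⁺ m))
  λ k l → let _ , _ , e = ∈-map⁻ _ k
              _ , _ , e' = ∈-map⁻ _ l
          in ∷-injectiveʳ (trans (sym e) e')

idx-∈ : (t : List ℕ) {j : ℕ} → j < length t → idx t j ∈ t
idx-∈ (a ∷ t) {zero} l = here refl
idx-∈ (a ∷ t) {suc j} (s≤s l) = there (idx-∈ t l)

idx-applyUpTo : (f : ℕ → ℕ) (n : ℕ) {j : ℕ} → j < n → idx (applyUpTo f n) j ≡ f j
idx-applyUpTo f (suc n) {zero} l = refl
idx-applyUpTo f (suc n) {suc j} (s≤s l) = idx-applyUpTo (f ∘ suc) n l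

idx-injective : (t t' : List ℕ) → length t ≡ length t' → (∀ {j} → j < length t → idx t j ≡ idx t' j) → t ≡ t'
idx-injective [] [] e h = refl
idx-injective (a ∷ t) (a' ∷ t') e h = cong₂ _∷_ (h {0} (s≤s z≤n)) (idx-injective t t' (suc-injective e) (λ l → h (s≤s l)))

faces-nonEmpty : (off : ℕ) (ms : List ℕ) → (∀ {m} → m ∈ ms → m ≢ 0) → ∀ {w} → w ∈ faces off ms → w ≢ []
faces-nonEmpty off (zero ∷ ms) h i = ⊥-elim (h (here refl) refl)
faces-nonEmpty off (suc m ∷ ms) h (here refl) ()
faces-nonEmpty off (suc m ∷ ms) h (there i) = faces-nonEmpty (off + suc m) ms (h ∘ there) i

module Data-Trees (n : ℕ) (1≤n : 1 ≤ n) (comp : List ℕ) (sum≡ : sum comp ≡ n)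
  (positive : ∀ {m} → m ∈ comp → m ≢ 0) where

  private
    S = faces 0 comp
    concat≡ : concat S ≡ upTo n
    concat≡ = trans (concat-faces-upTo comp) (cong upTo sum≡)
    un : Unique (concat S)
    un = subst Unique (sym concat≡) (Uniqueₚ.upTo⁺ n)
    length≡ : length (concat S) ≡ n
    length≡ = trans (cong length concat≡) (length-applyUpTo id n)
    lengths≡ : map length S ≡ comp
    lengths≡ = lengths-faces 0 comp
    K≡ : length S ≡ length comp
    K≡ = trans (sym (length-map length S)) (cong length lengths≡)
    in-S : ∀ {a} → a < n → a ∈ concat S
    in-S {a} a< = subst (a ∈_) (sym concat≡) (∈-upTo⁺ a<)
    <n : ∀ {a} → a ∈ concat S → a < n
    <n {a} a∈ = ∈-upTo⁻ (subst (a ∈_) concat≡ a∈)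
    nonEmpty : ∀ {w} → w ∈ S → w ≢ []
    nonEmpty = faces-nonEmpty 0 comp positive
    data-list = filterᵇ (isGenus0Datum n (length comp) comp) (allTables n n)

    good : (t : List ℕ) → t ∈ allTables n n → T (isFPFInvolution n t) → Good (idx t) S
    good t t∈ tt' = mkGood un (λ a∈ → in-S (h (idx-∈ t (subst (_ <_) (sym l) (<n a∈)))))
        (λ a∈ → ≡ᵇ⇒≡ _ _ (proj₂ (each a∈)))
        (λ {a} a∈ e → subst T (cong not (Equivalence.to T-≡ (≡⇒≡ᵇ (idx t a) a e))) (proj₁ (each a∈)))
      where
      l = proj₁ (allTables⁻ n n t∈)
      h = proj₂ (allTables⁻ n n t∈)
      each : ∀ {a} → a ∈ concat S → T (not (idx t a ≡ᵇ a)) × T (idx t (idx t a) ≡ᵇ a)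
      each a∈ = Equivalence.to T-∧ (all⁻ _ (upTo n) tt' (∈-upTo⁺ (<n a∈)))

  Represents : List ℕ → Tree → Set
  Represents t tree = Planar (idx t) S tree

  datum⇒tree : ∀ {t} → t ∈ data-list → ∃[ tree ] tree ∈ trees n comp × Represents t tree
  datum⇒tree {t} t∈ = tree , subst (λ l → tree ∈ trees n l) lengths≡ (planar-trees n planar (≤-reflexive length≡)) , planar
    where
    t∈all = proj₁ (∈-filterᵇ⁻ _ (allTables n n) t∈)
    valid = proj₂ (∈-filterᵇ⁻ (isGenus0Datum n (length comp) comp) (allTables n n) t∈)
    fpf = proj₁ (Equivalence.to (T-∧ {isFPFInvolution n t}) valid)
    rest = Equivalence.to (T-∧ {connected n (idx t) (tau comp)}) (proj₂ (Equivalence.to (T-∧ {isFPFInvolution n t}) valid))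
    g = good t t∈all fpf
    module Re = Reachability n (idx t) (tau comp) S concat≡ g (tau-cyclic 0 comp) 1≤n
    C : Connected (idx t) S
    C = Re.connected⇒Connected nonEmpty (proj₁ rest)
    -- `euler` expects an explicit first face; `S` has one because it contains `n ≥ 1` letters.
    eulerS : ∀ S → S ≢ [] → length (concat S) ≤ n → Good (idx t) S → Connected (idx t) S → Euler (idx t) S
    eulerS [] ne l g C = ⊥-elim (ne refl)
    eulerS (w ∷ W) ne l g C = euler n w W l g (inj₂ C)
    S≢[] : S ≢ []
    S≢[] e = <⇒≱ 1≤n (≤-reflexive (trans (sym length≡) (cong (length ∘ concat) e)))
    eu = eulerS S S≢[] (≤-reflexive length≡) g C
    k = proj₁ eu
    k≡ : numCycles n (tau comp ∘ idx t) ≡ k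
    k≡ = Re.numCycles-vertices nonEmpty (proj₁ (proj₂ eu))
    genus : 2 * (k + length S) ≡ 4 + length (concat S)
    genus = trans (cong₂ (λ a b → 2 * (a + b)) (sym k≡) K≡)
      (trans (≡ᵇ⇒≡ _ (n + 4) (proj₂ rest)) (trans (+-comm n 4) (cong (4 +_) (sym length≡))))
    -- The genus test is the case of equality in Euler's inequality, so the strict alternative is
    -- impossible and a tree remains.
    sharp : ∃[ tree ] Planar (idx t) S tree
    sharp with proj₂ (proj₂ eu)
    ... | inj₁ l = ⊥-elim (<-irrefl genus l)
    ... | inj₂ (_ , P) = P
    tree = proj₁ sharp
    planar = proj₂ sharp

  tree⇒datum : ∀ {tree} → tree ∈ trees n comp → ∃[ t ] t ∈ data-list × Represents t tree
  tree⇒datum {tree} tree∈ = t , ∈-filterᵇ⁺ _ t∈all valid , planar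
    where
    pl = trees-planar n S un (subst (λ l → tree ∈ trees n l) (sym lengths≡) tree∈)
    ι = proj₁ pl
    gι = proj₁ (proj₂ pl)
    -- The table agrees with `ι` on all letters, which is all that the derivation depends on.
    t = applyUpTo ι n
    idx≡ : ∀ {a} → a ∈ concat S → ι a ≡ idx t a
    idx≡ a∈ = sym (idx-applyUpTo ι n (<n a∈))
    planar : Planar (idx t) S tree
    planar = planar-cong idx≡ (proj₂ (proj₂ pl))
    t∈all : t ∈ allTables n n
    t∈all = allTables⁺ n n t (length-applyUpTo ι n)
      (λ a∈ → let i , i< , e = ∈-applyUpTo⁻ ι a∈ in subst (_< n) (sym e) (<n (Good.closed gι (in-S i<))))
    fpf : T (isFPFInvolution n t)
    fpf = all⁺ _ (upTo n) λ {j} j∈ → let j∈S = in-S (∈-upTo⁻ j∈) in Equivalence.from T-∧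
      ( Equivalence.from T-not-≡ (neq (λ e → Good.fixedFree gι j∈S (trans (idx≡ j∈S) e)))
      , ≡⇒≡ᵇ _ j (trans (cong (idx t) (sym (idx≡ j∈S))) (trans (sym (idx≡ (Good.closed gι j∈S))) (Good.involutive gι j∈S))))
      where
      neq : ∀ {a b} → a ≢ b → (a ≡ᵇ b) ≡ false
      neq {a} {b} n with a ≡ᵇ b in eq
      ... | false = refl
      ... | true = ⊥-elim (n (≡ᵇ⇒≡ a b (subst T (sym eq) tt)))
    g = good t t∈all fpf
    module Re = Reachability n (idx t) (tau comp) S concat≡ g (tau-cyclic 0 comp) 1≤n
    C : Connected (idx t) S
    C with planar-connected planar g
    ... | inj₂ C = C
    ... | inj₁ e = ⊥-elim (<⇒≱ 1≤n (≤-reflexive (trans (sym length≡) (cong (length ∘ concat) e))))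
    pv = planar-vertices planar
    k≡ : numCycles n (tau comp ∘ idx t) ≡ proj₁ pv
    k≡ = Re.numCycles-vertices nonEmpty (proj₁ (proj₂ pv))
    valid : T (isGenus0Datum n (length comp) comp t)
    valid = Equivalence.from (T-∧ {isFPFInvolution n t}) (fpf , Equivalence.from (T-∧ {connected n (idx t) (tau comp)})
      (Re.Connected⇒connected C , ≡⇒≡ᵇ _ (n + 4)
        (trans (cong₂ (λ a b → 2 * (a + b)) k≡ (sym K≡)) (trans (proj₂ (proj₂ pv)) (trans (cong (4 +_) length≡) (+-comm 4 n))))))

  -- Each datum has a tree and each tree a datum; a tree fixes the table by `planar-injective`, and
  -- a table fixes the tree by `planar-deterministic`.
  count-data : length data-list ≡ length (trees n comp)
  count-data = ≤-antisym
    (length≤-by-relation Represents data-list (trees n comp) (unique-filterᵇ _ (allTables-unique n n)) datum⇒tree same-table)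
    (length≤-by-relation (λ tree t → Represents t tree) (trees n comp) data-list (trees-unique n comp) tree⇒datum
      (λ _ _ t∈ P P' → planar-deterministic P P' (good-datum t∈)))
    where
    good-datum : ∀ {t} → t ∈ data-list → Good (idx t) S
    good-datum {t} t∈ = let i , v = ∈-filterᵇ⁻ (isGenus0Datum n (length comp) comp) (allTables n n) t∈ in
      good t i (proj₁ (Equivalence.to (T-∧ {isFPFInvolution n t}) v))
    table-length : ∀ {t} → t ∈ data-list → length t ≡ n
    table-length {t} t∈ = proj₁ (allTables⁻ n n (proj₁ (∈-filterᵇ⁻ (isGenus0Datum n (length comp) comp) (allTables n n) t∈)))
    same-table : ∀ {t t' tree} → t ∈ data-list → t' ∈ data-list → tree ∈ trees n comp →
      Represents t tree → Represents t' tree → t ≡ t'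
    same-table {t} {t'} t∈ t'∈ _ P P' = idx-injective t t' (trans (table-length t∈) (sym (table-length t'∈)))
      (λ l → planar-injective P P' refl (Good.involutive (good-datum t∈)) (Good.involutive (good-datum t'∈))
        (in-S (subst (_ <_) (table-length t∈) l)))

-- Tree counts independent of fuel, and parity

sum-map-cong : {A : Set} (f g : A → ℕ) (xs : List A) → (∀ {x} → x ∈ xs → f x ≡ g x) → sum (map f xs) ≡ sum (map g xs)
sum-map-cong f g [] h = refl
sum-map-cong f g (x ∷ xs) h = cong₂ _+_ (h (here refl)) (sum-map-cong f g xs (h ∘ there))

countData-trees : (n K : ℕ) (P : List ℕ → Bool) → 1 ≤ n →
  countData n K P ≡ sum (map (λ comp → if P comp then length (trees n comp) else 0) (compositions n K))
countData-trees n K P 1≤n = trans (length-concatMap _ (compositions n K)) (sum-map-cong _ _ (compositions n K) each)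
  where
  each : ∀ {comp} → comp ∈ compositions n K →
    length (if P comp then filterᵇ (isGenus0Datum n K comp) (allTables n n) else []) ≡ (if P comp then length (trees n comp) else 0)
  each {comp} c∈ with P comp | compositions-spec n K c∈
  ... | false | _ = refl
  ... | true | s , refl , pos = Data-Trees.count-data n 1≤n comp s pos

concatMap-cong-∈ : {A B : Set} {f g : A → List B} (xs : List A) → (∀ {x} → x ∈ xs → f x ≡ g x) → concatMap f xs ≡ concatMap g xs
concatMap-cong-∈ [] h = refl
concatMap-cong-∈ (x ∷ xs) h = cong₂ _++_ (h (here refl)) (concatMap-cong-∈ xs (h ∘ there))

part-sum : {m : List Bool} {xs ys zs : List ℕ} → Part m xs ys zs → sum zs ≡ sum xs + sum ys
part-sum [] = refl
part-sum (left {xs = xs} {x = x} p) = trans (cong (x +_) (part-sum p)) (sym (+-assoc x (sum xs) _))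
part-sum (right {xs = xs} {y = y} p) = trans (cong (y +_) (part-sum p)) (rot y (sum xs) _)
  where
  rot : ∀ a b c → a + (b + c) ≡ b + (a + c)
  rot = solve 3 (λ a b c → a :+ (b :+ c) := b :+ (a :+ c)) refl
    where open +-*-Solver

node-sum : (i j : ℕ) {μ : List Bool} {A B W : List ℕ} → Part μ A B W →
  suc (i + suc j) + sum W ≡ suc (suc ((i + sum A) + (j + sum B)))
node-sum i j {A = A} {B} p = trans (cong (suc (i + suc j) +_) (part-sum p)) (arith i j (sum A) (sum B))
  where
  arith : ∀ i j a b → suc (i + suc j) + (a + b) ≡ suc (suc ((i + a) + (j + b)))
  arith = solve 4 (λ i j a b → con 1 :+ (i :+ (con 1 :+ j)) :+ (a :+ b) := con 2 :+ ((i :+ a) :+ (j :+ b))) refl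
    where open +-*-Solver

join-sum : (m i j : ℕ) (A B : List ℕ) →
  suc m + sum (A ++ (i + suc j) ∷ B) ≡ suc (suc (sum (m + (j + i) ∷ A ++ B)))
join-sum m i j A B = trans (cong (suc m +_) (sum-++ A ((i + suc j) ∷ B)))
  (trans (arith m i j (sum A) (sum B)) (cong (λ s → suc (suc (m + (j + i) + s))) (sym (sum-++ A B))))
  where
  arith : ∀ m i j a b → suc m + (a + ((i + suc j) + b)) ≡ suc (suc (m + (j + i) + (a + b)))
  arith = solve 5 (λ m i j a b → con 1 :+ m :+ (a :+ ((i :+ (con 1 :+ j)) :+ b)) := con 2 :+ (m :+ (j :+ i) :+ (a :+ b))) refl
    where open +-*-Solver

≤-of-suc² : {a b f : ℕ} → b ≡ suc (suc a) → b ≤ suc f → a ≤ f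
≤-of-suc² refl l = ≤-trans (n≤1+n _) (≤-pred l)

-- Each step lowers the total length by two and the fuel by one, so fuel equal to the total length
-- never runs out.
trees-fuel : (f f' : ℕ) (W : List ℕ) → sum W ≤ f → sum W ≤ f' → trees f W ≡ trees f' W
trees-fuel f f' [] l l' = refl
trees-fuel f f' (zero ∷ []) l l' = refl
trees-fuel f f' (zero ∷ _ ∷ _) l l' = refl
trees-fuel (suc f) (suc f') (suc m ∷ W) l l' = cong₂ _++_
  (concatMap-cong-∈ (splittings m) λ {(i , j)} ij∈ → concatMap-cong-∈ (bipartitions W) λ {(μ , A , B)} p∈ →
    let p = bipartitions⁻ W p∈
        e = trans (cong (λ m → suc m + sum W) (splittings⁻ ij∈)) (node-sum i j p)
        b = ≤-of-suc² e l
        b' = ≤-of-suc² e l'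
    in cong₂ (cartesianProductWith (node i j μ A B))
      (trees-fuel f f' (i ∷ A) (≤-trans (m≤m+n _ _) b) (≤-trans (m≤m+n _ _) b'))
      (trees-fuel f f' (j ∷ B) (≤-trans (m≤n+m _ (i + sum A)) b) (≤-trans (m≤n+m _ (i + sum A)) b')))
  (concatMap-cong-∈ (picks W) λ {(A , b , B)} p∈ → concatMap-cong-∈ (splittings b) λ {(i , j)} ij∈ →
    let e = trans (cong (λ V → suc m + sum V) (trans (picks⁻ W p∈) (cong (λ b → A ++ b ∷ B) (splittings⁻ ij∈)))) (join-sum m i j A B)
    in cong (map (join A i j B)) (trees-fuel f f' (m + (j + i) ∷ A ++ B) (≤-of-suc² e l) (≤-of-suc² e l')))

treeCount : List ℕ → ℕ
treeCount W = length (trees (sum W) W)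

treeCount-fuel : (f : ℕ) (W : List ℕ) → sum W ≤ f → length (trees f W) ≡ treeCount W
treeCount-fuel f W l = cong length (trees-fuel f (sum W) W l ≤-refl)

-- Letters disappear in pairs. This later removes the odd lengths from the convolutions.
trees-even : (f : ℕ) (W : List ℕ) {t : Tree} → t ∈ trees f W → ∃[ k ] sum W ≡ k + k
trees-even f (zero ∷ []) i = 0 , refl
trees-even (suc f) (suc m ∷ W) t∈ with ∈-++⁻ (concatMap (nodes f W) (splittings m)) t∈
... | inj₁ k with ∈-concatMap⁻′ (nodes f W) (splittings m) k
... | (i , j) , ij∈ , k' with nodes⁻ f W {i} {j} k'
... | μ , A , B , t₁ , t₂ , p , l₁ , l₂ , _ =
  let k₁ , e₁ = trees-even f (i ∷ A) l₁
      k₂ , e₂ = trees-even f (j ∷ B) l₂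
  in suc (k₁ + k₂) , trans (cong (λ m → suc m + sum W) (splittings⁻ ij∈)) (trans (node-sum i j p)
       (trans (cong₂ (λ a b → suc (suc (a + b))) e₁ e₂) (arith k₁ k₂)))
  where
  arith : ∀ a b → suc (suc ((a + a) + (b + b))) ≡ suc (a + b) + suc (a + b)
  arith = solve 2 (λ a b → con 2 :+ ((a :+ a) :+ (b :+ b)) := (con 1 :+ (a :+ b)) :+ (con 1 :+ (a :+ b))) refl
    where open +-*-Solver
trees-even (suc f) (suc m ∷ W) t∈ | inj₂ k with ∈-concatMap⁻′ (joins f m) (picks W) k
... | (A , b , B) , p∈ , k' with joins⁻ f m {A} {B} {b} k'
... | i , j , t' , b≡ , l , _ =
  let k , e = trees-even f (m + (j + i) ∷ A ++ B) l
  in suc k , trans (cong (λ V → suc m + sum V) (trans (picks⁻ W p∈) (cong (λ b → A ++ b ∷ B) b≡)))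
       (trans (join-sum m i j A B) (trans (cong (suc ∘ suc) e) (cong suc (sym (+-suc k k)))))

odd≢even : ∀ k l → suc (k + k) ≢ l + l
odd≢even zero (suc l) e = 0≢1+n (trans (suc-injective e) (+-suc l l))
odd≢even (suc k) (suc l) e = odd≢even k l (suc-injective (trans (sym (cong suc (+-suc k k))) (trans (suc-injective e) (+-suc l l))))

treeCount-odd : (W : List ℕ) (k : ℕ) → sum W ≡ suc (k + k) → treeCount W ≡ 0
treeCount-odd W k e with trees (sum W) W in eq
... | [] = refl
... | t ∷ _ = let l , e' = trees-even (sum W) W (subst (t ∈_) (sym eq) (here refl)) in ⊥-elim (odd≢even k l (trans (sym e) e'))

-- Convolution sums

-- conv n h is the sum of h i j over i + j + 1 = n.
conv : ℕ → (ℕ → ℕ → ℕ) → ℕ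
conv zero h = 0
conv (suc n) h = h 0 n + conv n (λ i j → h (suc i) j)

conv-cong : (n : ℕ) {h k : ℕ → ℕ → ℕ} → (∀ i j → i + suc j ≡ n → h i j ≡ k i j) → conv n h ≡ conv n k
conv-cong zero e = refl
conv-cong (suc n) e = cong₂ _+_ (e 0 n refl) (conv-cong n (λ i j p → e (suc i) j (cong suc p)))

conv-zero : (n : ℕ) {h : ℕ → ℕ → ℕ} → (∀ i j → i + suc j ≡ n → h i j ≡ 0) → conv n h ≡ 0
conv-zero zero e = refl
conv-zero (suc n) e = cong₂ _+_ (e 0 n refl) (conv-zero n (λ i j p → e (suc i) j (cong suc p)))

+-interchange : ∀ a b c d → (a + b) + (c + d) ≡ (a + c) + (b + d)
+-interchange = solve 4 (λ a b c d → (a :+ b) :+ (c :+ d) := (a :+ c) :+ (b :+ d)) refl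
  where open +-*-Solver

conv-+ : (n : ℕ) (h k : ℕ → ℕ → ℕ) → conv n (λ i j → h i j + k i j) ≡ conv n h + conv n k
conv-+ zero h k = refl
conv-+ (suc n) h k = trans (cong (h 0 n + k 0 n +_) (conv-+ n (λ i j → h (suc i) j) (λ i j → k (suc i) j)))
  (+-interchange (h 0 n) (k 0 n) _ _)

conv-*ˡ : (n a : ℕ) (h : ℕ → ℕ → ℕ) → conv n (λ i j → a * h i j) ≡ a * conv n h
conv-*ˡ zero a h = sym (*-zeroʳ a)
conv-*ˡ (suc n) a h = trans (cong (a * h 0 n +_) (conv-*ˡ n a (λ i j → h (suc i) j))) (sym (*-distribˡ-+ a (h 0 n) _))

conv-*ʳ : (n a : ℕ) (h : ℕ → ℕ → ℕ) → conv n (λ i j → h i j * a) ≡ conv n h * a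
conv-*ʳ zero a h = refl
conv-*ʳ (suc n) a h = trans (cong (h 0 n * a +_) (conv-*ʳ n a (λ i j → h (suc i) j))) (sym (*-distribʳ-+ a (h 0 n) _))

conv-last : (n : ℕ) (h : ℕ → ℕ → ℕ) → conv (suc n) h ≡ conv n (λ i j → h i (suc j)) + h n 0
conv-last zero h = +-comm (h 0 0) 0
conv-last (suc n) h = trans (cong (h 0 (suc n) +_) (conv-last n (λ i j → h (suc i) j))) (sym (+-assoc (h 0 (suc n)) _ _))

conv-comm : (n : ℕ) (h : ℕ → ℕ → ℕ) → conv n h ≡ conv n (λ i j → h j i)
conv-comm zero h = refl
conv-comm (suc n) h = trans (cong (h 0 n +_) (conv-comm n (λ i j → h (suc i) j)))
  (trans (+-comm (h 0 n) _) (sym (conv-last n (λ i j → h j i))))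

-- Both sides range over all triples with `i + j + r + 2 = n`.
conv-assoc : (n : ℕ) (h : ℕ → ℕ → ℕ → ℕ) →
  conv n (λ a r → conv a (λ i j → h i j r)) ≡ conv n (λ i s → conv s (λ j r → h i j r))
conv-assoc zero h = refl
conv-assoc (suc n) h = trans (conv-+ n (λ a r → h 0 a r) (λ a r → conv a (λ i j → h (suc i) j r)))
  (cong (conv n (h 0) +_) (conv-assoc n (λ i → h (suc i))))

conv-exchange : (a r : ℕ) (h : ℕ → ℕ → ℕ → ℕ → ℕ) →
  conv r (λ b c → conv a (λ i j → h i j b c)) ≡ conv a (λ i j → conv r (λ b c → h i j b c))
conv-exchange a zero h = sym (conv-zero a (λ _ _ _ → refl))
conv-exchange a (suc r) h = trans (cong (conv a (λ i j → h i j 0 r) +_) (conv-exchange a r (λ i j b c → h i j (suc b) c)))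
  (sym (conv-+ a (λ i j → h i j 0 r) (λ i j → conv r (λ b c → h i j (suc b) c))))

conv-left-comm : (n : ℕ) (h : ℕ → ℕ → ℕ → ℕ) →
  conv n (λ a r → conv r (λ b c → h a b c)) ≡ conv n (λ b r → conv r (λ a c → h a b c))
conv-left-comm n h = trans (sym (conv-assoc n h))
  (trans (conv-cong n (λ m c _ → conv-comm m (λ a b → h a b c))) (conv-assoc n (λ b a c → h a b c)))

conv-upTo : (n : ℕ) (h : ℕ → ℕ → ℕ) → conv n h ≡ sum (map (λ a → h a (n ∸ suc a)) (upTo n))
conv-upTo n h = trans (go n h) (cong sum (sym (map-upTo (λ a → h a (n ∸ suc a)) n)))
  where
  go : ∀ n h → conv n h ≡ sum (applyUpTo (λ a → h a (n ∸ suc a)) n)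
  go zero h = refl
  go (suc n) h = cong (h 0 n +_) (go n (λ i j → h (suc i) j))

conv-splittings : (n : ℕ) (h : ℕ × ℕ → ℕ) → sum (map h (splittings n)) ≡ conv n (λ i j → h (i , j))
conv-splittings zero h = refl
conv-splittings (suc n) h = cong (h (0 , n) +_)
  (trans (cong sum (sym (map-∘ (splittings n)))) (conv-splittings n (λ (i , j) → h (suc i , j))))

conv-const : (n a : ℕ) → conv n (λ _ _ → a) ≡ n * a
conv-const zero a = refl
conv-const (suc n) a = cong (a +_) (conv-const n a)

conv-indicator : (n k : ℕ) (h : ℕ → ℕ → ℕ) → k < n → conv n (λ a b → if a ≡ᵇ k then h a b else 0) ≡ h k (n ∸ suc k)
conv-indicator (suc n) zero h l = trans (cong (h 0 n +_) (conv-zero n (λ _ _ _ → refl))) (+-identityʳ (h 0 n))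
conv-indicator (suc n) (suc k) h (s≤s l) = conv-indicator n k (λ i → h (suc i)) l

-- Twice the triangular number 1 + ... + `n`, stated without division; the factor 2 will be supplied
-- by the two faces with which the first one can merge.
conv-triangular : (n : ℕ) → conv n (λ _ b → suc b) + conv n (λ _ b → suc b) ≡ n * suc n
conv-triangular zero = refl
conv-triangular (suc n) = trans (+-interchange (suc n) (conv n (λ _ b → suc b)) (suc n) (conv n (λ _ b → suc b)))
  (trans (cong (suc n + suc n +_) (conv-triangular n)) (arith n))
  where
  arith : ∀ n → suc n + suc n + n * suc n ≡ suc n * suc (suc n)
  arith = solve 1 (λ n → (con 1 :+ n) :+ (con 1 :+ n) :+ n :* (con 1 :+ n) := (con 1 :+ n) :* (con 2 :+ n)) refl
    where open +-*-Solver

-- The arguments of `h` add up to `n + n`, so once the first is even the second is too.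
conv-even : (n : ℕ) (h : ℕ → ℕ → ℕ) → (∀ i j → h (suc (i + i)) j ≡ 0) →
  conv (suc (n + n)) h ≡ conv (suc n) (λ i j → h (i + i) (j + j))
conv-even zero h z = refl
conv-even (suc n) h z = cong (h 0 (suc n + suc n) +_)
  (trans (cong (λ m → conv m (λ i j → h (suc i) j)) (cong suc (+-suc n n)))
    (trans (cong (_+ conv (suc (n + n)) (λ i j → h (suc (suc i)) j)) (z 0 (suc (n + n))))
      (trans (conv-even n (λ i j → h (suc (suc i)) j) (λ i j → trans (cong (λ k → h k j) (cong suc (cong suc (sym (+-suc i i))))) (z (suc i) j)))
        (conv-cong (suc n) (λ i j _ → cong (λ k → h k (j + j)) (cong suc (sym (+-suc i i))))))))

length-cartesian : {A B C : Set} (f : A → B → C) (xs : List A) (ys : List B) →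
  length (cartesianProductWith f xs ys) ≡ length xs * length ys
length-cartesian f [] ys = refl
length-cartesian f (x ∷ xs) ys = trans (length-++ (map (f x) ys)) (cong₂ _+_ (length-map (f x) ys) (length-cartesian f xs ys))

-- This is Tutte's recursion. All `b` positions of the partner inside a face of length `b` give the
-- same merged length, hence the factor `b`.
treeCount-suc : (m : ℕ) (W : List ℕ) → treeCount (suc m ∷ W) ≡
  conv m (λ i j → sum (map (λ (_ , A , B) → treeCount (i ∷ A) * treeCount (j ∷ B)) (bipartitions W))) +
  sum (map (λ (A , b , B) → b * treeCount (m + (b ∸ 1) ∷ A ++ B)) (picks W))
treeCount-suc m W = trans (length-++ (concatMap (nodes f W) (splittings m)))
  (cong₂ _+_
    (trans (length-concatMap (nodes f W) (splittings m))
      (trans (conv-splittings m (length ∘ nodes f W)) (conv-cong m nodes-count)))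
    (trans (length-concatMap (joins f m) (picks W)) (sum-map-cong _ _ (picks W) (λ {(A , b , B)} i → joins-count A b B (picks⁻ W i)))))
  where
  f = m + sum W
  nodes-count : ∀ i j → i + suc j ≡ m → length (nodes f W (i , j)) ≡
    sum (map (λ (_ , A , B) → treeCount (i ∷ A) * treeCount (j ∷ B)) (bipartitions W))
  nodes-count i j ij = trans (length-concatMap _ (bipartitions W)) (sum-map-cong _ _ (bipartitions W) λ {(μ , A , B)} p∈ →
    let b = ≤-of-suc² {f = f} (trans (cong (λ m → suc m + sum W) (sym ij)) (node-sum i j (bipartitions⁻ W p∈))) ≤-refl
    in trans (length-cartesian (node i j μ A B) (trees f (i ∷ A)) (trees f (j ∷ B)))
         (cong₂ _*_ (treeCount-fuel f (i ∷ A) (≤-trans (m≤m+n _ _) b)) (treeCount-fuel f (j ∷ B) (≤-trans (m≤n+m _ (i + sum A)) b))))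
  joins-count : ∀ A b B → W ≡ A ++ b ∷ B → length (joins f m (A , b , B)) ≡ b * treeCount (m + (b ∸ 1) ∷ A ++ B)
  joins-count A b B W≡ = trans (length-concatMap _ (splittings b))
    (trans (sum-map-cong _ _ (splittings b) each) (trans (conv-splittings b (λ _ → treeCount (m + (b ∸ 1) ∷ A ++ B))) (conv-const b _)))
    where
    each : ∀ {p} → p ∈ splittings b → length (map (join A (proj₁ p) (proj₂ p) B) (trees f (m + (proj₂ p + proj₁ p) ∷ A ++ B))) ≡
      treeCount (m + (b ∸ 1) ∷ A ++ B)
    each {i , j} p∈ = trans (length-map _ (trees f (m + (j + i) ∷ A ++ B)))
      (trans (treeCount-fuel f (m + (j + i) ∷ A ++ B) (≤-of-suc² (trans (cong (λ V → suc m + sum V) (trans W≡ (cong (λ b → A ++ b ∷ B) b≡))) (join-sum m i j A B)) ≤-refl))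
        (cong (λ k → treeCount (m + k ∷ A ++ B)) (sym (trans (cong (_∸ 1) (trans b≡ (+-suc i j))) (+-comm i j)))))
      where
      b≡ : b ≡ i + suc j
      b≡ = splittings⁻ p∈

-- Sums over compositions as convolutions

countData-treeCount : (n K : ℕ) (P : List ℕ → Bool) → 1 ≤ n →
  countData n K P ≡ sum (map (λ comp → if P comp then treeCount comp else 0) (compositions n K))
countData-treeCount n K P 1≤n = trans (countData-trees n K P 1≤n) (sum-map-cong _ _ (compositions n K)
  λ {comp} c∈ → cong (λ l → if P comp then l else 0) (treeCount-fuel n comp (≤-reflexive (proj₁ (compositions-spec n K c∈)))))

sum-concatMap : {A B : Set} (g : B → ℕ) (f : A → List B) (xs : List A) →
  sum (map g (concatMap f xs)) ≡ sum (map (λ x → sum (map g (f x))) xs)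
sum-concatMap g f [] = refl
sum-concatMap g f (x ∷ xs) = trans (cong sum (map-++ g (f x) (concatMap f xs)))
  (trans (sum-++ (map g (f x)) _) (cong (sum (map g (f x)) +_) (sum-concatMap g f xs)))

compositionSum : ℕ → ℕ → (List ℕ → ℕ) → ℕ
compositionSum n K g = sum (map g (compositions n K))

compositionSum-suc : (n K : ℕ) (g : List ℕ → ℕ) →
  compositionSum n (suc K) g ≡ conv n (λ a r → compositionSum r K (λ c → g (suc a ∷ c)))
compositionSum-suc n K g = trans (cong (sum ∘ map g) (unfold n)) (trans (sum-concatMap g _ (upTo n))
  (trans (sum-map-cong _ _ (upTo n) (λ {a} _ → cong sum (sym (map-∘ (compositions (n ∸ suc a) K)))))
    (sym (conv-upTo n (λ a r → compositionSum r K (λ c → g (suc a ∷ c)))))))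
  where
  unfold : ∀ n → compositions n (suc K) ≡ concatMap (λ a → map (λ c → suc a ∷ c) (compositions (n ∸ suc a) K)) (upTo n)
  unfold zero = refl
  unfold (suc n) = refl

compositionSum-1 : (n : ℕ) (g : List ℕ → ℕ) → compositionSum (suc n) 1 g ≡ g (suc n ∷ [])
compositionSum-1 n g = trans (compositionSum-suc (suc n) 0 g)
  (trans (conv-last n (λ a r → compositionSum r 0 (λ c → g (suc a ∷ c))))
    (cong₂ _+_ (conv-zero n (λ _ _ _ → refl)) (+-identityʳ (g (suc n ∷ [])))))

-- The last summand leaves nothing for the second part and vanishes; dropping it turns `n` into
-- `n ∸ 1` and makes both parts successors.
compositionSum-2 : (n : ℕ) (g : List ℕ → ℕ) →
  compositionSum n 2 g ≡ conv (n ∸ 1) (λ a b → g (suc a ∷ suc b ∷ []))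
compositionSum-2 zero g = refl
compositionSum-2 (suc n) g = trans (compositionSum-suc (suc n) 1 g)
  (trans (conv-last n (λ a r → compositionSum r 1 (λ c → g (suc a ∷ c))))
    (trans (+-identityʳ _) (conv-cong n (λ a b _ → compositionSum-1 b (λ c → g (suc a ∷ c))))))

compositionSum-3 : (n : ℕ) (g : List ℕ → ℕ) →
  compositionSum n 3 g ≡ conv (n ∸ 1) (λ a r → conv r (λ b c → g (suc a ∷ suc b ∷ suc c ∷ [])))
compositionSum-3 zero g = refl
compositionSum-3 (suc n) g = trans (compositionSum-suc (suc n) 2 g)
  (trans (conv-last n (λ a r → compositionSum r 2 (λ c → g (suc a ∷ c))))
    (trans (+-identityʳ _) (conv-cong n (λ a r _ → compositionSum-2 (suc r) (λ c → g (suc a ∷ c))))))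

-- The recurrence for three faces

F₁ : ℕ → ℕ
F₁ a = treeCount (a ∷ [])

F₂ : ℕ → ℕ → ℕ
F₂ a b = treeCount (a ∷ b ∷ [])

F₃ : ℕ → ℕ → ℕ → ℕ
F₃ a b c = treeCount (a ∷ b ∷ c ∷ [])

-- The numbers of two- and three-face data on `n` positions. They are indexed by positions rather
-- than edges, so that convolutions can run over lengths of either parity.
E₂ E₃ : ℕ → ℕ
E₂ n = conv (n ∸ 1) (λ a b → F₂ (suc a) (suc b))
E₃ n = conv (n ∸ 1) (λ a r → conv r (λ b c → F₃ (suc a) (suc b) (suc c)))

-- An empty first face contributes nothing when there are further faces.
E₂-conv : (n : ℕ) → conv n (λ a b → F₂ a (suc b)) ≡ E₂ n
E₂-conv zero = refl
E₂-conv (suc n) = refl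

E₃-conv : (n : ℕ) → conv n (λ a r → conv r (λ b c → F₃ a (suc b) (suc c))) ≡ E₃ n
E₃-conv zero = refl
E₃-conv (suc n) = cong (_+ E₃ (suc n)) (conv-zero n (λ _ _ _ → refl))

conv₂ : ℕ → (ℕ → ℕ → ℕ → ℕ) → ℕ
conv₂ n h = conv n (λ a r → conv r (h a))

conv₃ : ℕ → (ℕ → ℕ → ℕ → ℕ → ℕ) → ℕ
conv₃ n h = conv n (λ i s → conv₂ s (h i))

conv₂-cong : (n : ℕ) {h k : ℕ → ℕ → ℕ → ℕ} → (∀ a b c → h a b c ≡ k a b c) → conv₂ n h ≡ conv₂ n k
conv₂-cong n e = conv-cong n (λ a r _ → conv-cong r (λ b c _ → e a b c))

conv₂-+ : (n : ℕ) (h k : ℕ → ℕ → ℕ → ℕ) → conv₂ n (λ a b c → h a b c + k a b c) ≡ conv₂ n h + conv₂ n k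
conv₂-+ n h k = trans (conv-cong n (λ a r _ → conv-+ r (h a) (k a))) (conv-+ n _ _)

conv₂-*ˡ : (n x : ℕ) (h : ℕ → ℕ → ℕ → ℕ) → conv₂ n (λ a b c → x * h a b c) ≡ x * conv₂ n h
conv₂-*ˡ n x h = trans (conv-cong n (λ a r _ → conv-*ˡ r x (h a))) (conv-*ˡ n x _)

conv₃-+ : (n : ℕ) (h k : ℕ → ℕ → ℕ → ℕ → ℕ) →
  conv₃ n (λ i j b c → h i j b c + k i j b c) ≡ conv₃ n h + conv₃ n k
conv₃-+ n h k = trans (conv-cong n (λ i s _ → conv₂-+ s (h i) (k i))) (conv-+ n _ _)

conv₂-conv : (n : ℕ) (h : ℕ → ℕ → ℕ → ℕ → ℕ) →
  conv₂ n (λ a b c → conv a (λ i j → h i j b c)) ≡ conv₃ n h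
conv₂-conv n h = trans (conv-cong n (λ a r _ → conv-exchange a r h)) (conv-assoc n (λ i j r → conv r (λ b c → h i j b c)))

-- A split that leaves both other faces on one side: the factor of the lone side is constant in the
-- inner sum, which then collects a full `E₃`.
bridge-term₁ : (n : ℕ) → conv₃ n (λ i j b c → F₁ i * F₃ j (suc b) (suc c)) ≡ conv n (λ i s → F₁ i * E₃ s)
bridge-term₁ n = conv-cong n (λ i s _ → trans (conv₂-*ˡ s (F₁ i) _) (cong (F₁ i *_) (E₃-conv s)))

bridge-term₁′ : (n : ℕ) → conv₃ n (λ i j b c → F₃ i (suc b) (suc c) * F₁ j) ≡ conv n (λ i s → F₁ i * E₃ s)
bridge-term₁′ n = trans (conv-left-comm n (λ i j r → conv r (λ b c → F₃ i (suc b) (suc c) * F₁ j)))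
  (trans (conv-cong n (λ j s _ → conv₂-cong s (λ i b c → *-comm (F₃ i (suc b) (suc c)) (F₁ j)))) (bridge-term₁ n))

-- A split with one other face on each side: once `j` and `b` change places, the variables of the
-- two factors are adjacent and the sum factorises.
bridge-term₂ : (n : ℕ) → conv₃ n (λ i j b c → F₂ i (suc b) * F₂ j (suc c)) ≡ conv n (λ p q → E₂ p * E₂ q)
bridge-term₂ n = begin
  conv₃ n (λ i j b c → F₂ i (suc b) * F₂ j (suc c))
    ≡⟨ conv-cong n (λ i s _ → conv-left-comm s (λ j b c → F₂ i (suc b) * F₂ j (suc c))) ⟩
  conv₃ n (λ i b j c → F₂ i (suc b) * F₂ j (suc c))
    ≡⟨ conv-cong n (λ i s _ → conv-cong s (λ b t _ → trans (conv-*ˡ t (F₂ i (suc b)) _) (cong (F₂ i (suc b) *_) (E₂-conv t)))) ⟩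
  conv₂ n (λ i b t → F₂ i (suc b) * E₂ t)
    ≡⟨ sym (conv-assoc n (λ i b t → F₂ i (suc b) * E₂ t)) ⟩
  conv n (λ p t → conv p (λ i b → F₂ i (suc b) * E₂ t))
    ≡⟨ conv-cong n (λ p t _ → trans (conv-*ʳ p (E₂ t) _) (cong (_* E₂ t) (E₂-conv p))) ⟩
  conv n (λ p q → E₂ p * E₂ q) ∎
  where open ≡-Reasoning

bridge-term₂′ : (n : ℕ) → conv₃ n (λ i j b c → F₂ i (suc c) * F₂ j (suc b)) ≡ conv n (λ p q → E₂ p * E₂ q)
bridge-term₂′ n = trans (conv-cong n (λ i s _ → conv-cong s (λ j r _ → conv-comm r (λ b c → F₂ i (suc c) * F₂ j (suc b)))))
  (bridge-term₂ n)

-- The merged face has length `a + b`, whatever the two lengths were. Grouping by `m = a + suc b`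
-- collects the weights `suc b` into a triangular number.
merge-term : (n : ℕ) → conv₂ n (λ a b c → suc b * F₂ (a + b) (suc c)) ≡
  conv n (λ m c → conv m (λ _ b → suc b) * F₂ (m ∸ 1) (suc c))
merge-term n = trans (sym (conv-assoc n (λ a b c → suc b * F₂ (a + b) (suc c))))
  (conv-cong n (λ m c _ → trans
    (conv-cong m (λ a b e → cong (λ k → suc b * F₂ k (suc c)) (sym (cong (_∸ 1) (trans (sym e) (+-suc a b))))))
    (conv-*ʳ m (F₂ (m ∸ 1) (suc c)) (λ _ b → suc b))))

merge-term′ : (n : ℕ) → conv₂ n (λ a b c → suc c * F₂ (a + c) (suc b)) ≡
  conv n (λ m c → conv m (λ _ b → suc b) * F₂ (m ∸ 1) (suc c))
merge-term′ n = trans (conv-cong n (λ a r _ → conv-comm r (λ b c → suc c * F₂ (a + c) (suc b)))) (merge-term n)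

merge-terms : (n : ℕ) →
  conv n (λ m c → conv m (λ _ b → suc b) * F₂ (m ∸ 1) (suc c)) + conv n (λ m c → conv m (λ _ b → suc b) * F₂ (m ∸ 1) (suc c))
  ≡ conv (n ∸ 1) (λ m c → suc m * suc (suc m) * F₂ m (suc c))
merge-terms n = trans (sym (conv-+ n _ _))
  (trans (conv-cong n (λ m c _ → trans (sym (*-distribʳ-+ (F₂ (m ∸ 1) (suc c)) (conv m (λ _ b → suc b)) _))
    (cong (_* F₂ (m ∸ 1) (suc c)) (conv-triangular m)))) (drop-zero n))
  where
  drop-zero : ∀ n → conv n (λ m c → m * suc m * F₂ (m ∸ 1) (suc c)) ≡ conv (n ∸ 1) (λ m c → suc m * suc (suc m) * F₂ m (suc c))
  drop-zero zero = refl
  drop-zero (suc n) = refl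

-- The four distributions of two further faces come in two pairs of equal sums, which explains the
-- factor 2; the two possible merges double the triangular number to `suc m * suc (suc m)`.
E₃-recurrence : (n : ℕ) → E₃ (suc n) ≡
  2 * (conv n (λ i s → F₁ i * E₃ s) + conv n (λ i s → E₂ i * E₂ s)) +
  conv (n ∸ 1) (λ m c → suc m * suc (suc m) * F₂ m (suc c))
E₃-recurrence n = begin
  conv₂ n (λ a b c → F₃ (suc a) (suc b) (suc c))
    ≡⟨ conv₂-cong n (λ a b c → treeCount-suc a (suc b ∷ suc c ∷ [])) ⟩
  -- The order is that of `bipartitions`: both faces with `u`, one on each side in two ways, both
  -- with `v`; each `+ 0` is the end of a list sum.
  conv₂ n (λ a b c → conv a (λ i j → h₁ i j b c + (h₂ i j b c + (h₃ i j b c + (h₄ i j b c + 0)))) + (k₁ a b c + (k₂ a b c + 0)))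
    ≡⟨ conv₂-+ n _ _ ⟩
  conv₂ n (λ a b c → conv a (λ i j → h₁ i j b c + (h₂ i j b c + (h₃ i j b c + (h₄ i j b c + 0))))) +
  conv₂ n (λ a b c → k₁ a b c + (k₂ a b c + 0))
    ≡⟨ cong₂ _+_ bridges merges ⟩
  X + (Y + (Y + X)) + conv (n ∸ 1) (λ m c → suc m * suc (suc m) * F₂ m (suc c))
    ≡⟨ cong (_+ conv (n ∸ 1) (λ m c → suc m * suc (suc m) * F₂ m (suc c))) (arith X Y) ⟩
  2 * (X + Y) + conv (n ∸ 1) (λ m c → suc m * suc (suc m) * F₂ m (suc c)) ∎
  where
  open ≡-Reasoning
  X = conv n (λ i s → F₁ i * E₃ s)
  Y = conv n (λ i s → E₂ i * E₂ s)
  h₁ h₂ h₃ h₄ : ℕ → ℕ → ℕ → ℕ → ℕ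
  h₁ i j b c = F₃ i (suc b) (suc c) * F₁ j
  h₂ i j b c = F₂ i (suc b) * F₂ j (suc c)
  h₃ i j b c = F₂ i (suc c) * F₂ j (suc b)
  h₄ i j b c = F₁ i * F₃ j (suc b) (suc c)
  k₁ k₂ : ℕ → ℕ → ℕ → ℕ
  k₁ a b c = suc b * F₂ (a + b) (suc c)
  k₂ a b c = suc c * F₂ (a + c) (suc b)
  arith : ∀ x y → x + (y + (y + x)) ≡ 2 * (x + y)
  arith = solve 2 (λ x y → x :+ (y :+ (y :+ x)) := con 2 :* (x :+ y)) refl
    where open +-*-Solver
  bridges : conv₂ n (λ a b c → conv a (λ i j → h₁ i j b c + (h₂ i j b c + (h₃ i j b c + (h₄ i j b c + 0))))) ≡ X + (Y + (Y + X))
  bridges = trans (conv₂-conv n _) (trans (conv₃-+ n h₁ _) (cong₂ _+_ (bridge-term₁′ n)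
    (trans (conv₃-+ n h₂ _) (cong₂ _+_ (bridge-term₂ n)
      (trans (conv₃-+ n h₃ _) (cong₂ _+_ (bridge-term₂′ n)
        (trans (conv-cong n (λ i s _ → conv₂-cong s (λ j b c → +-identityʳ (h₄ i j b c)))) (bridge-term₁ n))))))))
  merges : conv₂ n (λ a b c → k₁ a b c + (k₂ a b c + 0)) ≡ conv (n ∸ 1) (λ m c → suc m * suc (suc m) * F₂ m (suc c))
  merges = trans (conv₂-+ n k₁ _) (trans (cong₂ _+_ (merge-term n)
    (trans (conv₂-cong n (λ a b c → +-identityʳ (k₂ a b c))) (merge-term′ n))) (merge-terms n))

-- Passage from positions to edges, and the recurrence for `ε₀`

double : (n : ℕ) → 2 * n ≡ n + n
double n = cong (n +_) (+-identityʳ n)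

1≤double : (i : ℕ) → 1 ≤ 2 * suc i
1≤double i = s≤s z≤n

ε₀-1 : (i : ℕ) → ε₀ i 1 ≡ F₁ (i + i)
ε₀-1 zero = refl
ε₀-1 (suc i) = trans (countData-treeCount (2 * suc i) 1 _ (1≤double i))
  (trans (compositionSum-1 (i + 1 * suc i) treeCount) (cong F₁ (double (suc i))))

ε₀-2 : (i : ℕ) → ε₀ i 2 ≡ E₂ (i + i)
ε₀-2 zero = refl
ε₀-2 (suc i) = trans (countData-treeCount (2 * suc i) 2 _ (1≤double i))
  (trans (compositionSum-2 (2 * suc i) treeCount) (cong E₂ (double (suc i))))

ε₀-3 : (i : ℕ) → ε₀ i 3 ≡ E₃ (i + i)
ε₀-3 zero = refl
ε₀-3 (suc i) = trans (countData-treeCount (2 * suc i) 3 _ (1≤double i))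
  (trans (compositionSum-3 (2 * suc i) treeCount) (cong E₃ (double (suc i))))

ε̃₀-2 : (n k : ℕ) → k < n → ε̃₀ (suc n) (suc k) 2 ≡ F₂ (suc k) (suc (n ∸ suc k))
ε̃₀-2 n k k<n = trans (countData-treeCount (suc n) 2 (firstIs (suc k)) (s≤s z≤n))
  (trans (compositionSum-2 (suc n) (λ comp → if firstIs (suc k) comp then treeCount comp else 0))
    (conv-indicator n k (λ a b → F₂ (suc a) (suc b)) k<n))

F₁-odd : (i : ℕ) → F₁ (suc (i + i)) ≡ 0
F₁-odd i = treeCount-odd (suc (i + i) ∷ []) i (+-identityʳ _)

E₂-odd : (i : ℕ) → E₂ (suc (i + i)) ≡ 0
E₂-odd i = conv-zero (i + i) λ a b e → treeCount-odd (suc a ∷ suc b ∷ []) i (cong suc (trans (cong (a +_) (+-identityʳ (suc b))) e))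

-- Only even lengths survive, so both indices are halved. The top summand carries the factor
-- `g 0 = 0`, which is why the sum over edges stops one earlier.
convolution-of-doubles : (M : ℕ) (f g f' g' : ℕ → ℕ) → (∀ i → f (suc (i + i)) ≡ 0) → g 0 ≡ 0 →
  (∀ i → f' i ≡ f (i + i)) → (∀ i → g' i ≡ g (i + i)) →
  conv (suc (M + M)) (λ i s → f i * g s) ≡ sum (map (λ i → f' i * g' (suc M ∸ i ∸ 1)) (upTo M))
convolution-of-doubles M f g f' g' odd g0 f≡ g≡ = begin
  conv (suc (M + M)) (λ i s → f i * g s)                 ≡⟨ conv-even M (λ i s → f i * g s) (λ i j → cong (_* g j) (odd i)) ⟩
  conv (suc M) (λ i j → f (i + i) * g (j + j))           ≡⟨ conv-cong (suc M) (λ i j _ → sym (cong₂ _*_ (f≡ i) (g≡ j))) ⟩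
  conv (suc M) (λ i j → f' i * g' j)                     ≡⟨ conv-last M (λ i j → f' i * g' j) ⟩
  conv M (λ i j → f' i * g' (suc j)) + f' M * g' 0       ≡⟨ cong (conv M (λ i j → f' i * g' (suc j)) +_) (trans (cong (f' M *_) (trans (g≡ 0) g0)) (*-zeroʳ (f' M))) ⟩
  conv M (λ i j → f' i * g' (suc j)) + 0                 ≡⟨ +-identityʳ _ ⟩
  conv M (λ i j → f' i * g' (suc j))                     ≡⟨ conv-cong M (λ i j e → cong (λ k → f' i * g' k) (index i j e)) ⟩
  conv M (λ i j → f' i * g' (suc M ∸ i ∸ 1))             ≡⟨ conv-upTo M (λ i _ → f' i * g' (suc M ∸ i ∸ 1)) ⟩
  sum (map (λ i → f' i * g' (suc M ∸ i ∸ 1)) (upTo M))   ∎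
  where
  open ≡-Reasoning
  index : ∀ i j → i + suc j ≡ M → suc j ≡ suc M ∸ i ∸ 1
  index i j refl = sym (trans (cong (λ k → k ∸ i ∸ 1) (sym (+-suc i (suc j)))) (cong (_∸ 1) (m+n∸m≡n i (suc (suc j)))))

sum-map-+ : {A : Set} (f g : A → ℕ) (xs : List A) → sum (map (λ x → f x + g x) xs) ≡ sum (map f xs) + sum (map g xs)
sum-map-+ f g [] = refl
sum-map-+ f g (x ∷ xs) = trans (cong (f x + g x +_) (sum-map-+ f g xs)) (+-interchange (f x) (g x) _ _)

theorem5 : (N : ℕ) → 2 ≤ N →
    ε₀ N 3 ≡
    2 * Σ[ 0 to N ∸ 2 ] (λ i → ε₀ i 1 * ε₀ (N ∸ i ∸ 1) 3 + ε₀ i 2 * ε₀ (N ∸ i ∸ 1) 2)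
    + Σ[ 1 to 2 * N ∸ 3 ] (λ i → (i + 1) * (i + 2) * ε̃₀ (2 * N ∸ 2) i 2)
theorem5 (suc (suc N)) (s≤s (s≤s z≤n)) = begin
  ε₀ (suc M) 3
    ≡⟨ trans (ε₀-3 (suc M)) (cong E₃ (cong suc (+-suc M M))) ⟩
  E₃ (suc (suc (M + M)))
    ≡⟨ E₃-recurrence (suc (M + M)) ⟩
  2 * (conv (suc (M + M)) (λ i s → F₁ i * E₃ s) + conv (suc (M + M)) (λ i s → E₂ i * E₂ s)) +
  conv (M + M) (λ m c → suc m * suc (suc m) * F₂ m (suc c))
    ≡⟨ cong₂ (λ a b → 2 * a + b)
         (trans (cong₂ _+_
            (convolution-of-doubles M F₁ E₃ (λ i → ε₀ i 1) (λ i → ε₀ i 3) F₁-odd refl ε₀-1 ε₀-3)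
            (convolution-of-doubles M E₂ E₂ (λ i → ε₀ i 2) (λ i → ε₀ i 2) E₂-odd refl ε₀-2 ε₀-2))
           (sym (sum-map-+ (λ i → ε₀ i 1 * ε₀ (suc M ∸ i ∸ 1) 3) (λ i → ε₀ i 2 * ε₀ (suc M ∸ i ∸ 1) 2) (upTo M))))
         merged ⟩
  2 * Σ[ 0 to N ] (λ i → ε₀ i 1 * ε₀ (suc M ∸ i ∸ 1) 3 + ε₀ i 2 * ε₀ (suc M ∸ i ∸ 1) 2)
    + Σ[ 1 to 2 * suc M ∸ 3 ] (λ i → (i + 1) * (i + 2) * ε̃₀ (2 * suc M ∸ 2) i 2) ∎
  where
  open ≡-Reasoning
  -- `M` is one less than the number of edges, so the recurrence is applied with `suc (M + M)`
  -- positions besides the root dart.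
  M = suc N
  merged : conv (M + M) (λ m c → suc m * suc (suc m) * F₂ m (suc c)) ≡
    Σ[ 1 to 2 * suc M ∸ 3 ] (λ i → (i + 1) * (i + 2) * ε̃₀ (2 * suc M ∸ 2) i 2)
  merged = begin
    -- The summand with `m = 0` computes to 0, since an empty face beside another face has no tree;
    -- the lengths therefore start at 1.
    conv (N + M) (λ m c → suc (suc m) * suc (suc (suc m)) * F₂ (suc m) (suc c))
      ≡⟨ conv-upTo (N + M) _ ⟩
    sum (map (λ m → suc (suc m) * suc (suc (suc m)) * F₂ (suc m) (suc ((N + M) ∸ suc m))) (upTo (N + M)))
      ≡⟨ sum-map-cong _ _ (upTo (N + M)) (λ {m} m∈ → cong₂ _*_
           (cong₂ _*_ (+-comm 1 (suc m)) (+-comm 2 (suc m))) (sym (ε̃₀-2 (N + M) m (∈-upTo⁻ m∈)))) ⟩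
    Σ[ 1 to N + M ] (λ i → (i + 1) * (i + 2) * ε̃₀ (M + M) i 2)
      ≡⟨ cong (λ n → Σ[ 1 to n ∸ 3 ] (λ i → (i + 1) * (i + 2) * ε̃₀ (n ∸ 2) i 2)) (sym (trans (double (suc M)) (cong suc (+-suc M M)))) ⟩
    Σ[ 1 to 2 * suc M ∸ 3 ] (λ i → (i + 1) * (i + 2) * ε̃₀ (2 * suc M ∸ 2) i 2) ∎
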